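{- Let $n\ge 6$. The number $|G(n,n-6)/Z_n|$ of cyclic equivalence classes of $(n-6)$-dissections of a convex regular $n$-gon is \[ \frac{(n-3)(n-4)^2(n-5)}{24n(2n-5)}C_{n-2}+\frac{(n-4)^2}{4n}C_{n/2-2}+\frac{n-3}{9}C_{n/3-1}+\frac{1}{3}C_{n/6-1}. \]
   Context: For $n\ge 3$ and $0\le k\le n-3$, a $k$-dissection of a convex regular $n$-gon is a partition of it into $k+1$ polygons by $k$ pairwise non-crossing diagonals; $G(n,k)$ denotes the set of $k$-dissections (vertices labelled $0,\dots,n-1$ in cyclic order). The cyclic group $Z_n$ acts on $G(n,k)$ by rotation and $G(n,k)/Z_n$ is the set of orbits. For real $m$, $C_m=\frac{1}{m+1}\binom{2m}{m}$ if $m$ is a nonnegative integer and $C_m=0$ otherwise. -}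

module Defs where

open import Data.Nat as ℕ using (ℕ; zero; suc; _≤_; _<_; _∸_; _≡ᵇ_)
open import Data.Nat.Combinatorics using (_C_)
open import Data.Nat.DivMod using (_mod_)
open import Data.Fin using (Fin; toℕ)
open import Data.Integer as ℤ using (ℤ; +_; -[1+_])
open import Data.Rational as ℚ using (ℚ; _/_; mkℚ)
open import Data.Bool using (Bool; true; false; if_then_else_; _∨_)
open import Data.List using (List; map; allFin; length)
open import Data.Nat.ListAction using (sum)
open import Data.List.Relation.Unary.All using (All)
open import Data.List.Relation.Unary.Any using (Any)
open import Data.List.Relation.Unary.AllPairs using (AllPairs)
open import Data.Product using (_×_; ∃; ∃-syntax)
open import Relation.Nullary using (¬_)
open import Relation.Binary.PropositionalEquality using (_≡_)

-- a / d as a rational, with the (unused) convention a / 0 = 0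
frac : ℤ → ℕ → ℚ
frac a zero = ℚ.0ℚ
frac a (suc d) = a / suc d

catalanℚ : ℕ → ℚ
catalanℚ m = frac (+ ((2 ℕ.* m) C m)) (suc m)

-- C_m for rational m: C_m if m is a nonnegative integer, 0 otherwise
Cat : ℚ → ℚ
Cat (mkℚ (+ k) zero _) = catalanℚ k
Cat (mkℚ (+ k) (suc _) _) = ℚ.0ℚ
Cat (mkℚ -[1+ k ] _ _) = ℚ.0ℚ

-- A set of (undirected) diagonals of the n-gon with vertices 0..n-1,
-- encoded by a Boolean "adjacency" table; D i j = true means the
-- segment {i,j} is in the set.  We require the normal form i < j.
Config : ℕ → Set
Config n = Fin n → Fin n → Bool

-- {i,j} with i < j is a diagonal: not a side (j ≥ i+2, and not {0,n-1})
IsDiagonal : (n : ℕ) → Fin n → Fin n → Set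
IsDiagonal n i j = (suc (suc (toℕ i)) ≤ toℕ j) × ¬ ((toℕ i ≡ 0) × (suc (toℕ j) ≡ n))

Cross : {n : ℕ} → Fin n → Fin n → Fin n → Fin n → Set
Cross i j k l = (toℕ i < toℕ k) × (toℕ k < toℕ j) × (toℕ j < toℕ l)

count : {n : ℕ} → Config n → ℕ
count {n} D = sum (map (λ i → sum (map (λ j → if D i j then 1 else 0) (allFin n))) (allFin n))

IsDissection : (n k : ℕ) → Config n → Set
IsDissection n k D =
  (∀ i j → D i j ≡ true → IsDiagonal n i j)
  × (∀ i j k l → D i j ≡ true → D k l ≡ true → ¬ Cross i j k l)
  × (count D ≡ k)

Mem : {n : ℕ} → Config n → Fin n → Fin n → Bool
Mem D i j = D i j ∨ D j i

rot : (n : ℕ) .{{_ : ℕ.NonZero n}} → Fin n → Fin n → Fin n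
rot n r i = (toℕ i ℕ.+ toℕ r) mod n

Rotated : (n : ℕ) .{{_ : ℕ.NonZero n}} → Config n → Config n → Set
Rotated n D D' = ∃[ r ] (∀ i j → Mem D i j ≡ Mem D' (rot n r i) (rot n r j))

-- |G(n,k)/Z_n| = c : there is a list of k-dissections, pairwise in
-- distinct Z_n-orbits, meeting every orbit, of length c
NumOrbits : (n : ℕ) .{{_ : ℕ.NonZero n}} → ℕ → ℕ → Set
NumOrbits n k c =
  ∃[ L ] (All (IsDissection n k) L
         × AllPairs (λ D D' → ¬ Rotated n D D') L
         × (∀ D → IsDissection n k D → Any (Rotated n D) L)
         × length L ≡ c)

{-# OPTIONS --safe #-}
module Submission where

-- Burnside's lemma reduces the count to the numbers of dissections fixed by the rotations of the
-- n-gon.  Orient every diagonal away from a central cell; the dissection becomes a noncrossing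
-- family of arcs of the n-cycle.  Recording at each vertex v the cells below the arcs that start
-- at v turns such a family into free data: a number M v for every v, with bounded sum, and a
-- subset of {0, …, M v - 1} containing 0 when M v > 0.  The arcs are recovered from the data as
-- first passages of the walk with steps 1 - M v (the cycle lemma), and the data are counted by a
-- product of two binomial coefficients.
--
-- A dissection fixed by a nontrivial rotation of order d has an invariant central cell, so it is
-- an arc family of the (n/d)-cycle; as d divides n and n - 6 it divides 6.  The only other
-- invariant centre would be a diameter, which parity excludes.  For the trivial rotation, cut the
-- n-gon at the side {0, n-1}: dissections are the arc families of the (n-1)-cycle that leave
-- vertex 0 uncovered, and averaging over rotations of that cycle counts uncovered vertices.

open import Defs
open import Data.Nat as ℕ using (ℕ; zero; suc; _∸_; _≤_; _<_; s≤s; z≤n; z<s; _≤?_; _<?_; NonZero)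
open import Data.Nat.Properties hiding (_≟_)
open import Data.Nat.DivMod using (_%_; _mod_; m%n<n; m%n%n≡m%n; [m+n]%n≡m%n; [m+kn]%n≡m%n; m<n⇒m%n≡m; m≡m%n+[m/n]*n)
open import Data.Nat.Divisibility using (_∣_; divides; _∣?_; ∣m+n∣m⇒∣n; m∣m*n)
open import Data.Nat.GCD using (gcd; gcd[m,n]∣m; gcd[m,n]∣n; gcd-GCD; module Bézout)
open import Data.Nat.ListAction using () renaming (sum to sumᴸ)
open import Data.Nat.Tactic.RingSolver using (solve-∀)
open import Data.Bool as Bool using (Bool; true; false; if_then_else_; _∧_; _∨_)
open import Data.Bool.Properties using (∨-comm)
open import Data.Fin as Fin using (Fin; zero; suc; toℕ; fromℕ<; splitAt; join; _↑ˡ_; _↑ʳ_)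
open import Data.Fin.Properties using (injective⇒≤; toℕ<n; toℕ-fromℕ<; toℕ-injective; splitAt-↑ˡ; splitAt-↑ʳ; join-splitAt) renaming (suc-injective to Fin-suc-injective)
open import Data.List as List using (List; []; _∷_; length; allFin; map; tabulate)
open import Data.List.Properties using (map-tabulate; length-map)
open import Data.List.Membership.Propositional using (_∈_)
open import Data.List.Membership.Propositional.Properties using (∈-allFin)
open import Data.List.Relation.Unary.All as All using (All; []; _∷_)
import Data.List.Relation.Unary.All.Properties as Allₚ
open import Data.List.Relation.Unary.AllPairs as AllPairs using (AllPairs; []; _∷_)
import Data.List.Relation.Unary.AllPairs.Properties as AllPairsₚ
open import Data.List.Relation.Unary.Any as Any using (Any; here; there)
import Data.List.Relation.Unary.Any.Properties as Anyₚ
open import Data.Product using (_×_; _,_; proj₁; proj₂; ∃-syntax; Σ-syntax)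
open import Data.Sum using (_⊎_; inj₁; inj₂; [_,_]′)
open import Data.Empty using (⊥; ⊥-elim)
open import Function using (_∘_; const; id; Equivalence)
open import Relation.Nullary using (¬_; yes; no; Dec; does)
open import Relation.Nullary.Decidable using (map′; _×-dec_; _→-dec_)
open import Relation.Binary.Definitions using (tri<; tri≈; tri>)
open import Relation.Binary.PropositionalEquality
open import Algebra.Properties.CommutativeMonoid.Sum +-0-commutativeMonoid using (sum; sum-cong-≗; sum-replicate-zero; ∑-distrib-+)
open ≡-Reasoning

-- One notion serves every case: arcs of the N-cycle of length at most T + 1, with T = N - 1 or T =
-- N - 2. For rotations of order at least 3 an arc may go once round the quotient cycle, its lifts
-- being the sides of the central cell, so T = N - 1. For order 2 such an arc would be a diameter,
-- and in the cut polygon it would be the cut side itself; both call for T = N - 2. The obstacle is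
-- the trivial rotation: "vertex 0 is uncovered" is not a condition on single entries of the data.
-- Averaging therefore needs only the data weighted by 2 + slack. The product form survives this
-- weight, because the rows of the true bits and the lengths of the runs of false bits after them
-- are independent choices, and the weighted count of the second choice still obeys Pascal's rule.

-- Linear inequalities over ℕ by certified elimination.

module LinearArithmetic where
  open import Data.Nat using (_+_; _*_; _≤ᵇ_)
  open import Data.Integer as ℤ using (ℤ; +_; -[1+_])
  open import Data.Bool using (T)
  open import Data.Bool.Properties using (T-∧)
  open import Data.List using (_++_; concatMap)
  open import Data.Vec as Vec using (Vec; []; _∷_; lookup)
  open import Data.Vec.N-ary using (N-ary; _$ⁿ_)
  open import Data.Unit using (⊤; tt)
  open import Data.Maybe using (Maybe; just; nothing)

  infixl 7 _⊕_
  infixl 8 _⊛_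
  infix 5 _≼_ _≺_ _≐_
  infixr 4 _⇒_

  data Expr (n : ℕ) : Set where
    var : Fin n → Expr n
    con : ℕ → Expr n
    _⊕_ : Expr n → Expr n → Expr n
    _⊛_ : ℕ → Expr n → Expr n

  data Goal (n : ℕ) : Set where
    _≼_ _≺_ _≐_ : Expr n → Expr n → Goal n
    ff : Goal n
    _⇒_ : Goal n → Goal n → Goal n

  module _ {n : ℕ} where

    ⟦_⟧ : Expr n → Vec ℕ n → ℕ
    ⟦ var i ⟧ ρ = lookup ρ i
    ⟦ con k ⟧ ρ = k
    ⟦ a ⊕ b ⟧ ρ = ⟦ a ⟧ ρ + ⟦ b ⟧ ρ
    ⟦ k ⊛ a ⟧ ρ = k * ⟦ a ⟧ ρ

    ⟦_⟧ᵍ : Goal n → Vec ℕ n → Set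
    ⟦ a ≼ b ⟧ᵍ ρ = ⟦ a ⟧ ρ ≤ ⟦ b ⟧ ρ
    ⟦ a ≺ b ⟧ᵍ ρ = ⟦ a ⟧ ρ < ⟦ b ⟧ ρ
    ⟦ a ≐ b ⟧ᵍ ρ = ⟦ a ⟧ ρ ≡ ⟦ b ⟧ ρ
    ⟦ ff ⟧ᵍ ρ = ⊥
    ⟦ p ⇒ q ⟧ᵍ ρ = ⟦ p ⟧ᵍ ρ → ⟦ q ⟧ᵍ ρ

  -- Linear forms: the constant term comes first.
  Form : ℕ → Set
  Form n = Vec ℕ (suc n)

  eval : ∀ {n} → Vec ℕ n → Vec ℕ n → ℕ
  eval [] [] = 0
  eval (c ∷ cs) (x ∷ xs) = c * x + eval cs xs

  _⊞_ : ∀ {n} → Vec ℕ n → Vec ℕ n → Vec ℕ n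
  _⊞_ = Vec.zipWith _+_

  _⊠_ : ∀ {n} → ℕ → Vec ℕ n → Vec ℕ n
  k ⊠ v = Vec.map (k *_) v

  unit : ∀ {n} → Fin n → Vec ℕ n
  unit zero = 1 ∷ Vec.replicate _ 0
  unit (suc i) = 0 ∷ unit i

  form : ∀ {n} → Expr n → Form n
  form (var i) = 0 ∷ unit i
  form (con k) = k ∷ Vec.replicate _ 0
  form (a ⊕ b) = form a ⊞ form b
  form (k ⊛ a) = k ⊠ form a

  eval-⊞ : ∀ {n} (u v x : Vec ℕ n) → eval (u ⊞ v) x ≡ eval u x + eval v x
  eval-⊞ [] [] [] = refl
  eval-⊞ (a ∷ u) (b ∷ v) (x ∷ xs) rewrite eval-⊞ u v xs = lem a b x (eval u xs) (eval v xs)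
    where
    lem : ∀ a b x p q → (a + b) * x + (p + q) ≡ a * x + p + (b * x + q)
    lem = solve-∀

  eval-⊠ : ∀ {n} k (u x : Vec ℕ n) → eval (k ⊠ u) x ≡ k * eval u x
  eval-⊠ k [] [] = sym (*-zeroʳ k)
  eval-⊠ k (a ∷ u) (x ∷ xs) rewrite eval-⊠ k u xs = lem k a x (eval u xs)
    where
    lem : ∀ k a x p → k * a * x + k * p ≡ k * (a * x + p)
    lem = solve-∀

  eval-0 : ∀ {n} (x : Vec ℕ n) → eval (Vec.replicate n 0) x ≡ 0
  eval-0 [] = refl
  eval-0 (x ∷ xs) = eval-0 xs

  eval-unit : ∀ {n} (i : Fin n) (x : Vec ℕ n) → eval (unit i) x ≡ lookup x i
  eval-unit zero (x ∷ xs) rewrite eval-0 xs = trans (+-identityʳ _) (+-identityʳ x)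
  eval-unit (suc i) (x ∷ xs) = eval-unit i xs

  eval-form : ∀ {n} (e : Expr n) (ρ : Vec ℕ n) → eval (form e) (1 ∷ ρ) ≡ ⟦ e ⟧ ρ
  eval-form (var i) ρ = eval-unit i ρ
  eval-form (con k) ρ rewrite eval-0 ρ = trans (+-identityʳ _) (*-identityʳ k)
  eval-form (a ⊕ b) ρ = trans (eval-⊞ (form a) (form b) (1 ∷ ρ)) (cong₂ _+_ (eval-form a ρ) (eval-form b ρ))
  eval-form (k ⊛ a) ρ = trans (eval-⊠ k (form a) (1 ∷ ρ)) (cong (k *_) (eval-form a ρ))

  -- A pair (l , r) stands for the constraint l ≤ r.
  Ineq : ℕ → Set
  Ineq n = Form n × Form n

  Holds : ∀ {n} → Vec ℕ n → List (Ineq n) → Set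
  Holds ρ [] = ⊤
  Holds ρ ((l , r) ∷ cs) = eval l (1 ∷ ρ) ≤ eval r (1 ∷ ρ) × Holds ρ cs

  combine : ∀ {n} → List ℕ → List (Ineq n) → Ineq n
  combine (k ∷ ks) ((l , r) ∷ cs) with combine ks cs
  ... | l′ , r′ = (k ⊠ l) ⊞ l′ , (k ⊠ r) ⊞ r′
  combine _ _ = Vec.replicate _ 0 , Vec.replicate _ 0

  combine-holds : ∀ {n} (ρ : Vec ℕ n) ks cs → Holds ρ cs →
    eval (proj₁ (combine ks cs)) (1 ∷ ρ) ≤ eval (proj₂ (combine ks cs)) (1 ∷ ρ)
  combine-holds ρ [] cs h = ≤-refl
  combine-holds ρ (k ∷ ks) [] h = ≤-refl
  combine-holds ρ (k ∷ ks) ((l , r) ∷ cs) (h , hs)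
    rewrite eval-⊞ (k ⊠ l) (proj₁ (combine ks cs)) (1 ∷ ρ)
          | eval-⊞ (k ⊠ r) (proj₂ (combine ks cs)) (1 ∷ ρ)
          | eval-⊠ k l (1 ∷ ρ) | eval-⊠ k r (1 ∷ ρ)
    = +-mono-≤ (*-monoʳ-≤ k h) (combine-holds ρ ks cs hs)

  _≤ᵛ_ : ∀ {n} → Vec ℕ n → Vec ℕ n → Bool
  [] ≤ᵛ [] = true
  (a ∷ u) ≤ᵛ (b ∷ v) = (a ≤ᵇ b) ∧ (u ≤ᵛ v)

  ≤ᵛ-eval : ∀ {n} (u v x : Vec ℕ n) → T (u ≤ᵛ v) → eval u x ≤ eval v x
  ≤ᵛ-eval [] [] [] _ = z≤n
  ≤ᵛ-eval (a ∷ u) (b ∷ v) (x ∷ xs) h with Equivalence.to T-∧ h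
  ... | p , q = +-mono-≤ (*-monoˡ-≤ x (≤ᵇ⇒≤ a b p)) (≤ᵛ-eval u v xs q)

  -- The left constant exceeds the right one and no left coefficient is below its counterpart; as
  -- the variables are natural numbers, the left side is then always larger.
  absurdᵇ : ∀ {n} → Ineq n → Bool
  absurdᵇ (a ∷ u , b ∷ v) = (suc b ∷ v) ≤ᵛ (a ∷ u)

  absurd-sound : ∀ {n} (ρ : Vec ℕ n) (c : Ineq n) → T (absurdᵇ c) → ¬ (eval (proj₁ c) (1 ∷ ρ) ≤ eval (proj₂ c) (1 ∷ ρ))
  absurd-sound ρ (a ∷ u , b ∷ v) t h = n≮n _ (≤-trans (≤ᵛ-eval (suc b ∷ v) (a ∷ u) (1 ∷ ρ) t) h)

  -- Fourier–Motzkin elimination; a row carries the coefficients of l - r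
  -- and the multipliers of the original constraints that produce it.
  Row : ℕ → Set
  Row n = ℤ × Vec ℤ n × List ℕ

  addList : List ℕ → List ℕ → List ℕ
  addList (x ∷ xs) (y ∷ ys) = x + y ∷ addList xs ys
  addList [] ys = ys
  addList xs [] = xs

  module _ {n} (i : Fin (suc n)) where

    cross : Row (suc n) → Row (suc n) → List (Row n)
    cross (c , as , ks) (d , bs , ls) with lookup as i | lookup bs i
    ... | + suc a | -[1+ b ] =
      ( (+ suc b) ℤ.* c ℤ.+ (+ suc a) ℤ.* d
      , Vec.zipWith (λ x y → (+ suc b) ℤ.* x ℤ.+ (+ suc a) ℤ.* y) (Vec.removeAt as i) (Vec.removeAt bs i)
      , addList (map (suc b *_) ks) (map (suc a *_) ls)) ∷ []
    ... | _ | _ = []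

    -- Variables range over ℕ, so a nonnegative coefficient may be dropped.
    keep : Row (suc n) → List (Row n)
    keep (c , as , ks) with lookup as i
    ... | -[1+ _ ] = []
    ... | + _ = (c , Vec.removeAt as i , ks) ∷ []

    eliminate : List (Row (suc n)) → List (Row n)
    eliminate rs = concatMap keep rs ++ concatMap (λ p → concatMap (cross p) rs) rs

    positives negatives : List (Row (suc n)) → ℕ
    positives [] = 0
    positives ((_ , as , _) ∷ rs) with lookup as i
    ... | + suc _ = suc (positives rs)
    ... | _ = positives rs
    negatives [] = 0
    negatives ((_ , as , _) ∷ rs) with lookup as i
    ... | -[1+ _ ] = suc (negatives rs)
    ... | _ = negatives rs

  -- Each pair of a positive and a negative coefficient yields a new row, so the variable with the
  -- fewest such pairs keeps the system small.
  cheapest : ∀ {n} → List (Row (suc n)) → Fin (suc n)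
  cheapest {n} rs = proj₂ (List.foldr better (cost zero , zero) (List.allFin (suc n)))
    where
    cost : Fin (suc n) → ℕ
    cost i = positives i rs * negatives i rs
    better : Fin (suc n) → ℕ × Fin (suc n) → ℕ × Fin (suc n)
    better i (c , j) = if cost i ≤ᵇ c then (cost i , i) else (c , j)

  nonnegᵇ : ∀ {n} → Vec ℤ n → Bool
  nonnegᵇ [] = true
  nonnegᵇ (+ _ ∷ as) = nonnegᵇ as
  nonnegᵇ (-[1+ _ ] ∷ _) = false

  find : ∀ {n} → List (Row n) → Maybe (List ℕ)
  find [] = nothing
  find ((+ suc _ , as , ks) ∷ rs) = if nonnegᵇ as then just ks else find rs
  find (_ ∷ rs) = find rs

  search : ∀ {n} → List (Row n) → List ℕ
  search {n} rs with find rs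
  ... | just ks = ks
  search {zero} rs | nothing = []
  search {suc n} rs | nothing = search (eliminate (cheapest rs) rs)

  rows : ∀ {n} → ℕ → List (Ineq n) → List (Row n)
  rows i [] = []
  rows i ((l ∷ ls , r ∷ rs) ∷ cs) =
    (l ℤ.⊖ r , Vec.zipWith ℤ._⊖_ ls rs , List.replicate i 0 ++ 1 ∷ []) ∷ rows (suc i) cs

  -- The elimination is used only as an oracle for multipliers; the combination they define is
  -- checked afresh, so soundness rests on `combine` and `absurdᵇ` alone.
  refutableᵇ : ∀ {n} → List (Ineq n) → Bool
  refutableᵇ cs = absurdᵇ (combine (search (rows 0 cs)) cs)

  refute : ∀ {n} (ρ : Vec ℕ n) cs → T (refutableᵇ cs) → ¬ Holds ρ cs
  refute ρ cs t h = absurd-sound ρ (combine ks cs) t (combine-holds ρ ks cs h)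
    where ks = search (rows 0 cs)

  lt : ∀ {n} → Expr n → Expr n → Ineq n
  lt a b = form (con 1 ⊕ a) , form b

  le : ∀ {n} → Expr n → Expr n → Ineq n
  le a b = form a , form b

  validᵇ : ∀ {n} → List (Ineq n) → Goal n → Bool
  validᵇ cs (a ≼ b) = refutableᵇ (lt b a ∷ cs)
  validᵇ cs (a ≺ b) = refutableᵇ (le b a ∷ cs)
  validᵇ cs (a ≐ b) = refutableᵇ (lt b a ∷ cs) ∧ refutableᵇ (lt a b ∷ cs)
  validᵇ cs ff = refutableᵇ cs
  validᵇ cs (a ≼ b ⇒ g) = validᵇ (le a b ∷ cs) g
  validᵇ cs (a ≺ b ⇒ g) = validᵇ (lt a b ∷ cs) g
  validᵇ cs (a ≐ b ⇒ g) = validᵇ (le a b ∷ le b a ∷ cs) g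
  validᵇ cs (_ ⇒ g) = validᵇ cs g

  module _ {n} (ρ : Vec ℕ n) where

    ≤-form : ∀ a b → ⟦ a ⟧ ρ ≤ ⟦ b ⟧ ρ → eval (form a) (1 ∷ ρ) ≤ eval (form b) (1 ∷ ρ)
    ≤-form a b h rewrite eval-form a ρ | eval-form b ρ = h

    valid-≼ : ∀ cs → Holds ρ cs → ∀ a b → T (refutableᵇ (lt b a ∷ cs)) → ⟦ a ⟧ ρ ≤ ⟦ b ⟧ ρ
    valid-≼ cs h a b t with ⟦ a ⟧ ρ ℕ.≤? ⟦ b ⟧ ρ
    ... | yes p = p
    ... | no ¬p = ⊥-elim (refute ρ (lt b a ∷ cs) t (≤-form (con 1 ⊕ b) a (≰⇒> ¬p) , h))

    valid : ∀ cs g → Holds ρ cs → T (validᵇ cs g) → ⟦ g ⟧ᵍ ρ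
    valid cs (a ≼ b) h t = valid-≼ cs h a b t
    valid cs (a ≺ b) h t with ⟦ a ⟧ ρ ℕ.<? ⟦ b ⟧ ρ
    ... | yes p = p
    ... | no ¬p = ⊥-elim (refute ρ (le b a ∷ cs) t (≤-form b a (≮⇒≥ ¬p) , h))
    valid cs (a ≐ b) h t with Equivalence.to T-∧ t
    ... | p , q = ≤-antisym (valid-≼ cs h a b p) (valid-≼ cs h b a q)
    valid cs ff h t = ⊥-elim (refute ρ cs t h)
    valid cs (a ≼ b ⇒ g) h t p = valid _ g (≤-form a b p , h) t
    valid cs (a ≺ b ⇒ g) h t p = valid _ g (≤-form (con 1 ⊕ a) b p , h) t
    valid cs (a ≐ b ⇒ g) h t p = valid _ g (≤-form a b (≤-reflexive p) , ≤-form b a (≤-reflexive (sym p)) , h) t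
    valid cs (ff ⇒ g) h t p = valid cs g h t
    valid cs ((_ ⇒ _) ⇒ g) h t p = valid cs g h t

  vars : ∀ n → Vec (Expr n) n
  vars n = Vec.map var (Vec.allFin n)

  Curried∀ : ∀ n → (Vec ℕ n → Set) → Set
  Curried∀ zero P = P []
  Curried∀ (suc n) P = (x : ℕ) → Curried∀ n (P ∘ (x ∷_))

  curry∀ : ∀ n {P : Vec ℕ n → Set} → (∀ ρ → P ρ) → Curried∀ n P
  curry∀ zero h = h []
  curry∀ (suc n) h x = curry∀ n (h ∘ (x ∷_))

  -- The implicit argument has a type that evaluates to `⊤` when the search succeeds, so it is
  -- filled in at every closed use.
  lin : ∀ n (f : N-ary n (Expr n) (Goal n)) {_ : T (validᵇ [] (f $ⁿ vars n))} → Curried∀ n ⟦ f $ⁿ vars n ⟧ᵍ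
  lin n f {t} = curry∀ n λ ρ → valid ρ [] (f $ⁿ vars n) tt t

open LinearArithmetic using (lin; con; _⊕_; _⊛_; _≼_; _≺_; _≐_; ff; _⇒_)

-- Finite sums, periodic functions and least elements.

module Sums where
  open import Data.Nat using (_+_; _*_)
  open import Data.Nat.DivMod using (_/_)

  𝟙 : Bool → ℕ
  𝟙 b = if b then 1 else 0

  true≢false : ∀ {b} → b ≡ true → b ≡ false → ⊥
  true≢false refl ()

  bool-ext : ∀ {a b} → (a ≡ true → b ≡ true) → (b ≡ true → a ≡ true) → a ≡ b
  bool-ext {true} {true} f g = refl
  bool-ext {true} {false} f g = sym (f refl)
  bool-ext {false} {true} f g = g refl
  bool-ext {false} {false} f g = refl

  ¬true⇒false : ∀ {b} → ¬ (b ≡ true) → b ≡ false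
  ¬true⇒false {true} h = ⊥-elim (h refl)
  ¬true⇒false {false} h = refl

  ∧-intro : ∀ {a b} → a ≡ true → b ≡ true → a ∧ b ≡ true
  ∧-intro refl refl = refl

  ∧-fst : ∀ {a b} → a ∧ b ≡ true → a ≡ true
  ∧-fst {true} _ = refl

  ∧-snd : ∀ {a b} → a ∧ b ≡ true → b ≡ true
  ∧-snd {true} h = h

  ∧-congʳ : ∀ {a b c} → (a ≡ true → b ≡ c) → a ∧ b ≡ a ∧ c
  ∧-congʳ {true} h = h refl
  ∧-congʳ {false} h = refl

  ∨-elim : ∀ {a b} → a ∨ b ≡ true → a ≡ true ⊎ b ≡ true
  ∨-elim {true} _ = inj₁ refl
  ∨-elim {false} h = inj₂ h

  ∨-introˡ : ∀ {a b} → a ≡ true → a ∨ b ≡ true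
  ∨-introˡ refl = refl

  ∨-introʳ : ∀ {a b} → b ≡ true → a ∨ b ≡ true
  ∨-introʳ {true} refl = refl
  ∨-introʳ {false} refl = refl

  does⇒ : ∀ {P : Set} (d : Dec P) → does d ≡ true → P
  does⇒ (yes p) _ = p

  ⇒does : ∀ {P : Set} (d : Dec P) → P → does d ≡ true
  ⇒does (yes _) _ = refl
  ⇒does (no ¬p) p = ⊥-elim (¬p p)

  abstract
    m≤n⇒∃ : ∀ {m n} → m ≤ n → ∃[ d ] m + d ≡ n
    m≤n⇒∃ {m} {n} h = n ∸ m , m+[n∸m]≡n h

  +-swapʳ : ∀ a b c → a + b + c ≡ a + c + b
  +-swapʳ a b c = trans (+-assoc a b c) (trans (cong (a +_) (+-comm b c)) (sym (+-assoc a c b)))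

  ∑ : ℕ → (ℕ → ℕ) → ℕ
  ∑ zero f = 0
  ∑ (suc n) f = f 0 + ∑ n (f ∘ suc)

  ∑-cong : ∀ n {f g} → (∀ i → i < n → f i ≡ g i) → ∑ n f ≡ ∑ n g
  ∑-cong zero h = refl
  ∑-cong (suc n) h = cong₂ _+_ (h 0 z<s) (∑-cong n λ i i<n → h (suc i) (s≤s i<n))

  ∑-0 : ∀ n {f} → (∀ i → i < n → f i ≡ 0) → ∑ n f ≡ 0
  ∑-0 zero h = refl
  ∑-0 (suc n) h = cong₂ _+_ (h 0 z<s) (∑-0 n λ i i<n → h (suc i) (s≤s i<n))

  ∑-const : ∀ n c → ∑ n (λ _ → c) ≡ n * c
  ∑-const zero c = refl
  ∑-const (suc n) c = cong (c +_) (∑-const n c)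

  ∑-+ : ∀ n f g → ∑ n (λ i → f i + g i) ≡ ∑ n f + ∑ n g
  ∑-+ zero f g = refl
  ∑-+ (suc n) f g = trans (cong (f 0 + g 0 +_) (∑-+ n (f ∘ suc) (g ∘ suc)))
    (lem (f 0) (g 0) (∑ n (f ∘ suc)) (∑ n (g ∘ suc)))
    where
    lem : ∀ a b c d → a + b + (c + d) ≡ a + c + (b + d)
    lem = solve-∀

  ∑-split : ∀ a b f → ∑ (a + b) f ≡ ∑ a f + ∑ b (λ i → f (a + i))
  ∑-split zero b f = refl
  ∑-split (suc a) b f = trans (cong (f 0 +_) (∑-split a b (f ∘ suc))) (sym (+-assoc (f 0) _ _))

  ∑-last : ∀ n f → ∑ (suc n) f ≡ ∑ n f + f n
  ∑-last zero f = +-identityʳ (f 0)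
  ∑-last (suc n) f = trans (cong (f 0 +_) (∑-last n (f ∘ suc))) (sym (+-assoc (f 0) _ _))

  ∑-swap : ∀ m n (f : ℕ → ℕ → ℕ) → ∑ m (λ i → ∑ n (f i)) ≡ ∑ n (λ j → ∑ m (λ i → f i j))
  ∑-swap zero n f = sym (∑-0 n λ _ _ → refl)
  ∑-swap (suc m) n f = trans (cong (∑ n (f 0) +_) (∑-swap m n (f ∘ suc)))
    (sym (∑-+ n (f 0) (λ j → ∑ m (λ i → f (suc i) j))))

  ∑-monoˡ : ∀ {m n} f → m ≤ n → ∑ m f ≤ ∑ n f
  ∑-monoˡ {m} f h with m≤n⇒∃ h
  ... | d , refl = subst (∑ m f ≤_) (sym (∑-split m d f)) (m≤m+n _ _)

  ∑-extend : ∀ {m n} f → m ≤ n → (∀ i → m ≤ i → f i ≡ 0) → ∑ n f ≡ ∑ m f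
  ∑-extend {m} f h z with m≤n⇒∃ h
  ... | d , refl = trans (∑-split m d f) (trans (cong (∑ m f +_) (∑-0 d λ i _ → z (m + i) (m≤m+n m i))) (+-identityʳ _))

  ∑-rev : ∀ n f → ∑ (suc n) (λ i → f (n ∸ i)) ≡ ∑ (suc n) f
  ∑-rev zero f = refl
  ∑-rev (suc n) f = begin
    f (suc n) + ∑ (suc n) (λ i → f (n ∸ i)) ≡⟨ cong (f (suc n) +_) (∑-rev n f) ⟩
    f (suc n) + ∑ (suc n) f ≡⟨ +-comm (f (suc n)) _ ⟩
    ∑ (suc n) f + f (suc n) ≡⟨ ∑-last (suc n) f ⟨
    ∑ (suc (suc n)) f ∎

  ∑-single : ∀ n f i → i < n → (∀ j → j < n → j ≢ i → f j ≡ 0) → ∑ n f ≡ f i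
  ∑-single (suc n) f zero h z = trans (cong (f 0 +_) (∑-0 n λ j j<n → z (suc j) (s≤s j<n) λ ())) (+-identityʳ _)
  ∑-single (suc n) f (suc i) (s≤s h) z =
    trans (cong (_+ ∑ n (f ∘ suc)) (z 0 z<s λ ()))
          (∑-single n (f ∘ suc) i h λ j j<n j≢i → z (suc j) (s≤s j<n) (j≢i ∘ suc-injective))

  -- Functions on ℤ/N are represented by N-periodic functions on ℕ.
  Periodic : {X : Set} → ℕ → (ℕ → X) → Set
  Periodic N f = ∀ v → f (v + N) ≡ f v

  periodic-* : ∀ {X : Set} {N} {f : ℕ → X} → Periodic N f → ∀ d → Periodic (d * N) f
  periodic-* {f = f} p zero v = cong f (+-identityʳ v)
  periodic-* {N = N} {f} p (suc d) v =
    trans (cong f (sym (+-assoc v N (d * N)))) (trans (periodic-* p d (v + N)) (p v))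

  periodic-∸ : ∀ {X : Set} {a b} {f : ℕ → X} c → Periodic a f → Periodic b f → a ≡ b + c → Periodic c f
  periodic-∸ {a = a} {b} {f} c p q refl v = trans (sym (q (v + c)))
    (trans (cong f (trans (+-assoc v c b) (cong (v +_) (+-comm c b)))) (p v))

  ∑-shift : ∀ {n f} → Periodic n f → ∀ v → ∑ n (λ j → f (v + j)) ≡ ∑ n f
  ∑-shift {n} {f} p zero = refl
  ∑-shift {zero} {f} p (suc v) = refl
  ∑-shift {suc m} {f} p (suc v) = begin
    ∑ (suc m) (λ j → f (suc v + j)) ≡⟨ ∑-last m _ ⟩
    ∑ m (λ j → f (suc v + j)) + f (suc v + m) ≡⟨ cong₂ _+_ (∑-cong m λ j _ → cong f (sym (+-suc v j)))
          (trans (cong f (trans (sym (+-suc v m)) refl)) (trans (p v) (cong f (sym (+-identityʳ v))))) ⟩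
    ∑ m (λ j → f (v + suc j)) + f (v + 0) ≡⟨ +-comm _ (f (v + 0)) ⟩
    ∑ (suc m) (λ j → f (v + j)) ≡⟨ ∑-shift p v ⟩
    ∑ (suc m) f ∎

  ∑-periods : ∀ {g f} → Periodic g f → ∀ d → ∑ (d * g) f ≡ d * ∑ g f
  ∑-periods p zero = refl
  ∑-periods {g} {f} p (suc d) = trans (∑-split g (d * g) f)
    (cong (∑ g f +_) (trans (∑-cong (d * g) λ i _ → trans (cong f (+-comm g i)) (p i)) (∑-periods p d)))

  sum-toℕ : ∀ n (f : ℕ → ℕ) → sum {n} (f ∘ toℕ) ≡ ∑ n f
  sum-toℕ zero f = refl
  sum-toℕ (suc n) f = cong (f 0 +_) (sum-toℕ n (f ∘ suc))

  least : ∀ (P : ℕ → Bool) n → P n ≡ true → ∃[ m ] m ≤ n × P m ≡ true × (∀ i → i < m → P i ≡ false)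
  least P n pn with P 0 in eq
  ... | true = 0 , z≤n , eq , λ _ ()
  least P zero pn | false = ⊥-elim (true≢false pn eq)
  least P (suc n) pn | false with least (P ∘ suc) n pn
  ... | m , m≤n , pm , below = suc m , s≤s m≤n , pm , λ { zero _ → eq ; (suc i) (s≤s i<m) → below i i<m }

  periodic-% : ∀ {X : Set} {N} .{{_ : ℕ.NonZero N}} {f : ℕ → X} → Periodic N f → ∀ v → f v ≡ f (v % N)
  periodic-% {N = N} {f = f} p v = trans (cong f (m≡m%n+[m/n]*n v N)) (periodic-* p (v / N) (v % N))

  argmax : ∀ (f : ℕ → ℕ) n → ∃[ v ] v < suc n × (∀ u → u < suc n → f u ≤ f v)
  argmax f zero = 0 , s≤s z≤n , λ { zero _ → ≤-refl ; (suc u) (s≤s ()) }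
  argmax f (suc n) with argmax (f ∘ suc) n
  ... | v , v<n , max with f (suc v) ℕ.≤? f 0
  ... | yes p = 0 , s≤s z≤n , λ { zero _ → ≤-refl ; (suc u) (s≤s h) → ≤-trans (max u h) p }
  ... | no ¬p = suc v , s≤s v<n , λ { zero _ → <⇒≤ (≰⇒> ¬p) ; (suc u) (s≤s h) → max u h }

open Sums

-- Counting tables by enumerations with `Fin N`.

module Enumerations where
  open import Data.Nat using (_+_; _*_)

  record Selection {N} (q : Fin N → Bool) (K : ℕ) : Set where
    field
      pick : Fin K → Fin N
      pick-true : ∀ i → q (pick i) ≡ true
      pick-inj : ∀ {i j} → pick i ≡ pick j → i ≡ j
      find : ∀ i → q i ≡ true → Fin K
      pick-find : ∀ i h → pick (find i h) ≡ i

  open Selection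

  select : ∀ {N} (q : Fin N → Bool) → Selection q (sum (𝟙 ∘ q))
  select {zero} q = record { pick = λ () ; pick-true = λ () ; pick-inj = λ {} ; find = λ () ; pick-find = λ () }
  select {suc N} q with q zero in eq | select (q ∘ suc)
  ... | false | s = record
    { pick = suc ∘ pick s
    ; pick-true = pick-true s
    ; pick-inj = pick-inj s ∘ Fin-suc-injective
    ; find = λ { zero h → ⊥-elim (true≢false h eq) ; (suc i) h → find s i h }
    ; pick-find = λ { zero h → ⊥-elim (true≢false h eq) ; (suc i) h → cong suc (pick-find s i h) }
    }
  ... | true | s = record
    { pick = pk
    ; pick-true = λ { zero → eq ; (suc i) → pick-true s i }
    ; pick-inj = inj
    ; find = λ { zero h → zero ; (suc i) h → suc (find s i h) }
    ; pick-find = λ { zero h → refl ; (suc i) h → cong suc (pick-find s i h) }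
    }
    where
    pk : Fin (suc (sum (𝟙 ∘ q ∘ suc))) → Fin (suc N)
    pk zero = zero
    pk (suc i) = suc (pick s i)
    inj : ∀ {i j} → pk i ≡ pk j → i ≡ j
    inj {zero} {zero} _ = refl
    inj {suc i} {suc j} h = cong suc (pick-inj s (Fin-suc-injective h))

  -- Counting through a relation avoids naming a map; applied to a one-to-one relation and to its
  -- converse it yields equality of two counts.
  count-≤ : ∀ n m (f g : ℕ → Bool) (R : ℕ → ℕ → Set) →
    (∀ i → i < n → f i ≡ true → ∃[ j ] (j < m × g j ≡ true × R i j)) →
    (∀ {i i′ j} → R i j → R i′ j → i ≡ i′) →
    ∑ n (𝟙 ∘ f) ≤ ∑ m (𝟙 ∘ g)
  count-≤ n m f g R total inj =
    subst₂ _≤_ (sum-toℕ n (𝟙 ∘ f)) (sum-toℕ m (𝟙 ∘ g)) (injective⇒≤ {f = h} h-inj)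
    where
    s = select {n} (f ∘ toℕ)
    s′ = select {m} (g ∘ toℕ)
    img : ∀ i → ∃[ j ] (j < m × g j ≡ true × R (toℕ (pick s i)) j)
    img i = total _ (toℕ<n (pick s i)) (pick-true s i)
    in-range : ∀ {j} (p : j < m) → g j ≡ true → g (toℕ (fromℕ< p)) ≡ true
    in-range p h = trans (cong g (toℕ-fromℕ< p)) h
    h : Fin (sum (𝟙 ∘ f ∘ toℕ {n})) → Fin (sum (𝟙 ∘ g ∘ toℕ {m}))
    h i = let j , j<m , gj , _ = img i in find s′ (fromℕ< j<m) (in-range j<m gj)
    back : ∀ i → toℕ (pick s′ (h i)) ≡ proj₁ (img i)
    back i = let j , j<m , gj , _ = img i in
      trans (cong toℕ (pick-find s′ (fromℕ< j<m) (in-range j<m gj))) (toℕ-fromℕ< j<m)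
    h-inj : ∀ {i i′} → h i ≡ h i′ → i ≡ i′
    h-inj {i} {i′} eq = pick-inj s (toℕ-injective (inj (proj₂ (proj₂ (proj₂ (img i))))
      (subst (R _) (sym same) (proj₂ (proj₂ (proj₂ (img i′)))))))
      where
      same : proj₁ (img i) ≡ proj₁ (img i′)
      same = trans (sym (back i)) (trans (cong (toℕ ∘ pick s′) eq) (back i′))

  Tab : Set
  Tab = ℕ → ℕ → Bool

  infix 4 _≈_
  _≈_ : Tab → Tab → Set
  t ≈ u = ∀ v ℓ → t v ℓ ≡ u v ℓ

  ≈-sym : ∀ {t u} → t ≈ u → u ≈ t
  ≈-sym h v ℓ = sym (h v ℓ)

  ≈-trans : ∀ {t u w} → t ≈ u → u ≈ w → t ≈ w
  ≈-trans h k v ℓ = trans (h v ℓ) (k v ℓ)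

  -- Tables are identified when they agree pointwise: `Fin N` is in bijection with the `≈`-classes
  -- of tables satisfying P.
  record Enum (P : Tab → Set) (N : ℕ) : Set where
    field
      at : Fin N → Tab
      at-P : ∀ i → P (at i)
      at-inj : ∀ {i j} → at i ≈ at j → i ≡ j
      idx : ∀ t → P t → Fin N
      at-idx : ∀ t p → at (idx t p) ≈ t

    idx-≈ : ∀ {t u p q} → idx t p ≡ idx u q → t ≈ u
    idx-≈ {t} {u} {p} {q} h =
      ≈-trans (≈-sym (at-idx t p)) (≈-trans (λ v ℓ → cong (λ i → at i v ℓ) h) (at-idx u q))

  enum-≤ : ∀ {P Q N K} → Enum P N → Enum Q K → (f : Tab → Tab) → (∀ t → P t → Q (f t)) →
    (∀ t u → P t → P u → f t ≈ f u → t ≈ u) → N ≤ K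
  enum-≤ e e′ f pq inj = injective⇒≤ {f = λ i → E′.idx (f (E.at i)) (pq _ (E.at-P i))}
    λ {i} {j} h → E.at-inj (inj _ _ (E.at-P i) (E.at-P j) (E′.idx-≈ h))
    where
    module E = Enum e
    module E′ = Enum e′

  enum-sub : ∀ {P N} (e : Enum P N) (q : Fin N → Bool) (Q : Tab → Set) →
    (∀ i → q i ≡ true → Q (Enum.at e i)) → (∀ t p → Q t → q (Enum.idx e t p) ≡ true) →
    Enum (λ t → P t × Q t) (sum (𝟙 ∘ q))
  enum-sub e q Q sound complete = record
    { at = at ∘ pick s
    ; at-P = λ i → at-P (pick s i) , sound _ (pick-true s i)
    ; at-inj = pick-inj s ∘ at-inj
    ; idx = λ t (p , h) → find s (idx t p) (complete t p h)
    ; at-idx = λ t (p , h) v ℓ → trans (cong (λ i → at i v ℓ) (pick-find s (idx t p) (complete t p h))) (at-idx t p v ℓ)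
    }
    where
    open Enum e
    s = select q

  enum-map : ∀ {P Q N} → Enum P N → (f h : Tab → Tab) → (∀ t → P t → Q (f t)) → (∀ t → Q t → P (h t)) →
    (∀ {t u} → t ≈ u → f t ≈ f u) → (∀ t → Q t → f (h t) ≈ t) → (∀ t u → P t → P u → f t ≈ f u → t ≈ u) → Enum Q N
  enum-map e f h pq qp f-cong fh f-inj = record
    { at = f ∘ at
    ; at-P = λ i → pq (at i) (at-P i)
    ; at-inj = λ {i} {j} eq → at-inj (f-inj _ _ (at-P i) (at-P j) eq)
    ; idx = λ t q → idx (h t) (qp t q)
    ; at-idx = λ t q → ≈-trans (f-cong (at-idx (h t) (qp t q))) (fh t q)
    }
    where open Enum e

  enum-unique : ∀ {P N K} → Enum P N → Enum P K → N ≡ K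
  enum-unique e e′ = ≤-antisym (enum-≤ e e′ id (λ _ → id) λ _ _ _ _ → id) (enum-≤ e′ e id (λ _ → id) λ _ _ _ _ → id)

open Enumerations

-- Noncrossing arc families and first passages of a walk.

module ArcFamilies where
  open import Data.Nat using (_+_; _*_; _≟_)

  -- Arcs of the N-cycle, lifted to ℕ: A v ℓ says that the arc from v to v + ℓ is present.
  record Fam (N T k : ℕ) (A : Tab) : Set where
    field
      per : ∀ ℓ → Periodic N (λ v → A v ℓ)
      len₂ : ∀ {v ℓ} → A v ℓ ≡ true → 2 ≤ ℓ
      len : ∀ {v ℓ} → A v ℓ ≡ true → ℓ ≤ suc T
      nc : ∀ {v ℓ i m} → A v ℓ ≡ true → A (v + i) m ≡ true → 0 < i → i < ℓ → i + m ≤ ℓ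
      cnt : ∑ N (λ v → ∑ (2 + T) (λ ℓ → 𝟙 (A v ℓ))) ≡ k

  -- Below the longest arc from v lie M v + 1 sides or arcs; the arcs from v, the longest first,
  -- are numbered by the b with R v b.
  record Spec (N T k : ℕ) (M : ℕ → ℕ) (R : Tab) : Set where
    field
      M-per : Periodic N M
      R-per : ∀ b → Periodic N (λ v → R v b)
      R<M : ∀ {v b} → R v b ≡ true → b < M v
      R-top : ∀ {v} → 0 < M v → R v 0 ≡ true
      M-sum : ∑ N M ≤ T
      R-cnt : ∑ N (λ v → ∑ (M v) (λ b → 𝟙 (R v b))) ≡ k

  module Heights (M : ℕ → ℕ) where

    S : ℕ → ℕ → ℕ
    S v ℓ = ∑ ℓ (λ j → M (v + j))

    S-split : ∀ v a b → S v (a + b) ≡ S v a + S (v + a) b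
    S-split v a b = trans (∑-split a b _) (cong (S v a +_) (∑-cong b λ i _ → cong M (sym (+-assoc v a i))))

    S-1 : ∀ v → S v 1 ≡ M v
    S-1 v = trans (+-identityʳ _) (cong M (+-identityʳ v))

    S-head : ∀ v ℓ → S v (suc ℓ) ≡ M v + S (v + 1) ℓ
    S-head v ℓ = trans (S-split v 1 ℓ) (cong (_+ S (v + 1) ℓ) (S-1 v))

    -- ℓ is the first time at which the walk with steps 1 - M, started at v, reaches height 1 - b.
    record Hit (v b ℓ : ℕ) : Set where
      constructor hit
      field
        positive : 0 < ℓ
        level : ℓ + b ≡ suc (S v ℓ)
        before : ∀ {i} → i < ℓ → 0 < i → i + b ≤ S v i

    open Hit

    abstract
      hit? : ∀ v b ℓ → Dec (Hit v b ℓ)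
      hit? v b ℓ with (0 <? ℓ) ×-dec ((ℓ + b ≟ suc (S v ℓ)) ×-dec allUpTo? (λ i → (0 <? i) →-dec (i + b ≤? S v i)) ℓ)
      ... | yes (p , q , r) = yes (hit p q r)
      ... | no ¬h = no λ (hit p q r) → ¬h (p , q , r)

    -- At time ℓ the walk stands at 1 - b, already at or above 1 - c, so the first passage to the
    -- lower level cannot come later.
    hit-≤ : ∀ {v b c ℓ m} → Hit v b ℓ → Hit v c m → b ≤ c → m ≤ ℓ
    hit-≤ {v} {b} {c} {ℓ} {m} h k b≤c with m ≤? ℓ
    ... | yes p = p
    ... | no ¬p = ⊥-elim (lin 4 (λ ℓ b c s → b ≼ c ⇒ ℓ ⊕ b ≐ con 1 ⊕ s ⇒ ℓ ⊕ c ≼ s ⇒ ff) ℓ b c _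
                    b≤c (level h) (before k (≰⇒> ¬p) (positive h)))

    hit-unique : ∀ {v b ℓ m} → Hit v b ℓ → Hit v b m → ℓ ≡ m
    hit-unique h k = ≤-antisym (hit-≤ k h ≤-refl) (hit-≤ h k ≤-refl)

    -- The first step ends at height 1 - M v, so the side from v is the passage with b = M v;
    -- genuine arcs are those with b < M v.
    hit-1 : ∀ v → Hit v (M v) 1
    hit-1 v = hit z<s (cong suc (sym (S-1 v))) λ { z<s () }

    -- At time i the walk is at most at -b and at time ℓ it is at 1 - b. It has thus risen by at
    -- least one since time i, and the level 1 - c above its height at i has been met by time ℓ.
    hit-nested : ∀ {v b ℓ i c m} → Hit v b ℓ → Hit (v + i) c m → 0 < i → i < ℓ → i + m ≤ ℓ
    hit-nested {v} {b} {ℓ} {i} {c} {m} h k 0<i i<ℓ with i + m ≤? ℓ | m≤n⇒∃ (<⇒≤ i<ℓ)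
    ... | yes p | _ = p
    ... | no ¬p | j , refl = ⊥-elim (lin 7 (λ i j b c x y z → (i ⊕ j) ⊕ b ≐ con 1 ⊕ z ⇒ z ≐ x ⊕ y ⇒ i ⊕ b ≼ x ⇒ j ⊕ c ≼ y ⇒ ff) i j b c _ _ _
          (level h) (S-split v i j) (before h i<ℓ 0<i)
          (before k (+-cancelˡ-< i j m (≰⇒> ¬p)) (+-cancelˡ-< i 0 j (subst (_< i + j) (sym (+-identityʳ i)) i<ℓ))))

    module _ {N T : ℕ} (M-per : Periodic N M) (M-sum : ∑ N M ≤ T) (T<N : T < N) where

      S-per : ∀ ℓ → Periodic N (λ v → S v ℓ)
      S-per ℓ v = ∑-cong ℓ λ j _ → trans (cong M (+-swapʳ v N j)) (M-per (v + j))

      S-round : ∀ v → S v N ≤ T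
      S-round v = subst (_≤ T) (sym (∑-shift M-per v)) M-sum

      -- Within one round, ℓ + b is 1 plus a partial sum of M, hence at most 1 + T. A passage after
      -- more than one round would require height at most -b at time N, yet the walk has risen by at
      -- least N - T > 0 there.
      hit-short : ∀ {v b ℓ} → Hit v b ℓ → ℓ ≤ suc T
      hit-short {v} {b} {ℓ} h with ℓ ≤? N
      ... | yes ℓ≤N = lin 5 (λ ℓ b s s′ T → ℓ ⊕ b ≐ con 1 ⊕ s ⇒ s ≼ s′ ⇒ s′ ≼ T ⇒ ℓ ≼ con 1 ⊕ T) ℓ b _ _ T
              (level h) (∑-monoˡ (λ j → M (v + j)) ℓ≤N) (S-round v)
      ... | no ¬p = ⊥-elim (lin 4 (λ N b s T → N ⊕ b ≼ s ⇒ s ≼ T ⇒ T ≺ N ⇒ ff) N b _ T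
              (before h (≰⇒> ¬p) (≤-trans z<s T<N)) (S-round v) T<N)

      abstract
        -- A full round ends at positive height, so the level is reached by time N; it is met
        -- exactly, since the first step ends at or below it and the walk climbs by at most one at a
        -- time.
        hit-exists : ∀ v b → b ≤ M v → ∃[ ℓ ] Hit v b ℓ
        hit-exists v b b≤M with m≤n⇒∃ (≤-trans z<s T<N)
        ... | N′ , eqN with least (λ ℓ → does (suc (S v (suc ℓ)) ≤? suc ℓ + b)) N′
                            (⇒does (_ ≤? _) (lin 4 (λ s T N b → s ≼ T ⇒ con 1 ⊕ T ≼ N ⇒ con 1 ⊕ s ≼ N ⊕ b) _ T (suc N′) b
                               (subst (λ n → S v n ≤ T) (sym eqN) (S-round v)) (subst (T <_) (sym eqN) T<N)))
        ... | m , _ , pm , below = suc m , hit z<s (lev m crossed bef) bef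
          where
          crossed : suc (S v (suc m)) ≤ suc m + b
          crossed = does⇒ (_ ≤? _) pm
          bef : ∀ {i} → i < suc m → 0 < i → i + b ≤ S v i
          bef {suc i} (s≤s i<m) _ with suc (S v (suc i)) ≤? suc i + b in eq
          ... | yes p = ⊥-elim (true≢false (⇒does (_ ≤? _) p) (below i i<m))
          ... | no ¬p = ≤-pred (≰⇒> ¬p)
          lev : ∀ m → suc (S v (suc m)) ≤ suc m + b → (∀ {i} → i < suc m → 0 < i → i + b ≤ S v i) → suc m + b ≡ suc (S v (suc m))
          lev zero c _ = ≤-antisym (s≤s (subst (b ≤_) (sym (S-1 v)) b≤M)) c
          lev (suc m) c before = ≤-antisym
            (s≤s (≤-trans (before ≤-refl z<s) (∑-monoˡ (λ j → M (v + j)) (n≤1+n (suc m))))) c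

    module Arcs (R : Tab) where

      -- The length determines the level: `Hit v b ℓ` forces b = 1 + S v ℓ - ℓ, so no search over b
      -- occurs.
      arcs : Tab
      arcs v ℓ = does (hit? v (suc (S v ℓ) ∸ ℓ) ℓ) ∧ R v (suc (S v ℓ) ∸ ℓ)

      arcs-intro : ∀ {v b ℓ} → Hit v b ℓ → R v b ≡ true → arcs v ℓ ≡ true
      arcs-intro {v} {b} {ℓ} h r = subst (λ c → does (hit? v c ℓ) ∧ R v c ≡ true)
        (sym (trans (cong (_∸ ℓ) (sym (level h))) (m+n∸m≡n ℓ b))) (∧-intro (⇒does (hit? v b ℓ) h) r)

      arcs-elim : ∀ v ℓ → arcs v ℓ ≡ true → ∃[ b ] (Hit v b ℓ × R v b ≡ true)
      arcs-elim v ℓ h = _ , does⇒ (hit? _ _ _) (∧-fst h) , ∧-snd h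

  module FromSpec {N T k M R} (T<N : T < N) (spec : Spec N T k M R) where
    open Spec spec
    open Heights M
    open Arcs R public
    open Hit

    exists : ∀ v b → b ≤ M v → ∃[ ℓ ] Hit v b ℓ
    exists = hit-exists M-per M-sum T<N

    arcs-per : ∀ ℓ → Periodic N (λ v → arcs v ℓ)
    arcs-per ℓ v = bool-ext
      (λ a → let b , h , r = arcs-elim (v + N) ℓ a in
         arcs-intro (hit (positive h) (trans (level h) (cong suc (per ℓ))) (λ {i} p q → subst (i + b ≤_) (per i) (before h p q)))
           (trans (sym (R-per b v)) r))
      (λ a → let b , h , r = arcs-elim v ℓ a in
         arcs-intro (hit (positive h) (trans (level h) (cong suc (sym (per ℓ)))) (λ {i} p q → subst (i + b ≤_) (sym (per i)) (before h p q)))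
           (trans (R-per b v) r))
      where
      per : ∀ ℓ → S (v + N) ℓ ≡ S v ℓ
      per ℓ = S-per M-per M-sum T<N ℓ v

    arcs-row : ∀ v → ∑ (2 + T) (𝟙 ∘ arcs v) ≡ ∑ (M v) (𝟙 ∘ R v)
    arcs-row v = ≤-antisym
      (count-≤ (2 + T) (M v) (arcs v) (R v) (λ ℓ b → Hit v b ℓ)
        (λ ℓ _ a → let b , h , r = arcs-elim v ℓ a in b , R<M r , r , h)
        hit-unique)
      (count-≤ (M v) (2 + T) (R v) (arcs v) (λ b ℓ → Hit v b ℓ)
        (λ b b<M r → let ℓ , h = exists v b (<⇒≤ b<M) in ℓ , s≤s (hit-short M-per M-sum T<N h) , arcs-intro h r , h)
        (λ {b} {c} {ℓ} h h′ → +-cancelˡ-≡ ℓ b c (trans (level h) (sym (level h′)))))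

    isFam : Fam N T k arcs
    isFam = record
      { per = arcs-per
      ; len₂ = len₂
      ; len = λ {v} {ℓ} a → hit-short M-per M-sum T<N (proj₁ (proj₂ (arcs-elim v ℓ a)))
      ; nc = λ {v} {ℓ} {i} {m} a a′ → hit-nested (proj₁ (proj₂ (arcs-elim v ℓ a))) (proj₁ (proj₂ (arcs-elim (v + i) m a′)))
      ; cnt = trans (∑-cong N λ v _ → arcs-row v) R-cnt
      }
      where
      len₂ : ∀ {v ℓ} → arcs v ℓ ≡ true → 2 ≤ ℓ
      len₂ {v} {ℓ} a with arcs-elim v ℓ a
      len₂ {v} {zero} a | b , h , r = ⊥-elim (n≮0 (positive h))
      -- Length one is the passage with b = M v, which `R<M` excludes.
      len₂ {v} {suc zero} a | b , h , r = ⊥-elim (<-irrefl (suc-injective (trans (level h) (cong suc (S-1 v)))) (R<M r))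
      len₂ {v} {suc (suc ℓ)} a | _ = s≤s z<s

open ArcFamilies

-- Recovering the data M and R from an arc family.

module FamilySpecs where
  open import Data.Nat using (_+_; _*_; _≟_)

  open Heights using (Hit; hit; S)
  open Hit

  module LongestArc {N T k M R k′ M′ R′} (T<N : T < N) (s : Spec N T k M R) (s′ : Spec N T k′ M′ R′)
    (same : Heights.Arcs.arcs M R ≈ Heights.Arcs.arcs M′ R′) where
    open Spec
    private
      module F = FromSpec T<N s
      module F′ = FromSpec T<N s′

    -- By `R-top` the top passage of the first family is an arc, hence an arc of the second; there
    -- it is some passage, no longer than the top one, and its existence forces a nonempty row.
    top-≤ : ∀ {v ℓ ℓ′} → 0 < M v → Hit M v 0 ℓ → Hit M′ v 0 ℓ′ → ℓ ≤ ℓ′ × 0 < M′ v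
    top-≤ {v} {ℓ} {ℓ′} 0<M h h′ =
      let b , h″ , r = F′.arcs-elim v ℓ (trans (sym (same v ℓ)) (F.arcs-intro h (R-top s 0<M)))
      in Heights.hit-≤ M′ h′ h″ z≤n , ≤-trans z<s (R<M s′ r)

  module Recover {N T k M R k′ M′ R′} (T<N : T < N) (s : Spec N T k M R) (s′ : Spec N T k′ M′ R′)
    (same : Heights.Arcs.arcs M R ≈ Heights.Arcs.arcs M′ R′) where
    open Spec
    private
      module F = FromSpec T<N s
      module F′ = FromSpec T<N s′
      module U = LongestArc T<N s s′ same
      module U′ = LongestArc T<N s′ s (≈-sym same)

    -- Induction on the length of the top passage. Vertices strictly beneath it have shorter ones,
    -- so M and M′ agree there; the equation ℓ = 1 + S v ℓ, with the same ℓ on both sides, then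
    -- determines the remaining summand at v.
    M-eq′ : ∀ fuel v ℓ → Hit M v 0 ℓ → ℓ ≤ fuel → M v ≡ M′ v
    M-eq′ zero v ℓ h ℓ≤ = ⊥-elim (n≮0 (≤-trans (positive h) ℓ≤))
    M-eq′ (suc fuel) v ℓ h ℓ≤ with M v ≟ 0 | F′.exists v 0 z≤n
    ... | yes M0 | ℓ′ , h′ with M′ v ≟ 0
    ... | yes M′0 = trans M0 (sym M′0)
    ... | no M′≢0 = ⊥-elim (<-irrefl (sym M0) (proj₂ (U′.top-≤ (n≢0⇒n>0 M′≢0) h′ h)))
    M-eq′ (suc fuel) v (suc m) h (s≤s m≤) | no M≢0 | ℓ′ , h′ = +-cancelʳ-≡ _ _ _ heads
      where
      top = U.top-≤ (n≢0⇒n>0 M≢0) h h′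
      ℓ≡ℓ′ : suc m ≡ ℓ′
      ℓ≡ℓ′ = ≤-antisym (proj₁ top) (proj₁ (U′.top-≤ (proj₂ top) h′ h))
      tails : S M′ (v + 1) m ≡ S M (v + 1) m
      tails = ∑-cong m λ j j<m → sym (go j j<m)
        where
        go : ∀ j → j < m → M (v + 1 + j) ≡ M′ (v + 1 + j)
        go j j<m with F.exists (v + 1 + j) 0 z≤n
        ... | ℓⱼ , hⱼ = M-eq′ fuel (v + 1 + j) ℓⱼ hⱼ
          (lin 4 (λ j ℓ m f → con 1 ⊕ j ⊕ ℓ ≼ con 1 ⊕ m ⇒ m ≼ f ⇒ ℓ ≼ f) j ℓⱼ m fuel
            (Heights.hit-nested M h (subst (λ u → Hit M u 0 ℓⱼ) (+-assoc v 1 j) hⱼ) z<s (s≤s j<m)) m≤)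
      heads : M v + S M (v + 1) m ≡ M′ v + S M (v + 1) m
      heads = suc-injective (begin
        suc (M v + S M (v + 1) m) ≡⟨ cong suc (Heights.S-head M v m) ⟨
        suc (S M v (suc m)) ≡⟨ level h ⟨
        suc m + 0 ≡⟨ cong (_+ 0) ℓ≡ℓ′ ⟩
        ℓ′ + 0 ≡⟨ level h′ ⟩
        suc (S M′ v ℓ′) ≡⟨ cong (suc ∘ S M′ v) ℓ≡ℓ′ ⟨
        suc (S M′ v (suc m)) ≡⟨ cong suc (Heights.S-head M′ v m) ⟩
        suc (M′ v + S M′ (v + 1) m) ≡⟨ cong (λ x → suc (M′ v + x)) tails ⟩
        suc (M′ v + S M (v + 1) m) ∎)
    
    M-eq : ∀ v → M v ≡ M′ v
    M-eq v = let ℓ , h = F.exists v 0 z≤n in M-eq′ ℓ v ℓ h ≤-refl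

    R-⇒ : ∀ v b → R v b ≡ true → R′ v b ≡ true
    R-⇒ v b r = let ℓ , h = F.exists v b (<⇒≤ (R<M s r))
                    b′ , h′ , r′ = F′.arcs-elim v ℓ (trans (sym (same v ℓ)) (F.arcs-intro h r))
                in subst (λ b → R′ v b ≡ true)
                     (+-cancelˡ-≡ ℓ b′ b (trans (level h′) (trans (cong suc (∑-cong ℓ λ j _ → sym (M-eq (v + j)))) (sym (level h))))) r′

  arcs-injective : ∀ {N T k M R k′ M′ R′} → T < N → Spec N T k M R → Spec N T k′ M′ R′ →
    Heights.Arcs.arcs M R ≈ Heights.Arcs.arcs M′ R′ → (∀ v → M v ≡ M′ v) × R ≈ R′
  arcs-injective T<N s s′ same = U.M-eq , λ v b → bool-ext (U.R-⇒ v b) (U′.R-⇒ v b)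
    where
    module U = Recover T<N s s′ same
    module U′ = Recover T<N s′ s (≈-sym same)

  -- An arc passing strictly over v is looked for at v + N, so that it starts at some v + i with i > 0.
  Uncovered : (N T : ℕ) → Tab → ℕ → Set
  Uncovered N T A v = ∀ {i} → i < N → 0 < i → ∀ {ℓ} → ℓ < 2 + T → A (v + i) ℓ ≡ true → i + ℓ ≤ N

  abstract
    uncovered? : ∀ N T A v → Dec (Uncovered N T A v)
    uncovered? N T A v = allUpTo? (λ i → (0 <? i) →-dec allUpTo? (λ ℓ → (A (v + i) ℓ Bool.≟ true) →-dec (i + ℓ ≤? N)) (2 + T)) N

  unc : (N T : ℕ) → Tab → ℕ → Bool
  unc N T A v = does (uncovered? N T A v)

  unc-≡ : ∀ {N T A B v w} → (∀ i ℓ → A (v + i) ℓ ≡ B (w + i) ℓ) → unc N T A v ≡ unc N T B w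
  unc-≡ {N} {T} {A} {B} {v} {w} h = bool-ext
    (λ a → ⇒does (uncovered? N T B w) λ i<N 0<i ℓ< b → does⇒ (uncovered? N T A v) a i<N 0<i ℓ< (trans (h _ _) b))
    (λ b → ⇒does (uncovered? N T A v) λ i<N 0<i ℓ< a → does⇒ (uncovered? N T B w) b i<N 0<i ℓ< (trans (sym (h _ _)) a))

  -- The default 1 stands for the side from v to v + 1, so that every vertex has a longest "arc".
  longest : (ℕ → Bool) → ℕ → ℕ
  longest f zero = 1
  longest f (suc n) = if f (suc n) then suc n else longest f n

  longest-≥1 : ∀ f n → 1 ≤ longest f n
  longest-≥1 f zero = ≤-refl
  longest-≥1 f (suc n) with f (suc n)
  ... | true = s≤s z≤n
  ... | false = longest-≥1 f n

  longest-max : ∀ f n ℓ → 0 < ℓ → ℓ ≤ n → f ℓ ≡ true → ℓ ≤ longest f n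
  longest-max f zero ℓ 0<ℓ ℓ≤ h = ≤-trans ℓ≤ z≤n
  longest-max f (suc n) ℓ 0<ℓ ℓ≤ h with f (suc n) in eq | m≤n⇒m<n∨m≡n ℓ≤
  ... | true | _ = ℓ≤
  ... | false | inj₁ (s≤s ℓ≤n) = longest-max f n ℓ 0<ℓ ℓ≤n h
  ... | false | inj₂ refl = ⊥-elim (true≢false h eq)

  longest-true : ∀ f n → longest f n ≡ 1 ⊎ f (longest f n) ≡ true
  longest-true f zero = inj₁ refl
  longest-true f (suc n) with f (suc n) in eq
  ... | true = inj₂ eq
  ... | false = longest-true f n

  longest-cong : ∀ {f g} n → (∀ i → f i ≡ g i) → longest f n ≡ longest g n
  longest-cong zero h = refl
  longest-cong {f} {g} (suc n) h = cong₂ (λ b m → if b then suc n else m) (h (suc n)) (longest-cong n h)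

  module FromFam {N T k A} (T<N : T < N) (N≤T+2 : N ≤ 2 + T) (fam : Fam N T k A) where
    open Fam fam

    L : ℕ → ℕ
    L v = longest (A v) (suc T)

    L≥1 : ∀ v → 1 ≤ L v
    L≥1 v = longest-≥1 (A v) (suc T)

    L-max : ∀ v ℓ → A v ℓ ≡ true → ℓ ≤ L v
    L-max v ℓ a = longest-max (A v) (suc T) ℓ (≤-trans z<s (len₂ a)) (len a) a

    L-arc : ∀ v → L v ≡ 1 ⊎ A v (L v) ≡ true
    L-arc v = longest-true (A v) (suc T)

    L-arc′ : ∀ v → 1 < L v → A v (L v) ≡ true
    L-arc′ v h with L-arc v
    ... | inj₁ e = ⊥-elim (<-irrefl (sym e) h)
    ... | inj₂ a = a

    L-per : Periodic N L
    L-per v = longest-cong (suc T) λ ℓ → per ℓ v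

    L≤N : ∀ v → L v ≤ N
    L≤N v with L-arc v
    ... | inj₁ e = subst (_≤ N) (sym e) (≤-trans z<s T<N)
    ... | inj₂ a = ≤-trans (len a) T<N

    -- The greedy path that leaves v by a side and then always follows the longest arc; by
    -- noncrossingness every arc from v ends on it.
    pos : ℕ → ℕ → ℕ
    pos v zero = 1
    pos v (suc w) = pos v w + L (v + pos v w)

    pos-step : ∀ v w → pos v w < pos v (suc w)
    pos-step v w = subst (_≤ pos v (suc w)) (+-comm (pos v w) 1) (+-monoʳ-≤ (pos v w) (L≥1 (v + pos v w)))

    pos-+ : ∀ v w d → pos v w ≤ pos v (w + d)
    pos-+ v w zero = ≤-reflexive (cong (pos v) (sym (+-identityʳ w)))
    pos-+ v w (suc d) = ≤-trans (pos-+ v w d)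
      (subst (λ x → pos v (w + d) ≤ pos v x) (sym (+-suc w d)) (<⇒≤ (pos-step v (w + d))))

    pos-mono : ∀ v {w w′} → w ≤ w′ → pos v w ≤ pos v w′
    pos-mono v {w} w≤ with m≤n⇒∃ w≤
    ... | d , refl = pos-+ v w d

    pos-reflects-≤ : ∀ v w w′ → pos v w ≤ pos v w′ → w ≤ w′
    pos-reflects-≤ v w w′ h with w ≤? w′
    ... | yes p = p
    ... | no ¬p = ⊥-elim (n≮n _ (≤-trans (pos-step v w′) (≤-trans (pos-mono v (≰⇒> ¬p)) h)))

    pos-injective : ∀ v w w′ → pos v w ≡ pos v w′ → w ≡ w′
    pos-injective v w w′ e = ≤-antisym (pos-reflects-≤ v w w′ (≤-reflexive e)) (pos-reflects-≤ v w′ w (≤-reflexive (sym e)))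

    pos≥1 : ∀ v w → 1 ≤ pos v w
    pos≥1 v w = pos-mono v {0} {w} z≤n

    on-path : ∀ v ℓ → A v ℓ ≡ true → ∃[ w ] pos v w ≡ ℓ
    on-path v ℓ a = go ℓ 0 (≤-trans z<s (len₂ a)) (m≤n+m ℓ 1)
      where
      go : ∀ fuel w → pos v w ≤ ℓ → ℓ ≤ pos v w + fuel → ∃[ w ] pos v w ≡ ℓ
      go fuel w p q with pos v w ≟ ℓ
      ... | yes e = w , e
      go zero w p q | no ne = ⊥-elim (ne (≤-antisym p (subst (ℓ ≤_) (+-identityʳ _) q)))
      go (suc fuel) w p q | no ne with pos v (suc w) ≤? ℓ
      ... | yes p′ = go fuel (suc w) p′
        (lin 4 (λ ℓ q f p → ℓ ≼ q ⊕ (con 1 ⊕ f) ⇒ q ≺ p ⇒ ℓ ≼ p ⊕ f) ℓ (pos v w) fuel (pos v (suc w)) q (pos-step v w))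
      ... | no ¬p′ = ⊥-elim (¬p′ (nc a (L-arc′ (v + pos v w)
        (lin 3 (λ ℓ q L → q ≺ ℓ ⇒ ℓ ≺ q ⊕ L ⇒ con 1 ≺ L) ℓ (pos v w) (L (v + pos v w)) q<ℓ (≰⇒> ¬p′))) (pos≥1 v w) q<ℓ))
        where
        q<ℓ : pos v w < ℓ
        q<ℓ = ≤∧≢⇒< p ne

    abstract
      top-index : ∀ v → ∃[ w ] pos v w ≡ L v
      top-index v with L-arc v
      ... | inj₁ e = 0 , sym e
      ... | inj₂ a = on-path v (L v) a

    M : ℕ → ℕ
    M v = proj₁ (top-index v)

    pos-M : ∀ v → pos v (M v) ≡ L v
    pos-M v = proj₂ (top-index v)

    pos-per : ∀ w → Periodic N (λ v → pos v w)
    pos-per zero v = refl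
    pos-per (suc w) v = cong₂ _+_ (pos-per w v)
      (trans (cong L (trans (cong (v + N +_) (pos-per w v)) (+-swapʳ v N (pos v w)))) (L-per (v + pos v w)))

    M-per : Periodic N M
    M-per v = pos-injective v (M (v + N)) (M v)
      (trans (sym (pos-per (M (v + N)) v)) (trans (pos-M (v + N)) (trans (L-per v) (sym (pos-M v)))))

    -- Position M v - b on the greedy path is where the walk first meets height 1 - b, so b = 0 is
    -- the longest arc and larger b are shorter ones.
    R : Tab
    R v b = does (b <? M v) ∧ A v (pos v (M v ∸ b))

    open Heights M using (S-split; hit-1; hit-unique)

    -- The initial side lands at height 1 - M v, and each longest arc after it is a passage with b =
    -- 0, raising the height by exactly one. The arcs met lie beneath the longest arc from v, which
    -- is why the assumption may be limited to smaller L.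
    path-hit : ∀ v → (∀ u → L u < L v → Hit M u 0 (L u)) → ∀ w c → w + c ≡ M v → Hit M v c (pos v w)
    path-hit v IH zero c e = subst (λ c → Hit M v c 1) (sym e) (hit-1 v)
    path-hit v IH (suc w) c e = hit (≤-trans (pos≥1 v w) (m≤m+n q L′)) lev bef
      where
      q = pos v w
      L′ = L (v + q)
      inside : q + L′ ≤ L v
      inside = subst (pos v (suc w) ≤_) (pos-M v) (pos-mono v (subst (suc w ≤_) e (m≤m+n (suc w) c)))
      h : Hit M v (suc c) q
      h = path-hit v IH w (suc c) (trans (+-suc w c) e)
      h′ : Hit M (v + q) 0 L′
      h′ = IH (v + q) (lin 3 (λ q l L → q ⊕ l ≼ L ⇒ con 1 ≼ q ⇒ l ≺ L) q L′ (L v) inside (pos≥1 v w))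
      lev : q + L′ + c ≡ suc (S M v (q + L′))
      lev = lin 6 (λ q l c s x y → q ⊕ (con 1 ⊕ c) ≐ con 1 ⊕ x ⇒ l ⊕ con 0 ≐ con 1 ⊕ y ⇒ s ≐ x ⊕ y ⇒ q ⊕ l ⊕ c ≐ con 1 ⊕ s)
              q L′ c _ _ _ (level h) (level h′) (S-split v q L′)
      bef : ∀ {i} → i < q + L′ → 0 < i → i + c ≤ S M v i
      bef {i} i< 0<i with <-cmp i q
      ... | tri< i<q _ _ = ≤-trans (+-monoʳ-≤ i (n≤1+n c)) (before h i<q 0<i)
      ... | tri≈ _ refl _ = lin 3 (λ q c s → q ⊕ (con 1 ⊕ c) ≐ con 1 ⊕ s ⇒ q ⊕ c ≼ s) q c (S M v q) (level h)
      ... | tri> _ _ q<i with m≤n⇒∃ (<⇒≤ q<i)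
      ... | j , refl = lin 6 (λ q j c s x y → q ⊕ (con 1 ⊕ c) ≐ con 1 ⊕ x ⇒ j ⊕ con 0 ≼ y ⇒ s ≐ x ⊕ y ⇒ (q ⊕ j) ⊕ c ≼ s)
              q j c _ _ _ (level h)
              (before h′ (+-cancelˡ-< q j L′ i<) (+-cancelˡ-< q 0 j (subst (_< q + j) (sym (+-identityʳ q)) q<i)))
              (S-split v q j)

    L-hit : ∀ v → Hit M v 0 (L v)
    L-hit v = go (L v) v ≤-refl
      where
      go : ∀ fuel v → L v ≤ fuel → Hit M v 0 (L v)
      go zero v h = ⊥-elim (n≮0 (≤-trans (L≥1 v) h))
      go (suc fuel) v h = subst (Hit M v 0) (pos-M v)
        (path-hit v (λ u lt → go fuel u (≤-pred (≤-trans lt h))) (M v) 0 (+-identityʳ _))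

    pos-hit : ∀ v w c → w + c ≡ M v → Hit M v c (pos v w)
    pos-hit v = path-hit v (λ u _ → L-hit u)

    U : ℕ → ℕ → ℕ
    U v ℓ = ∑ ℓ (λ j → 𝟙 (unc N T A (v + j)))

    unc-per : Periodic N (unc N T A)
    unc-per v = unc-≡ {N} {T} {A} {A} λ i ℓ → trans (cong (λ u → A u ℓ) (+-swapʳ v N i)) (per ℓ (v + i))

    Unc : ℕ → Set
    Unc v = ∀ i → i < N → 0 < i → ∀ ℓ → A (v + i) ℓ ≡ true → i + ℓ ≤ N

    Unc⇒ : ∀ {v} → Unc v → unc N T A v ≡ true
    Unc⇒ {v} u = ⇒does (uncovered? N T A v) λ i< 0<i _ a → u _ i< 0<i _ a

    ⇒Unc : ∀ {v} → unc N T A v ≡ true → Unc v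
    ⇒Unc {v} h i i< 0<i ℓ a = does⇒ (uncovered? N T A v) h i< 0<i (s≤s (len a)) a

    -- An arc covering p + L p would start beyond the longest arc from p, at p itself, or strictly
    -- beneath that arc. These contradict, in turn, that p is uncovered, that L p is maximal, and
    -- noncrossingness.
    unc-step : ∀ p → Unc p → Unc (p + L p)
    unc-step p u i i<N 0<i m a with <-cmp (L p + i) N
    ... | tri< lt _ _ = ≤-trans (m≤n+m (i + m) (L p)) (subst (_≤ N) (+-assoc (L p) i m)
            (u (L p + i) lt (≤-trans 0<i (m≤n+m i (L p))) m (subst (λ x → A x m ≡ true) (+-assoc p (L p) i) a)))
    ... | tri≈ _ e _ = subst (i + m ≤_) (trans (+-comm i (L p)) e)
            (+-monoʳ-≤ i (L-max p m (trans (sym (per m p)) (subst (λ x → A x m ≡ true) (trans (+-assoc p (L p) i) (cong (p +_) e)) a))))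
    ... | tri> _ _ gt with m≤n⇒∃ (<⇒≤ gt)
    ... | j , e = lin 5 (λ L i N j m → N ⊕ j ≐ L ⊕ i ⇒ j ⊕ m ≼ L ⇒ i ⊕ m ≼ N) (L p) i N j m e
            (nc (L-arc′ p (≤-trans (s≤s 0<j) j<L)) a′ 0<j j<L)
      where
      0<j : 0 < j
      0<j = lin 4 (λ L i N j → N ⊕ j ≐ L ⊕ i ⇒ N ≺ L ⊕ i ⇒ con 0 ≺ j) (L p) i N j e gt
      j<L : j < L p
      j<L = lin 4 (λ L i N j → N ⊕ j ≐ L ⊕ i ⇒ i ≺ N ⇒ j ≺ L) (L p) i N j e i<N
      a′ : A (p + j) m ≡ true
      a′ = trans (sym (per m (p + j))) (subst (λ x → A x m ≡ true)
             (trans (+-assoc p (L p) i) (trans (cong (p +_) (trans (sym e) (+-comm N j))) (sym (+-assoc p j N)))) a)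

    covered : ∀ p j → 0 < j → j < L p → unc N T A (p + j) ≡ false
    covered p j 0<j j<L = ¬true⇒false λ h → n≮n _ (≤-trans j<L
        (+-cancelʳ-≤ i (L p) j (subst₂ _≤_ (+-comm i (L p)) (sym e)
          (⇒Unc h i i<N 0<i (L p) arc))))
      where
      split = m≤n⇒∃ (≤-trans (<⇒≤ j<L) (L≤N p))
      i = proj₁ split
      e : j + i ≡ N
      e = proj₂ split
      i<N : i < N
      i<N = subst (i <_) e (+-monoˡ-≤ i 0<j)
      0<i : 0 < i
      0<i = lin 4 (λ j i N L → j ⊕ i ≐ N ⇒ j ≺ L ⇒ L ≼ N ⇒ con 0 ≺ i) j i N (L p) e j<L (L≤N p)
      arc : A (p + j + i) (L p) ≡ true
      arc = trans (cong (λ x → A x (L p)) (trans (+-assoc p j i) (cong (p +_) e)))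
              (trans (per (L p) p) (L-arc′ p (≤-trans (s≤s 0<j) j<L)))

    U-step : ∀ p → Unc p → U p (L p) ≡ 1
    U-step p u with L p in eq | L≥1 p
    ... | suc m | _ = cong₂ _+_ (cong 𝟙 (trans (cong (unc N T A) (+-identityʳ p)) (Unc⇒ u)))
          (∑-0 m λ j j<m → cong 𝟙 (covered p (suc j) z<s (subst (suc j <_) (sym eq) (s≤s j<m))))

    U-split : ∀ v a b → U v (a + b) ≡ U v a + U (v + a) b
    U-split v a b = trans (∑-split a b _) (cong (U v a +_) (∑-cong b λ i _ → cong (𝟙 ∘ unc N T A) (sym (+-assoc v a i))))

    abstract
      -- A vertex where L is maximal works: an arc passing over it would contain its longest arc or
      -- side and be strictly longer.
      base : ∃[ v ] Unc v
      base with m≤n⇒∃ (≤-trans z<s T<N)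
      ... | N′ , refl with argmax L N′
      ... | v , v<N , max = v , u
        where
        u : Unc v
        u i i<N 0<i m a with i + m ≤? N
        ... | yes p = p
        ... | no ¬p with m≤n⇒∃ (<⇒≤ i<N)
        ... | j , e = ⊥-elim (n≮n _ (≤-trans longer (≤-trans (L-max (v + i) m a) shorter)))
          where
          shorter : L (v + i) ≤ L v
          shorter = subst (_≤ L v) (sym (periodic-% {N = suc N′} L-per (v + i))) (max _ (m%n<n (v + i) (suc N′)))
          0<j : 0 < j
          0<j = lin 3 (λ i j N → i ⊕ j ≐ N ⇒ i ≺ N ⇒ con 0 ≺ j) i j N e i<N
          j<m : j < m
          j<m = lin 4 (λ i j N m → i ⊕ j ≐ N ⇒ N ≺ i ⊕ m ⇒ j ≺ m) i j N m e (≰⇒> ¬p)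
          longer : L v < m
          longer with L-arc v
          ... | inj₁ e₁ = subst (_< m) (sym e₁) (len₂ a)
          ... | inj₂ b = ≤-trans (+-monoˡ-≤ (L v) 0<j) (nc a (trans (cong (λ x → A x (L v)) (trans (+-assoc v i j) (cong (v +_) e)))
                            (trans (per (L v) v) b)) 0<j j<m)

    v₀ : ℕ
    v₀ = proj₁ base

    unc₀ : Unc v₀
    unc₀ = proj₂ base

    -- Each step of the greedy path from an uncovered vertex passes one uncovered vertex and
    -- adds its length minus one to the sum of M.
    walk : ∀ fuel e rest → rest ≤ fuel → e + rest ≡ N → Unc (v₀ + e) → U (v₀ + e) rest + S M (v₀ + e) rest ≡ rest
    walk _ e zero _ _ _ = refl
    walk (suc fuel) e rest@(suc _) rest≤ eq u with m≤n⇒∃ (step≤ e rest eq z<s)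
      where
      step≤ : ∀ e rest → e + rest ≡ N → 0 < rest → L (v₀ + e) ≤ rest
      step≤ zero rest eq _ = subst (L (v₀ + 0) ≤_) (sym eq) (L≤N _)
      step≤ (suc e) rest eq 0<rest with L-arc (v₀ + suc e)
      ... | inj₁ e₁ = subst (_≤ rest) (sym e₁) 0<rest
      ... | inj₂ a = +-cancelˡ-≤ (suc e) _ _ (subst (suc e + L (v₀ + suc e) ≤_) (sym eq)
              (unc₀ (suc e) (subst (suc e <_) eq (lin 2 (λ e r → con 0 ≺ r ⇒ e ≺ e ⊕ r) (suc e) rest 0<rest)) z<s _ a))
    ... | rest′ , eq′ = subst (λ r → U p r + S M p r ≡ r) eq′
        (lin 7 (λ u s u₂ s₂ L r s₁ → u ≐ con 1 ⊕ u₂ ⇒ s ≐ s₁ ⊕ s₂ ⇒ L ⊕ con 0 ≐ con 1 ⊕ s₁ ⇒ u₂ ⊕ s₂ ≐ r ⇒ u ⊕ s ≐ L ⊕ r)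
          (U p (L p + rest′)) (S M p (L p + rest′)) (U (p + L p) rest′) (S M (p + L p) rest′) (L p) rest′ (S M p (L p))
          (trans (U-split p (L p) rest′) (cong (_+ U (p + L p) rest′) (U-step p u)))
          (S-split p (L p) rest′) (level (L-hit p)) IH)
      where
      p = v₀ + e
      assoc : v₀ + (e + L p) ≡ p + L p
      assoc = sym (+-assoc v₀ e (L p))
      IH : U (p + L p) rest′ + S M (p + L p) rest′ ≡ rest′
      IH = subst (λ x → U x rest′ + S M x rest′ ≡ rest′) assoc
        (walk fuel (e + L p) rest′
          (lin 4 (λ L r t f → L ⊕ r ≐ t ⇒ t ≼ con 1 ⊕ f ⇒ con 1 ≼ L ⇒ r ≼ f) (L p) rest′ rest fuel eq′ rest≤ (L≥1 p))
          (trans (+-assoc e (L p) rest′) (trans (cong (e +_) eq′) eq))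
          (subst Unc (sym assoc) (unc-step p u)))

    unc-total : ∑ N (𝟙 ∘ unc N T A) + ∑ N M ≡ N
    unc-total = trans (cong₂ _+_ (sym (trans shift₀ (∑-shift (λ v → cong 𝟙 (unc-per v)) v₀))) (sym (trans shift₁ (∑-shift M-per v₀))))
        (walk N 0 N ≤-refl refl (subst Unc (sym (+-identityʳ v₀)) unc₀))
      where
      shift₀ : U (v₀ + 0) N ≡ U v₀ N
      shift₀ = cong (λ v → U v N) (+-identityʳ v₀)
      shift₁ : S M (v₀ + 0) N ≡ S M v₀ N
      shift₁ = cong (λ v → S M v N) (+-identityʳ v₀)

    -- If the longest arc from v₀ goes once round, the sum is its length minus one. Otherwise v₀ and
    -- the end of that arc are two distinct uncovered vertices, and the sum is at most N - 2.
    M-sum : ∑ N M ≤ T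
    M-sum with L v₀ <? N
    ... | no ¬lt = subst (_≤ T) (∑-shift M-per v₀)
          (lin 4 (λ N s T L → L ≐ N ⇒ L ⊕ con 0 ≐ con 1 ⊕ s ⇒ L ≼ con 1 ⊕ T ⇒ s ≼ T) N _ T (L v₀) L≡N
            (trans (level (L-hit v₀)) (cong (suc ∘ S M v₀) L≡N)) L≤T)
      where
      L≡N : L v₀ ≡ N
      L≡N = ≤-antisym (L≤N v₀) (≮⇒≥ ¬lt)
      L≤T : L v₀ ≤ suc T
      L≤T with L-arc v₀
      ... | inj₁ e = subst (_≤ suc T) (sym e) z<s
      ... | inj₂ a = len a
    ... | yes lt with m≤n⇒∃ lt
    ... | r , eq = lin 4 (λ N u s T → u ⊕ s ≐ N ⇒ con 2 ≼ u ⇒ N ≼ con 2 ⊕ T ⇒ s ≼ T) N _ (∑ N M) T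
          unc-total (subst (2 ≤_) (trans (cong (U v₀) eq) (∑-shift (λ v → cong 𝟙 (unc-per v)) v₀)) two) N≤T+2
      where
      two : 2 ≤ U v₀ (suc (L v₀ + r))
      two = subst (2 ≤_) (sym (trans (cong (U v₀) (sym (+-suc (L v₀) r))) (U-split v₀ (L v₀) (suc r))))
        (+-mono-≤ (≤-reflexive (sym (U-step v₀ unc₀)))
          (≤-trans (≤-reflexive (sym (cong 𝟙 (trans (cong (unc N T A) (+-identityʳ (v₀ + L v₀))) (Unc⇒ (unc-step v₀ unc₀)))))) (m≤m+n _ _)))

    R<M : ∀ {v b} → R v b ≡ true → b < M v
    R<M {v} {b} r = does⇒ (b <? M v) (∧-fst r)

    R-per : ∀ b → Periodic N (λ v → R v b)
    R-per b v rewrite M-per v = cong (does (b <? M v) ∧_)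
      (trans (cong (A (v + N)) (pos-per (M v ∸ b) v)) (per (pos v (M v ∸ b)) v))

    R-top : ∀ {v} → 0 < M v → R v 0 ≡ true
    R-top {v} h = ∧-intro (⇒does (0 <? M v) h) (trans (cong (A v) (pos-M v)) (L-arc′ v (subst (1 <_) (pos-M v) (≤-trans (pos-step v 0) (pos-mono v h)))))

    private
      spec′ : Spec N T _ M R
      -- The number of arcs is first whatever R produces; it is identified with k in `spec`, once
      -- `arcs-≈` is available.
      spec′ = record { M-per = M-per ; R-per = R-per ; R<M = R<M ; R-top = λ {v} → R-top {v} ; M-sum = M-sum ; R-cnt = refl }

    open FromSpec T<N spec′ using (arcs; arcs-intro; arcs-elim)

    arcs-≈ : arcs ≈ A
    arcs-≈ v ℓ = bool-ext
      (λ h → let b , h′ , r = arcs-elim v ℓ h in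
        subst (λ m → A v m ≡ true)
          (hit-unique (pos-hit v (M v ∸ b) b (m∸n+n≡m (<⇒≤ (R<M r)))) h′)
          (∧-snd r))
      λ a → let w , e = on-path v ℓ a
                w≤M = pos-reflects-≤ v w (M v) (subst₂ _≤_ (sym e) (sym (pos-M v)) (L-max v ℓ a))
                c , ec = m≤n⇒∃ w≤M
            in arcs-intro (subst (Hit M v c) e (pos-hit v w c ec))
                 (∧-intro (⇒does (c <? M v) (subst (c <_) ec (+-monoˡ-≤ c (w≥1 v ℓ w e a))))
                   (trans (cong (A v) (trans (cong (pos v) (trans (cong (_∸ c) (sym ec)) (m+n∸n≡m w c))) e)) a))
      where
      w≥1 : ∀ v ℓ w → pos v w ≡ ℓ → A v ℓ ≡ true → 1 ≤ w
      w≥1 v ℓ zero refl a = ⊥-elim (n≮n _ (len₂ a))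
      w≥1 v ℓ (suc w) e a = s≤s z≤n

    spec : Spec N T k M R
    spec = subst (λ k → Spec N T k M R)
      (trans (sym (Fam.cnt (FromSpec.isFam T<N spec′)))
        (trans (∑-cong N λ v _ → ∑-cong (2 + T) λ ℓ _ → cong 𝟙 (arcs-≈ v ℓ)) cnt)) spec′

open FamilySpecs

-- Words encoding the data, and their enumeration.

module Words where
  open import Data.Nat using (_+_; _*_)

  -- Words describing M and R vertex by vertex: G at the start of a vertex with g vertices left,
  -- I inside a nonempty row with g vertices left after it; k counts the bits equal to true and T
  -- bounds the number of bits.
  data G : ℕ → ℕ → ℕ → Set
  data I : ℕ → ℕ → ℕ → Set

  data G where
    done : ∀ {T} → G 0 0 T
    next : ∀ {g k T} → G g k T → G (suc g) k T
    row : ∀ {g k T} → I g k T → G (suc g) (suc k) (suc T)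

  data I where
    end : ∀ {g k T} → G g k T → I g k T
    off : ∀ {g k T} → I g k T → I g k (suc T)
    on : ∀ {g k T} → I g k T → I g (suc k) (suc T)

  width : ∀ {g k T} → G g k T → ℕ → ℕ
  widthᴵ : ∀ {g k T} → I g k T → ℕ → ℕ
  width done v = 0
  width (next c) zero = 0
  width (next c) (suc v) = width c v
  width (row i) zero = suc (widthᴵ i 0)
  width (row i) (suc v) = widthᴵ i (suc v)
  widthᴵ (end c) zero = 0
  widthᴵ (end c) (suc v) = width c v
  widthᴵ (off i) zero = suc (widthᴵ i 0)
  widthᴵ (off i) (suc v) = widthᴵ i (suc v)
  widthᴵ (on i) zero = suc (widthᴵ i 0)
  widthᴵ (on i) (suc v) = widthᴵ i (suc v)

  bits : ∀ {g k T} → G g k T → Tab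
  bitsᴵ : ∀ {g k T} → I g k T → Tab
  bits done v b = false
  bits (next c) zero b = false
  bits (next c) (suc v) b = bits c v b
  bits (row i) zero zero = true
  bits (row i) zero (suc b) = bitsᴵ i 0 b
  bits (row i) (suc v) b = bitsᴵ i (suc v) b
  bitsᴵ (end c) zero b = false
  bitsᴵ (end c) (suc v) b = bits c v b
  bitsᴵ (off i) zero zero = false
  bitsᴵ (off i) zero (suc b) = bitsᴵ i 0 b
  bitsᴵ (off i) (suc v) b = bitsᴵ i (suc v) b
  bitsᴵ (on i) zero zero = true
  bitsᴵ (on i) zero (suc b) = bitsᴵ i 0 b
  bitsᴵ (on i) (suc v) b = bitsᴵ i (suc v) b

  -- The part of the bound T left over by the bits; for N = 2 + T it becomes the number of uncovered
  -- vertices minus two.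
  slack : ∀ {g k T} → G g k T → ℕ
  slackᴵ : ∀ {g k T} → I g k T → ℕ
  slack (done {T}) = T
  slack (next c) = slack c
  slack (row i) = slackᴵ i
  slackᴵ (end c) = slack c
  slackᴵ (off i) = slackᴵ i
  slackᴵ (on i) = slackᴵ i

  bits<width : ∀ {g k T} (c : G g k T) v b → bits c v b ≡ true → b < width c v
  bitsᴵ<width : ∀ {g k T} (i : I g k T) v b → bitsᴵ i v b ≡ true → b < widthᴵ i v
  bits<width (next c) (suc v) b h = bits<width c v b h
  bits<width (row i) zero zero h = s≤s z≤n
  bits<width (row i) zero (suc b) h = s≤s (bitsᴵ<width i 0 b h)
  bits<width (row i) (suc v) b h = bitsᴵ<width i (suc v) b h
  bitsᴵ<width (end c) (suc v) b h = bits<width c v b h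
  bitsᴵ<width (off i) zero (suc b) h = s≤s (bitsᴵ<width i 0 b h)
  bitsᴵ<width (off i) (suc v) b h = bitsᴵ<width i (suc v) b h
  bitsᴵ<width (on i) zero zero h = s≤s z≤n
  bitsᴵ<width (on i) zero (suc b) h = s≤s (bitsᴵ<width i 0 b h)
  bitsᴵ<width (on i) (suc v) b h = bitsᴵ<width i (suc v) b h

  bits-top : ∀ {g k T} (c : G g k T) v → 0 < width c v → bits c v 0 ≡ true
  bitsᴵ-top : ∀ {g k T} (i : I g k T) v → 0 < widthᴵ i (suc v) → bitsᴵ i (suc v) 0 ≡ true
  bits-top (next c) (suc v) h = bits-top c v h
  bits-top (row i) zero h = refl
  bits-top (row i) (suc v) h = bitsᴵ-top i v h
  bitsᴵ-top (end c) v h = bits-top c v h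
  bitsᴵ-top (off i) v h = bitsᴵ-top i v h
  bitsᴵ-top (on i) v h = bitsᴵ-top i v h

  width-sum : ∀ {g k T} (c : G g k T) → ∑ g (width c) + slack c ≡ T
  widthᴵ-sum : ∀ {g k T} (i : I g k T) → ∑ (suc g) (widthᴵ i) + slackᴵ i ≡ T
  width-sum done = refl
  width-sum (next c) = width-sum c
  width-sum (row i) = cong suc (widthᴵ-sum i)
  widthᴵ-sum (end c) = width-sum c
  widthᴵ-sum (off i) = cong suc (widthᴵ-sum i)
  widthᴵ-sum (on i) = cong suc (widthᴵ-sum i)

  bits-sum : ∀ {g k T} (c : G g k T) → ∑ g (λ v → ∑ (width c v) (𝟙 ∘ bits c v)) ≡ k
  bitsᴵ-sum : ∀ {g k T} (i : I g k T) → ∑ (suc g) (λ v → ∑ (widthᴵ i v) (𝟙 ∘ bitsᴵ i v)) ≡ k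
  bits-sum done = refl
  bits-sum (next c) = bits-sum c
  bits-sum (row i) = cong suc (bitsᴵ-sum i)
  bitsᴵ-sum (end c) = bits-sum c
  bitsᴵ-sum (off i) = bitsᴵ-sum i
  bitsᴵ-sum (on i) = cong suc (bitsᴵ-sum i)

  code-inj : ∀ {g k T} (c d : G g k T) → (∀ v → v < g → width c v ≡ width d v) →
    (∀ v b → v < g → bits c v b ≡ bits d v b) → c ≡ d
  codeᴵ-inj : ∀ {g k T} (i j : I g k T) → (∀ v → v < suc g → widthᴵ i v ≡ widthᴵ j v) →
    (∀ v b → v < suc g → bitsᴵ i v b ≡ bitsᴵ j v b) → i ≡ j
  code-inj done done w r = refl
  code-inj (next c) (next d) w r = cong next (code-inj c d (λ v h → w (suc v) (s≤s h)) (λ v b h → r (suc v) b (s≤s h)))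
  code-inj (next c) (row j) w r with () ← w 0 z<s
  code-inj (row i) (next d) w r with () ← w 0 z<s
  code-inj (row i) (row j) w r = cong row (codeᴵ-inj i j
    (λ { zero h → suc-injective (w 0 h) ; (suc v) h → w (suc v) h })
    (λ { zero b h → r 0 (suc b) h ; (suc v) b h → r (suc v) b h }))
  codeᴵ-inj (end c) (end d) w r = cong end (code-inj c d (λ v h → w (suc v) (s≤s h)) (λ v b h → r (suc v) b (s≤s h)))
  codeᴵ-inj (end c) (off j) w r with () ← w 0 z<s
  codeᴵ-inj (end c) (on j) w r with () ← w 0 z<s
  codeᴵ-inj (off i) (end d) w r with () ← w 0 z<s
  codeᴵ-inj (on i) (end d) w r with () ← w 0 z<s
  codeᴵ-inj (off i) (on j) w r with () ← r 0 0 z<s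
  codeᴵ-inj (on i) (off j) w r with () ← r 0 0 z<s
  codeᴵ-inj (off i) (off j) w r = cong off (codeᴵ-inj i j
    (λ { zero h → suc-injective (w 0 h) ; (suc v) h → w (suc v) h })
    (λ { zero b h → r 0 (suc b) h ; (suc v) b h → r (suc v) b h }))
  codeᴵ-inj (on i) (on j) w r = cong on (codeᴵ-inj i j
    (λ { zero h → suc-injective (w 0 h) ; (suc v) h → w (suc v) h })
    (λ { zero b h → r 0 (suc b) h ; (suc v) b h → r (suc v) b h }))

  private
    Bits : ℕ → (ℕ → ℕ) → Tab → ℕ
    Bits g M R = ∑ g (λ v → ∑ (M v) (𝟙 ∘ R v))

  encode : ∀ g T M R → (∀ v b → R v b ≡ true → b < M v) → (∀ v → 0 < M v → R v 0 ≡ true) → ∑ g M ≤ T →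
    Σ[ c ∈ G g (Bits g M R) T ] (∀ v → v < g → width c v ≡ M v) × (∀ v b → v < g → bits c v b ≡ R v b)
  encodeᴵ : ∀ g T m (r : ℕ → Bool) M R → (∀ b → r b ≡ true → b < m) → (∀ v b → R v b ≡ true → b < M v) → (∀ v → 0 < M v → R v 0 ≡ true) → m + ∑ g M ≤ T →
    Σ[ i ∈ I g (∑ m (𝟙 ∘ r) + Bits g M R) T ] widthᴵ i 0 ≡ m × (∀ b → bitsᴵ i 0 b ≡ r b) ×
       (∀ v → v < g → widthᴵ i (suc v) ≡ M v) × (∀ v b → v < g → bitsᴵ i (suc v) b ≡ R v b)
  encode zero T M R bd top le = done , (λ _ ()) , λ _ _ ()
  encode (suc g) T M R bd top le with M 0 in eq
  ... | zero = let c , w , r = encode g T (M ∘ suc) (R ∘ suc) (bd ∘ suc) (top ∘ suc) le in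
    next c , (λ { zero _ → sym eq ; (suc v) (s≤s h) → w v h })
           , λ { zero b _ → sym (¬true⇒false λ h → n≮0 (subst (b <_) eq (bd 0 b h))) ; (suc v) b (s≤s h) → r v b h }
  encode (suc g) (suc T) M R bd top (s≤s le) | suc m
    -- The first bit of a nonempty row is forced to be true: `row` counts it towards k and T without
    -- offering a choice.
    rewrite top 0 (subst (0 <_) (sym eq) z<s) =
    let i , w₀ , r₀ , w , r = encodeᴵ g T m (R 0 ∘ suc) (M ∘ suc) (R ∘ suc)
              (λ b h → ≤-pred (subst (suc b <_) eq (bd 0 (suc b) h))) (bd ∘ suc) (top ∘ suc) le in
    row i , (λ { zero _ → trans (cong suc w₀) (sym eq) ; (suc v) (s≤s h) → w v h })
          , λ { zero zero _ → sym (top 0 (subst (0 <_) (sym eq) z<s)) ; zero (suc b) _ → r₀ b ; (suc v) b (s≤s h) → r v b h }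
  encodeᴵ g T zero r M R bd₀ bd top le =
    let c , w , rr = encode g T M R bd top le in
    end c , refl , (λ b → sym (¬true⇒false λ h → n≮0 (bd₀ b h))) , w , rr
  encodeᴵ g (suc T) (suc m) r M R bd₀ bd top (s≤s le)
    with encodeᴵ g T m (r ∘ suc) M R (λ b h → ≤-pred (bd₀ (suc b) h)) bd top le | r 0 in eq
  ... | i , w₀ , r₀ , w , rr | true = on i , cong suc w₀ , (λ { zero → sym eq ; (suc b) → r₀ b }) , w , rr
  ... | i , w₀ , r₀ , w , rr | false = off i , cong suc w₀ , (λ { zero → sym eq ; (suc b) → r₀ b }) , w , rr

  -- The recursion follows the constructors of `G` and `I`, with the weight evaluated at the final
  -- slack. Constant weight 1 counts words; weight 2 + slack counts pairs of a word and an uncovered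
  -- vertex.
  module Count (weight : ℕ → ℕ) where

    tot totᴿ totᴵ totᴼ totᴺ : ℕ → ℕ → ℕ → ℕ
    tot zero zero T = weight T
    tot zero (suc k) T = 0
    tot (suc g) k T = tot g k T + totᴿ g k T
    totᴿ g (suc k) (suc T) = totᴵ g k T
    totᴿ g _ _ = 0
    totᴵ g k T = tot g k T + (totᴼ g k T + totᴺ g k T)
    totᴼ g k zero = 0
    totᴼ g k (suc T) = totᴵ g k T
    totᴺ g (suc k) (suc T) = totᴵ g k T
    totᴺ g _ _ = 0

  open Count (const 1) using () renaming (tot to num; totᴿ to numᴿ; totᴵ to numᴵ; totᴼ to numᴼ; totᴺ to numᴺ) public

  code : ∀ g k T → Fin (num g k T) → G g k T
  codeᴿ : ∀ g k T → Fin (numᴿ g k T) → G (suc g) k T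
  codeᴵ : ∀ g k T → Fin (numᴵ g k T) → I g k T
  codeᴼ : ∀ g k T → Fin (numᴼ g k T) → I g k T
  codeᴺ : ∀ g k T → Fin (numᴺ g k T) → I g k T
  code zero zero T _ = done
  code (suc g) k T x = [ next ∘ code g k T , codeᴿ g k T ]′ (splitAt (num g k T) x)
  codeᴿ g (suc k) (suc T) x = row (codeᴵ g k T x)
  codeᴵ g k T x = [ end ∘ code g k T , [ codeᴼ g k T , codeᴺ g k T ]′ ∘ splitAt (numᴼ g k T) ]′ (splitAt (num g k T) x)
  codeᴼ g k (suc T) x = off (codeᴵ g k T x)
  codeᴺ g (suc k) (suc T) x = on (codeᴵ g k T x)

  index : ∀ {g k T} → G g k T → Fin (num g k T)
  indexᴵ : ∀ {g k T} → I g k T → Fin (numᴵ g k T)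
  index done = zero
  index {suc g} {k} {T} (next c) = index c ↑ˡ numᴿ g k T
  index {suc g} {suc k} {suc T} (row i) = num g (suc k) (suc T) ↑ʳ indexᴵ i
  indexᴵ {g} {k} {T} (end c) = index c ↑ˡ (numᴼ g k T + numᴺ g k T)
  indexᴵ {g} {k} {suc T} (off i) = num g k (suc T) ↑ʳ (indexᴵ i ↑ˡ numᴺ g k (suc T))
  indexᴵ {g} {suc k} {suc T} (on i) = num g (suc k) (suc T) ↑ʳ (numᴼ g (suc k) (suc T) ↑ʳ indexᴵ i)

  code-index : ∀ {g k T} (c : G g k T) → code g k T (index c) ≡ c
  codeᴵ-index : ∀ {g k T} (i : I g k T) → codeᴵ g k T (indexᴵ i) ≡ i
  code-index done = refl
  code-index {suc g} {k} {T} (next c) rewrite splitAt-↑ˡ (num g k T) (index c) (numᴿ g k T) = cong next (code-index c)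
  code-index {suc g} {suc k} {suc T} (row i)
    rewrite splitAt-↑ʳ (num g (suc k) (suc T)) (numᴿ g (suc k) (suc T)) (indexᴵ i) = cong row (codeᴵ-index i)
  codeᴵ-index {g} {k} {T} (end c) rewrite splitAt-↑ˡ (num g k T) (index c) (numᴼ g k T + numᴺ g k T) = cong end (code-index c)
  codeᴵ-index {g} {k} {suc T} (off i)
    rewrite splitAt-↑ʳ (num g k (suc T)) (numᴼ g k (suc T) + numᴺ g k (suc T)) (indexᴵ i ↑ˡ numᴺ g k (suc T))
          | splitAt-↑ˡ (numᴼ g k (suc T)) (indexᴵ i) (numᴺ g k (suc T)) = cong off (codeᴵ-index i)
  codeᴵ-index {g} {suc k} {suc T} (on i)
    rewrite splitAt-↑ʳ (num g (suc k) (suc T)) (numᴼ g (suc k) (suc T) + numᴺ g (suc k) (suc T)) (numᴼ g (suc k) (suc T) ↑ʳ indexᴵ i)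
          | splitAt-↑ʳ (numᴼ g (suc k) (suc T)) (numᴺ g (suc k) (suc T)) (indexᴵ i) = cong on (codeᴵ-index i)

  unsplit : ∀ m {n} (x : Fin (m + n)) {s} → splitAt m x ≡ s → join m n s ≡ x
  unsplit m {n} x e = trans (cong (join m n) (sym e)) (join-splitAt m n x)

  index-code : ∀ g k T x → index (code g k T x) ≡ x
  indexᴿ-code : ∀ g k T x → index (codeᴿ g k T x) ≡ num g k T ↑ʳ x
  indexᴵ-code : ∀ g k T x → indexᴵ (codeᴵ g k T x) ≡ x
  indexᴼ-code : ∀ g k T x → indexᴵ (codeᴼ g k T x) ≡ num g k T ↑ʳ (x ↑ˡ numᴺ g k T)
  indexᴺ-code : ∀ g k T x → indexᴵ (codeᴺ g k T x) ≡ num g k T ↑ʳ (numᴼ g k T ↑ʳ x)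
  index-code zero zero T zero = refl
  index-code (suc g) k T x with splitAt (num g k T) x in eq
  ... | inj₁ y = trans (cong (_↑ˡ numᴿ g k T) (index-code g k T y)) (unsplit (num g k T) x eq)
  ... | inj₂ y = trans (indexᴿ-code g k T y) (unsplit (num g k T) x eq)
  indexᴿ-code g (suc k) (suc T) x = cong (num g (suc k) (suc T) ↑ʳ_) (indexᴵ-code g k T x)
  indexᴵ-code g k T x with splitAt (num g k T) x in eq
  ... | inj₁ y = trans (cong (_↑ˡ (numᴼ g k T + numᴺ g k T)) (index-code g k T y)) (unsplit (num g k T) x eq)
  ... | inj₂ y with splitAt (numᴼ g k T) y in eq′
  ... | inj₁ z = trans (indexᴼ-code g k T z) (trans (cong (num g k T ↑ʳ_) (unsplit (numᴼ g k T) y eq′)) (unsplit (num g k T) x eq))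
  ... | inj₂ z = trans (indexᴺ-code g k T z) (trans (cong (num g k T ↑ʳ_) (unsplit (numᴼ g k T) y eq′)) (unsplit (num g k T) x eq))
  indexᴼ-code g k (suc T) x = cong (λ y → num g k (suc T) ↑ʳ (y ↑ˡ numᴺ g k (suc T))) (indexᴵ-code g k T x)
  indexᴺ-code g (suc k) (suc T) x = cong (λ y → num g (suc k) (suc T) ↑ʳ (numᴼ g (suc k) (suc T) ↑ʳ y)) (indexᴵ-code g k T x)

  sum-splitAt : ∀ m n {X : Set} (f : Fin m → X) (g : Fin n → X) (h : X → ℕ) →
    sum (h ∘ [ f , g ]′ ∘ splitAt m) ≡ sum (h ∘ f) + sum (h ∘ g)
  sum-splitAt zero n f g h = refl
  sum-splitAt (suc m) n f g h = trans (cong (h (f zero) +_) (trans (sum-cong-≗ lem) (sum-splitAt m n (f ∘ suc) g h)))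
    (sym (+-assoc (h (f zero)) _ _))
    where
    lem : ∀ x → h ([ f , g ]′ (splitAt (suc m) (suc x))) ≡ h ([ f ∘ suc , g ]′ (splitAt m x))
    lem x with splitAt m x
    ... | inj₁ _ = refl
    ... | inj₂ _ = refl

  module _ (weight : ℕ → ℕ) where
    open Count weight

    sum-slack : ∀ g k T → sum (weight ∘ slack ∘ code g k T) ≡ tot g k T
    sum-slackᴿ : ∀ g k T → sum (weight ∘ slack ∘ codeᴿ g k T) ≡ totᴿ g k T
    sum-slackᴵ : ∀ g k T → sum (weight ∘ slackᴵ ∘ codeᴵ g k T) ≡ totᴵ g k T
    sum-slackᴼ : ∀ g k T → sum (weight ∘ slackᴵ ∘ codeᴼ g k T) ≡ totᴼ g k T
    sum-slackᴺ : ∀ g k T → sum (weight ∘ slackᴵ ∘ codeᴺ g k T) ≡ totᴺ g k T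
    sum-slack zero zero T = +-identityʳ _
    sum-slack zero (suc k) T = refl
    sum-slack (suc g) k T = trans (sum-splitAt (num g k T) (numᴿ g k T) (next ∘ code g k T) (codeᴿ g k T) (weight ∘ slack))
      (cong₂ _+_ (sum-slack g k T) (sum-slackᴿ g k T))
    sum-slackᴿ g zero T = refl
    sum-slackᴿ g (suc k) zero = refl
    sum-slackᴿ g (suc k) (suc T) = sum-slackᴵ g k T
    sum-slackᴵ g k T = trans (sum-splitAt (num g k T) (numᴼ g k T + numᴺ g k T) (end ∘ code g k T) _ (weight ∘ slackᴵ))
      (cong₂ _+_ (sum-slack g k T) (trans (sum-splitAt (numᴼ g k T) (numᴺ g k T) (codeᴼ g k T) (codeᴺ g k T) (weight ∘ slackᴵ))
        (cong₂ _+_ (sum-slackᴼ g k T) (sum-slackᴺ g k T))))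
    sum-slackᴼ g k zero = refl
    sum-slackᴼ g k (suc T) = sum-slackᴵ g k T
    sum-slackᴺ g zero T = refl
    sum-slackᴺ g (suc k) zero = refl
    sum-slackᴺ g (suc k) (suc T) = sum-slackᴵ g k T

  module FamEnum {N′ T : ℕ} (T<N : T < suc N′) (N≤T+2 : suc N′ ≤ 2 + T) (k : ℕ) where
    private N = suc N′

    widthᴾ : G N k T → ℕ → ℕ
    widthᴾ c v = width c (v % N)

    bitsᴾ : G N k T → Tab
    bitsᴾ c v = bits c (v % N)

    code-spec : (c : G N k T) → Spec N T k (widthᴾ c) (bitsᴾ c)
    code-spec c = record
      { M-per = λ v → cong (width c) ([m+n]%n≡m%n v N)
      ; R-per = λ b v → cong (λ u → bits c u b) ([m+n]%n≡m%n v N)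
      ; R<M = λ {v} {b} → bits<width c (v % N) b
      ; R-top = λ {v} → bits-top c (v % N)
      ; M-sum = subst (_≤ T) (sym (∑-cong N λ v h → cong (width c) (m<n⇒m%n≡m h)))
          (subst (∑ N (width c) ≤_) (width-sum c) (m≤m+n _ _))
      ; R-cnt = trans (∑-cong N λ v h → cong (λ u → ∑ (width c u) (𝟙 ∘ bits c u)) (m<n⇒m%n≡m h)) (bits-sum c)
      }

    table : G N k T → Tab
    table c = Heights.Arcs.arcs (widthᴾ c) (bitsᴾ c)

    table-fam : ∀ c → Fam N T k (table c)
    table-fam c = FromSpec.isFam T<N (code-spec c)

    table-inj : ∀ c d → table c ≈ table d → c ≡ d
    table-inj c d h = code-inj c d
      (λ v v<N → subst (λ u → width c u ≡ width d u) (m<n⇒m%n≡m v<N) (proj₁ same v))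
      (λ v b v<N → subst (λ u → bits c u b ≡ bits d u b) (m<n⇒m%n≡m v<N) (proj₂ same v b))
      where same = arcs-injective T<N (code-spec c) (code-spec d) h

    arcs-cong : ∀ {M M′ R R′} → (∀ v → M v ≡ M′ v) → R ≈ R′ → Heights.Arcs.arcs M R ≈ Heights.Arcs.arcs M′ R′
    arcs-cong {M} {M′} {R} {R′} w r v ℓ = bool-ext (go w r) (go (sym ∘ w) (≈-sym r))
      where
      go : ∀ {M M′ R R′} → (∀ v → M v ≡ M′ v) → R ≈ R′ → Heights.Arcs.arcs M R v ℓ ≡ true → Heights.Arcs.arcs M′ R′ v ℓ ≡ true
      go {M} {M′} {R} {R′} w r h with Heights.Arcs.arcs-elim M R v ℓ h
      ... | b , Heights.hit p q s , rb = Heights.Arcs.arcs-intro M′ R′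
        (Heights.hit p (trans q (cong suc (∑-cong ℓ λ j _ → w (v + j))))
          (λ {i} i< 0<i → subst (i + b ≤_) (∑-cong i λ j _ → w (v + j)) (s i< 0<i)))
        (trans (sym (r v b)) rb)

    spec-code : ∀ {M R} → Spec N T k M R → Σ[ c ∈ G N k T ] (∀ v → widthᴾ c v ≡ M v) × bitsᴾ c ≈ R
    spec-code {M} {R} s =
      subst (λ k → Σ[ c ∈ G N k T ] (∀ v → width c (v % N) ≡ M v) × (λ v → bits c (v % N)) ≈ R) R-cnt
        (let c , w , r = encode N T M R (λ _ _ → R<M) (λ _ → R-top) M-sum in
          c , (λ v → trans (w (v % N) (m%n<n v N)) (sym (periodic-% {N = N} M-per v)))
            , (λ v b → trans (r (v % N) b (m%n<n v N)) (sym (periodic-% {N = N} (R-per b) v))))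
      where open Spec s

    fam-code : ∀ {A} → Fam N T k A → Σ[ c ∈ G N k T ] table c ≈ A
    fam-code f = let module F = FromFam T<N N≤T+2 f
                     c , w , r = spec-code F.spec
                 in c , ≈-trans (arcs-cong w r) F.arcs-≈

    famEnum : Enum (Fam N T k) (num N k T)
    famEnum = record
      { at = table ∘ code N k T
      ; at-P = table-fam ∘ code N k T
      ; at-inj = λ {i} {j} h → trans (sym (index-code N k T i)) (trans (cong index (table-inj (code N k T i) (code N k T j) h)) (index-code N k T j))
      ; idx = λ t f → index (proj₁ (fam-code f))
      ; at-idx = λ t f → ≈-trans (λ v ℓ → cong (λ c → table c v ℓ) (code-index (proj₁ (fam-code f)))) (proj₂ (fam-code f))
      }

    -- The total width is N minus the number of uncovered vertices by `unc-total`, and T minus the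
    -- slack by `width-sum`.
    unc-slack : N ≡ 2 + T → ∀ c → ∑ N (𝟙 ∘ unc N T (table c)) ≡ 2 + slack c
    unc-slack N≡ c = +-cancelʳ-≡ (∑ N (width c)) _ _ (begin
      ∑ N (𝟙 ∘ unc N T (table c)) + ∑ N (width c) ≡⟨ cong (∑ N (𝟙 ∘ unc N T (table c)) +_) (∑-cong N sameM) ⟨
      ∑ N (𝟙 ∘ unc N T (table c)) + ∑ N F.M ≡⟨ F.unc-total ⟩
      N ≡⟨ N≡ ⟩
      2 + T ≡⟨ cong (2 +_) (width-sum c) ⟨
      2 + (∑ N (width c) + slack c) ≡⟨ cong (2 +_) (+-comm _ (slack c)) ⟩
      2 + slack c + ∑ N (width c) ∎)
      where
      open ≡-Reasoning
      module F = FromFam T<N N≤T+2 (table-fam c)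
      sameM : ∀ v → v < N → F.M v ≡ width c v
      sameM v v<N = trans (proj₁ (arcs-injective T<N F.spec (code-spec c) F.arcs-≈) v) (cong (width c) (m<n⇒m%n≡m v<N))

open Words using (num; code; slack; sum-slack; module Count; module FamEnum)

-- Closed forms, and families with vertex 0 uncovered.

module RootedFamilies where
  open import Data.Nat using (_+_; _*_)
  open import Data.Nat.Combinatorics using (_C_; nCn≡1; nC1≡n; nCk+nC[k+1]≡[n+1]C[k+1]; k>n⇒nCk≡0)

  -- Multisets of size k from g rows. Zero rows are treated apart because the binomial has upper
  -- entry g - 1 + k.
  multichoose : ℕ → ℕ → ℕ
  multichoose zero zero = 1
  multichoose zero (suc k) = 0
  multichoose (suc g) k = (g + k) C k

  multichoose-0 : ∀ g → multichoose g 0 ≡ 1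
  multichoose-0 zero = refl
  multichoose-0 (suc g) = refl

  multichoose-suc : ∀ g k → multichoose (suc g) (suc k) ≡ multichoose g (suc k) + multichoose (suc g) k
  multichoose-suc zero k = trans (nCn≡1 (suc k)) (sym (nCn≡1 k))
  multichoose-suc (suc g) k = begin
    (suc g + suc k) C suc k ≡⟨ cong (_C suc k) (+-suc (suc g) k) ⟩
    suc (suc g + k) C suc k ≡⟨ nCk+nC[k+1]≡[n+1]C[k+1] (suc g + k) k ⟨
    (suc g + k) C k + (suc g + k) C suc k ≡⟨ +-comm ((suc g + k) C k) _ ⟩
    (suc g + k) C suc k + (suc g + k) C k ≡⟨ cong (λ n → n C suc k + (suc g + k) C k) (+-suc g k) ⟨
    (g + suc k) C suc k + (suc g + k) C k ∎

  -- A word is two independent choices: a weakly increasing assignment of the k true bits to g rows,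
  -- and the lengths of the runs of false bits after them, the remainder being slack. W gives the
  -- weighted number of second choices, and the induction uses Pascal's rule for it together with
  -- its vanishing at T = 0, k > 0.
  module ClosedForm (W : ℕ → ℕ → ℕ) (W-0 : ∀ k → W 0 (suc k) ≡ 0)
    (W-suc : ∀ T k → W (suc T) (suc k) ≡ W T k + W T (suc k)) where
    open Count (λ T → W T 0)

    tot≡ : ∀ g k T → tot g k T ≡ multichoose g k * W T k
    -- Inside a row the k true bits to come choose among the current row and the g rows ahead. The
    -- shift of both arguments of W restores the true bit read last, whose run of false bits is
    -- still open.
    totᴵ≡ : ∀ g k T → totᴵ g k T ≡ multichoose (suc g) k * W (suc T) (suc k)
    tot≡ zero zero T = sym (+-identityʳ _)
    tot≡ zero (suc k) T = refl
    tot≡ (suc g) zero T = trans (+-identityʳ _) (trans (tot≡ g 0 T) (cong (_* W T 0) (multichoose-0 g)))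
    tot≡ (suc g) (suc k) zero = trans (+-identityʳ _) (trans (tot≡ g (suc k) 0)
      (trans (zero-out (multichoose g (suc k))) (sym (zero-out (multichoose (suc g) (suc k))))))
      where
      zero-out : ∀ x → x * W 0 (suc k) ≡ 0
      zero-out x = trans (cong (x *_) (W-0 k)) (*-zeroʳ x)
    tot≡ (suc g) (suc k) (suc T) = begin
      tot g (suc k) (suc T) + totᴵ g k T ≡⟨ cong₂ _+_ (tot≡ g (suc k) (suc T)) (totᴵ≡ g k T) ⟩
      multichoose g (suc k) * w + multichoose (suc g) k * w ≡⟨ *-distribʳ-+ w (multichoose g (suc k)) _ ⟨
      (multichoose g (suc k) + multichoose (suc g) k) * w ≡⟨ cong (_* w) (multichoose-suc g k) ⟨
      multichoose (suc g) (suc k) * w ∎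
      where w = W (suc T) (suc k)
    totᴵ≡ g zero zero = begin
      tot g 0 0 + 0 ≡⟨ +-identityʳ _ ⟩
      tot g 0 0 ≡⟨ tot≡ g 0 0 ⟩
      multichoose g 0 * W 0 0 ≡⟨ cong₂ _*_ (multichoose-0 g) (trans (sym (+-identityʳ _)) (trans (cong (W 0 0 +_) (sym (W-0 0))) (sym (W-suc 0 0)))) ⟩
      multichoose (suc g) 0 * W 1 1 ∎
    totᴵ≡ g (suc k) zero = begin
      tot g (suc k) 0 + 0 ≡⟨ +-identityʳ _ ⟩
      tot g (suc k) 0 ≡⟨ tot≡ g (suc k) 0 ⟩
      multichoose g (suc k) * W 0 (suc k) ≡⟨ cong (multichoose g (suc k) *_) (W-0 k) ⟩
      multichoose g (suc k) * 0 ≡⟨ *-zeroʳ (multichoose g (suc k)) ⟩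
      0 ≡⟨ *-zeroʳ (multichoose (suc g) (suc k)) ⟨
      multichoose (suc g) (suc k) * 0 ≡⟨ cong (multichoose (suc g) (suc k) *_) (trans (W-suc 0 (suc k)) (cong₂ _+_ (W-0 k) (W-0 (suc k)))) ⟨
      multichoose (suc g) (suc k) * W 1 (suc (suc k)) ∎
    totᴵ≡ g zero (suc T) = begin
      tot g 0 (suc T) + (totᴵ g 0 T + 0) ≡⟨ cong₂ (λ x y → x + (y + 0)) (tot≡ g 0 (suc T)) (totᴵ≡ g 0 T) ⟩
      multichoose g 0 * W (suc T) 0 + (1 * W (suc T) 1 + 0) ≡⟨ cong (λ x → x * W (suc T) 0 + (1 * W (suc T) 1 + 0)) (multichoose-0 g) ⟩
      1 * W (suc T) 0 + (1 * W (suc T) 1 + 0) ≡⟨ lem (W (suc T) 0) (W (suc T) 1) ⟩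
      1 * (W (suc T) 0 + W (suc T) 1) ≡⟨ cong (1 *_) (W-suc (suc T) 0) ⟨
      1 * W (suc (suc T)) 1 ∎
      where
      lem : ∀ a b → 1 * a + (1 * b + 0) ≡ 1 * (a + b)
      lem = solve-∀
    totᴵ≡ g (suc k) (suc T) = begin
      tot g (suc k) (suc T) + (totᴵ g (suc k) T + totᴵ g k T)
        ≡⟨ cong₂ _+_ (tot≡ g (suc k) (suc T)) (cong₂ _+_ (totᴵ≡ g (suc k) T) (totᴵ≡ g k T)) ⟩
      x * w + (multichoose (suc g) (suc k) * w′ + y * w) ≡⟨ cong (λ z → x * w + (z * w′ + y * w)) (multichoose-suc g k) ⟩
      x * w + ((x + y) * w′ + y * w) ≡⟨ lem x y w w′ ⟩
      (x + y) * (w + w′) ≡⟨ cong₂ _*_ (multichoose-suc g k) (W-suc (suc T) (suc k)) ⟨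
      multichoose (suc g) (suc k) * W (suc (suc T)) (suc (suc k)) ∎
      where
      x = multichoose g (suc k)
      y = multichoose (suc g) k
      w = W (suc T) (suc k)
      w′ = W (suc T) (suc (suc k))
      lem : ∀ x y w w′ → x * w + ((x + y) * w′ + y * w) ≡ (x + y) * (w + w′)
      lem = solve-∀

  num≡ : ∀ g k T → num g k T ≡ multichoose g k * (T C k)
  num≡ = ClosedForm.tot≡ _C_ (λ k → k>n⇒nCk≡0 {0} {suc k} z<s) (λ T k → sym (nCk+nC[k+1]≡[n+1]C[k+1] T k))

  -- The sum of 2 + slack over all run lengths: there are T C k of them, and their slacks add up to
  -- T C (k + 1).
  slack-weight : ℕ → ℕ → ℕ
  slack-weight T k = 2 * (T C k) + T C suc k

  tot-slack≡ : ∀ g k T → Count.tot (λ T → slack-weight T 0) g k T ≡ multichoose g k * slack-weight T k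
  tot-slack≡ = ClosedForm.tot≡ slack-weight
    (λ k → cong₂ (λ x y → 2 * x + y) (k>n⇒nCk≡0 {0} {suc k} z<s) (k>n⇒nCk≡0 {0} {suc (suc k)} z<s))
    (λ T k → begin
      2 * (suc T C suc k) + suc T C suc (suc k)
        ≡⟨ cong₂ (λ x y → 2 * x + y) (nCk+nC[k+1]≡[n+1]C[k+1] T k) (nCk+nC[k+1]≡[n+1]C[k+1] T (suc k)) ⟨
      2 * (T C k + T C suc k) + (T C suc k + T C suc (suc k)) ≡⟨ lem (T C k) (T C suc k) (T C suc (suc k)) ⟩
      slack-weight T k + slack-weight T (suc k) ∎)
    where
    lem : ∀ a b c → 2 * (a + b) + (b + c) ≡ 2 * a + b + (2 * b + c)
    lem = solve-∀

  sum-∑-swap : ∀ {K} n (f : Fin K → ℕ → ℕ) → sum (λ i → ∑ n (f i)) ≡ ∑ n (λ j → sum (λ i → f i j))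
  sum-∑-swap {K} zero f = sum-replicate-zero K
  sum-∑-swap (suc n) f = trans (∑-distrib-+ (λ i → f i 0) (λ i → ∑ n (f i ∘ suc)))
    (cong (sum (λ i → f i 0) +_) (sum-∑-swap n (λ i → f i ∘ suc)))

  shift : ℕ → Tab → Tab
  shift u A v ℓ = A (v + u) ℓ

  shift-fam : ∀ {N T k A} u → Fam N T k A → Fam N T k (shift u A)
  shift-fam {N} {T} {k} {A} u f = record
    { per = λ ℓ v → trans (cong (λ x → A x ℓ) (+-swapʳ v N u)) (per ℓ (v + u))
    ; len₂ = len₂
    ; len = len
    ; nc = λ {v} {ℓ} {i} {m} a b → nc a (subst (λ x → A x m ≡ true) (+-swapʳ v i u) b)
    ; cnt = trans (trans (∑-cong N λ v _ → cong (λ x → ∑ (2 + T) (𝟙 ∘ A x)) (+-comm v u))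
        (∑-shift {N} {λ v → ∑ (2 + T) (𝟙 ∘ A v)} (λ v → ∑-cong (2 + T) λ ℓ _ → cong 𝟙 (per ℓ v)) u)) cnt
    }
    where open Fam f

  module RootedCount (T k : ℕ) where
    private
      N = 2 + T
      T<N : T < N
      T<N = m≤n+m (suc T) 1

    open FamEnum {suc T} {T} T<N ≤-refl k

    uncEnum : ∀ u → Enum (λ t → Fam N T k t × unc N T t u ≡ true) _
    uncEnum u = enum-sub famEnum (λ i → unc N T (Enum.at famEnum i) u) (λ t → unc N T t u ≡ true) (λ _ h → h)
      (λ t p h → trans (unc-≡ {N} {T} λ i ℓ → Enum.at-idx famEnum t p (u + i) ℓ) h)

    rooted : ℕ → ℕ
    rooted u = sum (λ i → 𝟙 (unc N T (Enum.at famEnum i) u))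

    shift-inj : ∀ {A B} u → u ≤ N → Fam N T k A → Fam N T k B → shift u A ≈ shift u B → A ≈ B
    shift-inj {A} {B} u u≤N f g h v ℓ with m≤n⇒∃ u≤N
    ... | w , e = trans (sym (trans (cong (λ x → A x ℓ) pos) (Fam.per f ℓ v)))
        (trans (h (v + w) ℓ) (trans (cong (λ x → B x ℓ) pos) (Fam.per g ℓ v)))
      where
      pos : v + w + u ≡ v + N
      pos = trans (+-assoc v w u) (cong (v +_) (trans (+-comm w u) e))

    rooted-≡ : ∀ u → u < N → rooted u ≡ rooted 0
    rooted-≡ u u<N = ≤-antisym
      (enum-≤ (uncEnum u) (uncEnum 0) (shift u)
        (λ t (f , h) → shift-fam u f , trans (unc-≡ {N} {T} λ i ℓ → cong (λ x → t x ℓ) (+-comm i u)) h)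
        (λ t t′ (f , _) (g , _) → shift-inj u (<⇒≤ u<N) f g))
      (enum-≤ (uncEnum 0) (uncEnum u) (shift w)
        (λ t (f , h) → shift-fam w f , trans (unc-≡ {N} {T} λ i ℓ →
            trans (cong (λ x → t x ℓ) (trans (cong (_+ w) (+-comm u i)) (trans (+-assoc i u w) (cong (i +_) e)))) (Fam.per f ℓ i)) h)
        (λ t t′ (f , _) (g , _) → shift-inj w (subst (w ≤_) e (m≤n+m w u)) f g))
      where
      w = proj₁ (m≤n⇒∃ (<⇒≤ u<N))
      e : u + w ≡ N
      e = proj₂ (m≤n⇒∃ (<⇒≤ u<N))

    -- Pairs of a family and an uncovered vertex of it are counted twice: by vertex, all vertices
    -- being equivalent under rotation, and by family through `unc-slack`.
    rooted-total : N * rooted 0 ≡ multichoose N k * slack-weight T k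
    rooted-total = begin
      N * rooted 0 ≡⟨ ∑-const N (rooted 0) ⟨
      ∑ N (λ _ → rooted 0) ≡⟨ ∑-cong N rooted-≡ ⟨
      ∑ N rooted ≡⟨ sum-∑-swap N (λ i u → 𝟙 (unc N T (Enum.at famEnum i) u)) ⟨
      sum (λ i → ∑ N (𝟙 ∘ unc N T (Enum.at famEnum i))) ≡⟨ sum-cong-≗ (λ i → unc-slack refl (code N k T i)) ⟩
      sum (λ i → 2 + slack (code N k T i)) ≡⟨ sum-cong-≗ (λ i → lem (slack (code N k T i))) ⟩
      sum (λ i → slack-weight (slack (code N k T i)) 0) ≡⟨ sum-slack (λ T → slack-weight T 0) N k T ⟩
      Count.tot (λ T → slack-weight T 0) N k T ≡⟨ tot-slack≡ N k T ⟩
      multichoose N k * slack-weight T k ∎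
      where
      lem : ∀ s → 2 + s ≡ slack-weight s 0
      lem s = sym (cong (2 +_) (nC1≡n s))

open RootedFamilies

-- Dissections with a rotational period as arc families of a quotient cycle.

module ChordTables where
  open import Data.Nat using (_+_; _*_; _≟_)

  -- Dissections of the n-gon as tables of chords: C v ℓ says that the chord joining v and v + ℓ is present.
  record Cyc (n k : ℕ) (C : Tab) : Set where
    field
      per : ∀ ℓ → Periodic n (λ v → C v ℓ)
      len₂ : ∀ {v ℓ} → C v ℓ ≡ true → 2 ≤ ℓ
      len : ∀ {v ℓ} → C v ℓ ≡ true → 2 + ℓ ≤ n
      flip : ∀ v ℓ m → ℓ + m ≡ n → C v ℓ ≡ C (v + ℓ) m
      nc : ∀ {v ℓ i m} → C v ℓ ≡ true → C (v + i) m ≡ true → 0 < i → i < ℓ → ℓ < i + m → i + m < n → ⊥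
      cnt : ∑ n (λ v → ∑ n (𝟙 ∘ C v)) ≡ 2 * k

  Period : ℕ → Tab → Set
  Period r C = ∀ ℓ → Periodic r (λ v → C v ℓ)

  𝟙-∨ : ∀ a b → (a ≡ true → b ≡ true → ⊥) → 𝟙 (a ∨ b) ≡ 𝟙 a + 𝟙 b
  𝟙-∨ true true h = ⊥-elim (h refl refl)
  𝟙-∨ true false h = refl
  𝟙-∨ false b h = refl

  -- By `T-short` every admissible arc is shorter than half the n-gon. At most one of the two arcs
  -- cut off by a chord is thus admissible, namely the one away from the centre.
  module Fixed (d g T : ℕ) (T<g : T < g) (T-short : 2 * suc T < d * g) where

    n : ℕ
    n = d * g

    toCyc : Tab → Tab
    toCyc A v ℓ = A v ℓ ∨ (does (ℓ ≤? n) ∧ A (v + ℓ) (n ∸ ℓ))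

    toFam : Tab → Tab
    toFam C v ℓ = C v ℓ ∧ does (ℓ ≤? suc T)

    toCyc-cong : ∀ {A B} → A ≈ B → toCyc A ≈ toCyc B
    toCyc-cong h v ℓ = cong₂ (λ x y → x ∨ (does (ℓ ≤? n) ∧ y)) (h v ℓ) (h (v + ℓ) (n ∸ ℓ))

    toFam-cong : ∀ {A B} → A ≈ B → toFam A ≈ toFam B
    toFam-cong h v ℓ = cong (_∧ does (ℓ ≤? suc T)) (h v ℓ)

    toCyc-elim : ∀ A v ℓ → toCyc A v ℓ ≡ true → A v ℓ ≡ true ⊎ ∃[ m ] (ℓ + m ≡ n × A (v + ℓ) m ≡ true)
    toCyc-elim A v ℓ h with ∨-elim {A v ℓ} h
    ... | inj₁ a = inj₁ a
    ... | inj₂ b = inj₂ (n ∸ ℓ , m+[n∸m]≡n (does⇒ (ℓ ≤? n) (∧-fst b)) , ∧-snd {does (ℓ ≤? n)} b)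

    toCyc-intro : ∀ A v ℓ m → ℓ + m ≡ n → A (v + ℓ) m ≡ true → toCyc A v ℓ ≡ true
    toCyc-intro A v ℓ m e a = ∨-introʳ {A v ℓ} (∧-intro (⇒does (ℓ ≤? n) (subst (ℓ ≤_) e (m≤m+n ℓ m)))
      (trans (cong (A (v + ℓ)) (trans (cong (_∸ ℓ) (sym e)) (m+n∸m≡n ℓ m))) a))

    module _ {k A} (fam : Fam g T k A) where
      open Fam fam

      n-per : ∀ ℓ → Periodic n (λ v → A v ℓ)
      n-per ℓ = periodic-* {f = λ v → A v ℓ} (per ℓ) d

      disjoint : ∀ v ℓ m → ℓ + m ≡ n → A v ℓ ≡ true → A (v + ℓ) m ≡ true → ⊥
      disjoint v ℓ m e a b = lin 4 (λ ℓ m n T → ℓ ⊕ m ≐ n ⇒ ℓ ≼ con 1 ⊕ T ⇒ m ≼ con 1 ⊕ T ⇒ 2 ⊛ (con 1 ⊕ T) ≺ n ⇒ ff)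
        ℓ m n T e (len a) (len b) T-short

      not-long : ∀ v ℓ → 2 + T ≤ ℓ → A v ℓ ≡ false
      not-long v ℓ h = ¬true⇒false λ a → n≮n _ (≤-trans h (len a))

      A-0 : ∀ v → A v 0 ≡ false
      A-0 v = ¬true⇒false λ a → n≮0 (len₂ a)

      2+T≤n : 2 + T ≤ n
      2+T≤n = lin 2 (λ T n → 2 ⊛ (con 1 ⊕ T) ≺ n ⇒ con 2 ⊕ T ≼ n) T n T-short

      count-A : ∑ n (λ v → ∑ n (𝟙 ∘ A v)) ≡ d * k
      count-A = begin
        ∑ n (λ v → ∑ n (𝟙 ∘ A v)) ≡⟨ ∑-cong n (λ v _ → ∑-extend (𝟙 ∘ A v) 2+T≤n λ ℓ h → cong 𝟙 (not-long v ℓ h)) ⟩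
        ∑ n (λ v → ∑ (2 + T) (𝟙 ∘ A v)) ≡⟨ ∑-periods {g} {λ v → ∑ (2 + T) (𝟙 ∘ A v)} (λ v → ∑-cong (2 + T) λ ℓ _ → cong 𝟙 (per ℓ v)) d ⟩
        d * ∑ g (λ v → ∑ (2 + T) (𝟙 ∘ A v)) ≡⟨ cong (d *_) cnt ⟩
        d * k ∎

      ∑-reflect : ∀ (f : ℕ → ℕ) → f 0 ≡ 0 → f n ≡ 0 → ∑ n (λ ℓ → f (n ∸ ℓ)) ≡ ∑ n f
      ∑-reflect f f0 fn = begin
        ∑ n (λ ℓ → f (n ∸ ℓ)) ≡⟨ +-identityʳ _ ⟨
        ∑ n (λ ℓ → f (n ∸ ℓ)) + 0 ≡⟨ cong (∑ n (λ ℓ → f (n ∸ ℓ)) +_) (trans (cong f (n∸n≡0 n)) f0) ⟨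
        ∑ n (λ ℓ → f (n ∸ ℓ)) + f (n ∸ n) ≡⟨ ∑-last n (λ ℓ → f (n ∸ ℓ)) ⟨
        ∑ (suc n) (λ ℓ → f (n ∸ ℓ)) ≡⟨ ∑-rev n f ⟩
        ∑ (suc n) f ≡⟨ ∑-last n f ⟩
        ∑ n f + f n ≡⟨ cong (∑ n f +_) fn ⟩
        ∑ n f + 0 ≡⟨ +-identityʳ _ ⟩
        ∑ n f ∎

      count-flipped : ∑ n (λ v → ∑ n (λ ℓ → 𝟙 (A (v + ℓ) (n ∸ ℓ)))) ≡ d * k
      count-flipped = begin
        ∑ n (λ v → ∑ n (λ ℓ → 𝟙 (A (v + ℓ) (n ∸ ℓ)))) ≡⟨ ∑-swap n n _ ⟩
        ∑ n (λ ℓ → ∑ n (λ v → 𝟙 (A (v + ℓ) (n ∸ ℓ))))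
          ≡⟨ ∑-cong n (λ ℓ _ → trans (∑-cong n λ v _ → cong (λ x → 𝟙 (A x (n ∸ ℓ))) (+-comm v ℓ))
                (∑-shift {n} {λ v → 𝟙 (A v (n ∸ ℓ))} (λ v → cong 𝟙 (n-per (n ∸ ℓ) v)) ℓ)) ⟩
        ∑ n (λ ℓ → ∑ n (λ v → 𝟙 (A v (n ∸ ℓ)))) ≡⟨ ∑-swap n n _ ⟩
        ∑ n (λ v → ∑ n (λ ℓ → 𝟙 (A v (n ∸ ℓ))))
          ≡⟨ ∑-cong n (λ v _ → ∑-reflect (𝟙 ∘ A v) (cong 𝟙 (A-0 v)) (cong 𝟙 (not-long v n 2+T≤n))) ⟩
        ∑ n (λ v → ∑ n (𝟙 ∘ A v)) ≡⟨ count-A ⟩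
        d * k ∎

      count-toCyc : ∑ n (λ v → ∑ n (𝟙 ∘ toCyc A v)) ≡ 2 * (d * k)
      count-toCyc = begin
        ∑ n (λ v → ∑ n (𝟙 ∘ toCyc A v)) ≡⟨ ∑-cong n (λ v _ → ∑-cong n λ ℓ ℓ<n → both v ℓ ℓ<n) ⟩
        ∑ n (λ v → ∑ n (λ ℓ → 𝟙 (A v ℓ) + 𝟙 (A (v + ℓ) (n ∸ ℓ)))) ≡⟨ ∑-cong n (λ v _ → ∑-+ n _ _) ⟩
        ∑ n (λ v → ∑ n (𝟙 ∘ A v) + ∑ n (λ ℓ → 𝟙 (A (v + ℓ) (n ∸ ℓ)))) ≡⟨ ∑-+ n _ _ ⟩
        ∑ n (λ v → ∑ n (𝟙 ∘ A v)) + ∑ n (λ v → ∑ n (λ ℓ → 𝟙 (A (v + ℓ) (n ∸ ℓ)))) ≡⟨ cong₂ _+_ count-A count-flipped ⟩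
        d * k + d * k ≡⟨ cong (d * k +_) (+-identityʳ (d * k)) ⟨
        2 * (d * k) ∎
        where
        both : ∀ v ℓ → ℓ < n → 𝟙 (toCyc A v ℓ) ≡ 𝟙 (A v ℓ) + 𝟙 (A (v + ℓ) (n ∸ ℓ))
        both v ℓ ℓ<n = trans (cong (λ b → 𝟙 (A v ℓ ∨ (b ∧ A (v + ℓ) (n ∸ ℓ)))) (⇒does (ℓ ≤? n) (<⇒≤ ℓ<n)))
          (𝟙-∨ (A v ℓ) _ (disjoint v ℓ (n ∸ ℓ) (m+[n∸m]≡n (<⇒≤ ℓ<n))))

      toCyc-period : Period g (toCyc A)
      toCyc-period ℓ v = cong₂ (λ x y → x ∨ (does (ℓ ≤? n) ∧ y)) (per ℓ v)
        (trans (cong (λ x → A x (n ∸ ℓ)) (+-swapʳ v g ℓ)) (per (n ∸ ℓ) (v + ℓ)))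

      -- Passing to the other side of a chord preserves crossing. In each of the four choices of
      -- sides one arc starts strictly beneath the other, and the nesting imposed by `nc`
      -- contradicts where it ends.
      toCyc-nc : ∀ {v ℓ i m} → toCyc A v ℓ ≡ true → toCyc A (v + i) m ≡ true → 0 < i → i < ℓ → ℓ < i + m → i + m < n → ⊥
      toCyc-nc {v} {ℓ} {i} {m} a b 0<i i<ℓ ℓ<i+m i+m<n with toCyc-elim A v ℓ a | toCyc-elim A (v + i) m b
      ... | inj₁ p | inj₁ q = n≮n _ (≤-trans ℓ<i+m (nc p q 0<i i<ℓ))
      ... | inj₁ p | inj₂ (m′ , e , q) with m≤n⇒∃ (<⇒≤ i+m<n)
      ... | j , ej = lin 6 (λ i m j n ℓ m′ → i ⊕ m ⊕ j ≐ n ⇒ m ⊕ m′ ≐ n ⇒ j ⊕ ℓ ≼ m′ ⇒ i ≺ ℓ ⇒ ff) i m j n ℓ m′ ej e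
            (nc {v = v + i + m} {i = j} q (trans (cong (λ x → A x ℓ) (trans (cong (_+ j) (+-assoc v i m)) (trans (+-assoc v (i + m) j) (cong (v +_) ej)))) (trans (n-per ℓ v) p))
              (lin 4 (λ i m j n → i ⊕ m ⊕ j ≐ n ⇒ i ⊕ m ≺ n ⇒ con 0 ≺ j) i m j n ej i+m<n)
              (lin 5 (λ i m j n m′ → i ⊕ m ⊕ j ≐ n ⇒ m ⊕ m′ ≐ n ⇒ con 0 ≺ i ⇒ j ≺ m′) i m j n m′ ej e 0<i)) i<ℓ
      toCyc-nc {v} {ℓ} {i} {m} a b 0<i i<ℓ ℓ<i+m i+m<n | inj₂ (ℓ′ , e , p) | inj₁ q with m≤n⇒∃ (<⇒≤ i<ℓ)
      ... | j , refl = lin 5 (λ i m j n ℓ′ → i ⊕ j ⊕ ℓ′ ≐ n ⇒ j ⊕ ℓ′ ≼ m ⇒ i ⊕ m ≺ n ⇒ ff) i m j n ℓ′ e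
            (nc {v = v + i} {i = j} q (trans (cong (λ x → A x ℓ′) (+-assoc v i j)) p)
              (lin 2 (λ i j → i ≺ i ⊕ j ⇒ con 0 ≺ j) i j i<ℓ) (+-cancelˡ-< i j m ℓ<i+m)) i+m<n
      toCyc-nc {v} {ℓ} {i} {m} a b 0<i i<ℓ ℓ<i+m i+m<n | inj₂ (ℓ′ , e , p) | inj₂ (m′ , e′ , q) with m≤n⇒∃ (<⇒≤ ℓ<i+m)
      ... | j , ej = lin 7 (λ i m j n ℓ ℓ′ m′ → ℓ ⊕ j ≐ i ⊕ m ⇒ ℓ ⊕ ℓ′ ≐ n ⇒ m ⊕ m′ ≐ n ⇒ j ⊕ m′ ≼ ℓ′ ⇒ con 0 ≺ i ⇒ ff) i m j n ℓ ℓ′ m′ ej e e′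
            (nc {v = v + ℓ} {i = j} p (trans (cong (λ x → A x m′) (trans (+-assoc v ℓ j) (trans (cong (v +_) ej) (sym (+-assoc v i m))))) q)
              (lin 4 (λ i m j ℓ → ℓ ⊕ j ≐ i ⊕ m ⇒ ℓ ≺ i ⊕ m ⇒ con 0 ≺ j) i m j ℓ ej ℓ<i+m)
              (lin 6 (λ i m j n ℓ ℓ′ → ℓ ⊕ j ≐ i ⊕ m ⇒ ℓ ⊕ ℓ′ ≐ n ⇒ i ⊕ m ≺ n ⇒ j ≺ ℓ′) i m j n ℓ ℓ′ ej e i+m<n)) 0<i

      toCyc-bounds : ∀ {v ℓ} → toCyc A v ℓ ≡ true → 2 ≤ ℓ × 2 + ℓ ≤ n
      toCyc-bounds {v} {ℓ} h with toCyc-elim A v ℓ h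
      ... | inj₁ a = len₂ a , lin 3 (λ ℓ n T → ℓ ≼ con 1 ⊕ T ⇒ 2 ⊛ (con 1 ⊕ T) ≺ n ⇒ con 2 ⊕ ℓ ≼ n) ℓ n T (len a) T-short
      ... | inj₂ (m , e , a) =
          lin 4 (λ ℓ n T m → ℓ ⊕ m ≐ n ⇒ m ≼ con 1 ⊕ T ⇒ 2 ⊛ (con 1 ⊕ T) ≺ n ⇒ con 2 ≼ ℓ) ℓ n T m e (len a) T-short
        , lin 3 (λ ℓ n m → ℓ ⊕ m ≐ n ⇒ con 2 ≼ m ⇒ con 2 ⊕ ℓ ≼ n) ℓ n m e (len₂ a)

      toCyc-flip : ∀ v ℓ m → ℓ + m ≡ n → toCyc A v ℓ ≡ true → toCyc A (v + ℓ) m ≡ true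
      toCyc-flip v ℓ m e h with toCyc-elim A v ℓ h
      ... | inj₁ a = toCyc-intro A (v + ℓ) m ℓ (trans (+-comm m ℓ) e)
              (trans (cong (λ x → A x ℓ) (trans (+-assoc v ℓ m) (cong (v +_) e))) (trans (n-per ℓ v) a))
      ... | inj₂ (m′ , e′ , a) = ∨-introˡ (trans (cong (A (v + ℓ)) (+-cancelˡ-≡ ℓ m m′ (trans e (sym e′)))) a)

      toCyc-n-per : Period n (toCyc A)
      toCyc-n-per ℓ = periodic-* {f = λ v → toCyc A v ℓ} (toCyc-period ℓ) d

      isCyc : Cyc n (d * k) (toCyc A)
      isCyc = record
        { per = toCyc-n-per
        ; len₂ = λ h → proj₁ (toCyc-bounds h)
        ; len = λ h → proj₂ (toCyc-bounds h)
        ; flip = λ v ℓ m e → bool-ext (toCyc-flip v ℓ m e) (λ h → trans (sym (toCyc-n-per ℓ v))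
            (subst (λ x → toCyc A x ℓ ≡ true) (trans (+-assoc v ℓ m) (cong (v +_) e)) (toCyc-flip (v + ℓ) m ℓ (trans (+-comm m ℓ) e) h)))
        ; nc = toCyc-nc
        ; cnt = count-toCyc
        }

      toFam-toCyc : toFam (toCyc A) ≈ A
      toFam-toCyc v ℓ = bool-ext fwd (λ a → ∧-intro (∨-introˡ a) (⇒does (ℓ ≤? suc T) (len a)))
        where
        fwd : toFam (toCyc A) v ℓ ≡ true → A v ℓ ≡ true
        fwd h with toCyc-elim A v ℓ (∧-fst h)
        ... | inj₁ a = a
        ... | inj₂ (m , e , a) = ⊥-elim (lin 4 (λ ℓ n T m → ℓ ⊕ m ≐ n ⇒ m ≼ con 1 ⊕ T ⇒ 2 ⊛ (con 1 ⊕ T) ≺ n ⇒ ℓ ≼ con 1 ⊕ T ⇒ ff) ℓ n T m e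
                (len a) T-short (does⇒ (ℓ ≤? suc T) (∧-snd {toCyc A v ℓ} h)))

    Short : Tab → Set
    Short C = ∀ v ℓ → C v ℓ ≡ true → ℓ ≤ suc T ⊎ n ≤ ℓ + suc T

    module _ {k C} (cyc : Cyc n k C) (period : Period g C) (short : Short C) where
      open Cyc cyc

      toFam-fam : Fam g T (∑ g (λ v → ∑ (2 + T) (𝟙 ∘ toFam C v))) (toFam C)
      toFam-fam = record
        { per = λ ℓ v → cong (_∧ does (ℓ ≤? suc T)) (period ℓ v)
        ; len₂ = λ h → len₂ (∧-fst h)
        ; len = bound
        ; nc = λ {v} {ℓ} {i} {m} a b 0<i i<ℓ → nest {v} {ℓ} {i} {m} a b 0<i i<ℓ
        ; cnt = refl
        }
        where
        bound : ∀ {v ℓ} → toFam C v ℓ ≡ true → ℓ ≤ suc T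
        bound {v} {ℓ} h = does⇒ (ℓ ≤? suc T) (∧-snd {C v ℓ} h)
        nest : ∀ {v ℓ i m} → toFam C v ℓ ≡ true → toFam C (v + i) m ≡ true → 0 < i → i < ℓ → i + m ≤ ℓ
        nest {v} {ℓ} {i} {m} a b 0<i i<ℓ with i + m ≤? ℓ
        ... | yes p = p
        ... | no ¬p = ⊥-elim (nc (∧-fst a) (∧-fst b) 0<i i<ℓ (≰⇒> ¬p)
                (lin 5 (λ i m ℓ T n → i ≺ ℓ ⇒ ℓ ≼ con 1 ⊕ T ⇒ m ≼ con 1 ⊕ T ⇒ 2 ⊛ (con 1 ⊕ T) ≺ n ⇒ i ⊕ m ≺ n) i m ℓ T n
                  i<ℓ (bound {v} a) (bound {v + i} b) T-short))

      toCyc-toFam : toCyc (toFam C) ≈ C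
      toCyc-toFam v ℓ = bool-ext fwd bwd
        where
        fwd : toCyc (toFam C) v ℓ ≡ true → C v ℓ ≡ true
        fwd h with toCyc-elim (toFam C) v ℓ h
        ... | inj₁ a = ∧-fst a
        ... | inj₂ (m , e , a) = trans (flip v ℓ m e) (∧-fst a)
        bwd : C v ℓ ≡ true → toCyc (toFam C) v ℓ ≡ true
        bwd c with short v ℓ c
        ... | inj₁ p = ∨-introˡ (∧-intro c (⇒does (ℓ ≤? suc T) p))
        ... | inj₂ q with m≤n⇒∃ (≤-trans (m≤n+m ℓ 2) (len c))
        ... | m , e = toCyc-intro (toFam C) v ℓ m e (∧-intro (trans (sym (flip v ℓ m e)) c)
                (⇒does (m ≤? suc T) (lin 4 (λ ℓ m n T → ℓ ⊕ m ≐ n ⇒ n ≼ ℓ ⊕ (con 1 ⊕ T) ⇒ m ≼ con 1 ⊕ T) ℓ m n T e q)))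

      -- Besides fixing the number of arcs, this exhibits d as a divisor of the number of diagonals,
      -- which `order-∣6` exploits.
      count-split : d * ∑ g (λ v → ∑ (2 + T) (𝟙 ∘ toFam C v)) ≡ k
      count-split = *-cancelˡ-≡ _ _ 2 (begin
        2 * (d * ∑ g (λ v → ∑ (2 + T) (𝟙 ∘ toFam C v))) ≡⟨ count-toCyc toFam-fam ⟨
        ∑ n (λ v → ∑ n (𝟙 ∘ toCyc (toFam C) v)) ≡⟨ ∑-cong n (λ v _ → ∑-cong n λ ℓ _ → cong 𝟙 (toCyc-toFam v ℓ)) ⟩
        ∑ n (λ v → ∑ n (𝟙 ∘ C v)) ≡⟨ cnt ⟩
        2 * k ∎)

    fixedEnum : ∀ {K} k → 0 < d → (∀ C → Cyc n (d * k) C → Period g C → Short C) →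
      Enum (Fam g T k) K → Enum (λ C → Cyc n (d * k) C × Period g C) K
    fixedEnum k 0<d short e = enum-map e toCyc toFam
      (λ A f → isCyc f , toCyc-period f)
      (λ C (c , p) → subst (λ j → Fam g T j (toFam C))
          (*-cancelˡ-≡ _ _ d {{ℕ.>-nonZero 0<d}} (count-split c p (short C c p))) (toFam-fam c p (short C c p)))
      toCyc-cong
      (λ C (c , p) → toCyc-toFam c p (short C c p))
      (λ A B f f′ h → ≈-trans (≈-sym (toFam-toCyc f)) (≈-trans (toFam-cong h) (toFam-toCyc f′)))

  module _ {n k C} (cyc : Cyc n k C) where
    open Cyc cyc

    -- A chord longer than g on both of its sides would cross its own rotation by g.
    no-middle : ∀ {g} → 0 < g → Period g C → ∀ v ℓ → C v ℓ ≡ true → ℓ ≤ g ⊎ n ≤ ℓ + g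
    no-middle {g} 0<g p v ℓ c with ℓ ≤? g | n ≤? ℓ + g
    ... | yes h | _ = inj₁ h
    ... | no _ | yes h = inj₂ h
    ... | no h | no h′ = ⊥-elim (nc c (trans (p ℓ v) c) 0<g (≰⇒> h) (+-monoˡ-≤ ℓ 0<g) (subst (_< n) (+-comm ℓ g) (≰⇒> h′)))

  odd≢even : ∀ a b → suc (2 * a) ≡ 2 * b → ⊥
  odd≢even a b e with b ≤? a
  ... | yes p = lin 2 (λ a b → b ≼ a ⇒ con 1 ⊕ 2 ⊛ a ≐ 2 ⊛ b ⇒ ff) a b p e
  ... | no p = lin 2 (λ a b → a ≺ b ⇒ con 1 ⊕ 2 ⊛ a ≐ 2 ⊛ b ⇒ ff) a b (≰⇒> p) e

  -- Chords of lengths ℓ and n - ℓ pair off, so an even total forces an even number of diameters,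
  -- while two different diameters cross.
  no-diameter : ∀ {k h C} → let g = suc h in Cyc (g + g) (2 * k) C → Period g C → ∀ v → C v g ≡ true → ⊥
  no-diameter {k} {h} {C} cyc p v₁ c₁ = odd≢even X k (sym even)
    where
    open Cyc cyc
    g = suc h
    n = g + g
    c : ℕ → ℕ
    c ℓ = ∑ g (λ v → 𝟙 (C v ℓ))
    c-flip : ∀ ℓ m → ℓ + m ≡ n → c ℓ ≡ c m
    c-flip ℓ m e = trans (∑-cong g λ v _ → cong 𝟙 (trans (flip v ℓ m e) (cong (λ x → C x m) (+-comm v ℓ))))
      (∑-shift {g} {λ v → 𝟙 (C v m)} (λ v → cong 𝟙 (p m v)) ℓ)
    v : ℕ
    v = v₁ % g
    diam : C v g ≡ true
    diam = trans (sym (periodic-% {N = g} (p g) v₁)) c₁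
    c-0 : c 0 ≡ 0
    c-0 = ∑-0 g λ v _ → cong 𝟙 (¬true⇒false λ a → n≮0 (len₂ {v} a))
    no-two : ∀ u w → u < w → w < g → C u g ≡ true → C w g ≡ true → ⊥
    no-two u w u<w w<g a b with m≤n⇒∃ (<⇒≤ u<w)
    ... | i , refl = nc a b 0<i (≤-trans (s≤s (m≤n+m i u)) w<g) (+-monoˡ-≤ g 0<i) (+-monoˡ-< g (≤-trans (s≤s (m≤n+m i u)) w<g))
      where
      0<i : 0 < i
      0<i = lin 2 (λ i u → u ≺ u ⊕ i ⇒ con 0 ≺ i) i u u<w
    c-g : c g ≡ 1
    c-g = trans (∑-single g (λ v → 𝟙 (C v g)) v (m%n<n v₁ g) λ u u<g u≢v → cong 𝟙 (¬true⇒false λ a → other u u<g u≢v a)) (cong 𝟙 diam)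
      where
      other : ∀ u → u < g → u ≢ v → C u g ≡ true → ⊥
      other u u<g u≢v a with <-cmp u v
      ... | tri< lt _ _ = no-two u v lt (m%n<n v₁ g) a diam
      ... | tri≈ _ e _ = u≢v e
      ... | tri> _ _ gt = no-two v u gt u<g diam a
    X : ℕ
    X = ∑ h (c ∘ suc)
    mirrored : ∑ h (λ i → c (g + suc i)) ≡ X
    mirrored = trans (∑-cong h λ i i<h → c-flip (g + suc i) (h ∸ i)
        (trans (+-assoc g (suc i) (h ∸ i)) (cong (λ x → g + suc x) (m+[n∸m]≡n (<⇒≤ i<h))))) (rev h)
      where
      rev : ∀ h → ∑ h (λ i → c (h ∸ i)) ≡ ∑ h (c ∘ suc)
      rev zero = refl
      rev (suc h) = trans (∑-cong (suc h) λ i i≤h → cong c (+-∸-assoc 1 (≤-pred i≤h))) (∑-rev h (c ∘ suc))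
    total : ∑ n c ≡ suc (2 * X)
    total = begin
      ∑ (g + g) c ≡⟨ ∑-split g g c ⟩
      (c 0 + X) + (c (g + 0) + ∑ h (λ i → c (g + suc i))) ≡⟨ cong₂ _+_ (cong (_+ X) c-0) (cong₂ _+_ (trans (cong c (+-identityʳ g)) c-g) mirrored) ⟩
      X + suc X ≡⟨ +-suc X X ⟩
      suc (X + X) ≡⟨ cong (λ x → suc (X + x)) (+-identityʳ X) ⟨
      suc (2 * X) ∎
    even : 2 * k ≡ suc (2 * X)
    even = trans (*-cancelˡ-≡ _ _ 2 (begin
      2 * (2 * k) ≡⟨ cnt ⟨
      ∑ n (λ v → ∑ n (𝟙 ∘ C v)) ≡⟨ cong (λ m → ∑ m (λ v → ∑ n (𝟙 ∘ C v))) (cong (g +_) (+-identityʳ g)) ⟨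
      ∑ (2 * g) (λ v → ∑ n (𝟙 ∘ C v)) ≡⟨ ∑-periods {g} {λ v → ∑ n (𝟙 ∘ C v)} (λ v → ∑-cong n λ ℓ _ → cong 𝟙 (p ℓ v)) 2 ⟩
      2 * ∑ g (λ v → ∑ n (𝟙 ∘ C v)) ≡⟨ cong (2 *_) (∑-swap g n (λ v ℓ → 𝟙 (C v ℓ))) ⟩
      2 * ∑ n c ∎)) total

open ChordTables

-- Cutting the polygon at a side; pairs of endpoints versus chords.

module PairTables where
  open import Data.Nat using (_+_; _*_)
  open import Data.Nat.DivMod using (_/_)

  -- The same dissections as sets of pairs u < w < n, the encoding of Config.
  record Dis (n k : ℕ) (E : Tab) : Set where
    field
      diag : ∀ {u w} → u < n → w < n → E u w ≡ true → 2 + u ≤ w × ¬ (u ≡ 0 × suc w ≡ n)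
      nc : ∀ {p q r s} → p < q → q < r → r < s → s < n → E p r ≡ true → E q s ≡ true → ⊥
      cnt : ∑ n (λ u → ∑ n (𝟙 ∘ E u)) ≡ k

  infix 4 _≈[_]_
  _≈[_]_ : Tab → ℕ → Tab → Set
  E ≈[ n ] E′ = ∀ u w → u < n → w < n → E u w ≡ E′ u w

  ends : Tab → Tab
  ends X u w = does (u <? w) ∧ X u (w ∸ u)

  ends-elim : ∀ X u w → ends X u w ≡ true → ∃[ ℓ ] (u + ℓ ≡ w × u < w × X u ℓ ≡ true)
  ends-elim X u w h = w ∸ u , m+[n∸m]≡n (<⇒≤ u<w) , u<w , ∧-snd {does (u <? w)} h
    where u<w = does⇒ (u <? w) (∧-fst h)

  ends-intro : ∀ X u ℓ → 0 < ℓ → X u ℓ ≡ true → ends X u (u + ℓ) ≡ true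
  ends-intro X u ℓ 0<ℓ h = ∧-intro (⇒does (u <? u + ℓ) (lin 2 (λ u ℓ → con 0 ≺ ℓ ⇒ u ≺ u ⊕ ℓ) u ℓ 0<ℓ))
    (trans (cong (X u) (m+n∸m≡n u ℓ)) h)

  ends-cong : ∀ {X Y} → X ≈ Y → ends X ≈ ends Y
  ends-cong h u w = cong (does (u <? w) ∧_) (h u (w ∸ u))

  -- Identifying the ends 0 and N of the cut side turns the path of the other sides into the
  -- N-cycle. Arcs of length at most T + 1 = N - 1 leave out the cut side, and "0 uncovered" says
  -- that no arc passes over the glued vertex.
  module Linear (T : ℕ) where
    N n : ℕ
    N = 2 + T
    n = suc N

    Root : ℕ → Tab → Set
    Root k B = Fam N T k B × unc N T B 0 ≡ true

    %-+ : ∀ v i M .{{_ : ℕ.NonZero M}} → (v + i) % M ≡ (v % M + i) % M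
    %-+ v i M = begin
      (v + i) % M ≡⟨ cong (λ x → (x + i) % M) (m≡m%n+[m/n]*n v M) ⟩
      (v % M + v / M * M + i) % M ≡⟨ cong (_% M) (+-swapʳ (v % M) (v / M * M) i) ⟩
      (v % M + i + v / M * M) % M ≡⟨ [m+kn]%n≡m%n (v % M + i) (v / M) M ⟩
      (v % M + i) % M ∎

    -- The guard admits a sum equal to N, so that a diagonal ending at the last vertex survives
    -- although that vertex is glued to 0.
    toB : Tab → Tab
    toB E v ℓ = does (v % N + ℓ ≤? N) ∧ E (v % N) (v % N + ℓ)

    toB-cong : ∀ {E E′} → E ≈[ n ] E′ → toB E ≈ toB E′
    toB-cong h v ℓ = ∧-congʳ λ p →
      h (v % N) (v % N + ℓ) (≤-trans (m%n<n v N) (n≤1+n N)) (s≤s (does⇒ (v % N + ℓ ≤? N) p))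

    module _ {k B} (root : Root k B) where
      open Fam (proj₁ root)

      fits : ∀ {a ℓ} → a < N → B a ℓ ≡ true → a + ℓ ≤ N
      fits {zero} a<N b = ≤-trans (len b) (n≤1+n (suc T))
      fits {suc a} a<N b = does⇒ (uncovered? N T B 0) (proj₂ root) a<N z<s (s≤s (len b)) b

      ends-row : ∀ u → u < N → ∑ n (𝟙 ∘ ends B u) ≡ ∑ N (𝟙 ∘ B u)
      ends-row u u<N = ≤-antisym
        (count-≤ n N (ends B u) (B u) (λ w ℓ → u + ℓ ≡ w)
          (λ w w<n h → let ℓ , e , _ , b = ends-elim B u w h in ℓ , s≤s (len b) , b , e)
          (λ e e′ → trans (sym e) e′))
        (count-≤ N n (B u) (ends B u) (λ ℓ w → u + ℓ ≡ w)
          (λ ℓ _ b → u + ℓ , s≤s (fits u<N b) , ends-intro B u ℓ (≤-trans z<s (len₂ b)) b , refl)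
          (λ {ℓ} {m} e e′ → +-cancelˡ-≡ u ℓ m (trans e (sym e′))))

      ends-dis : Dis n k (ends B)
      ends-dis = record { diag = dg ; nc = cr ; cnt = ct }
        where
        dg : ∀ {u w} → u < n → w < n → ends B u w ≡ true → 2 + u ≤ w × ¬ (u ≡ 0 × suc w ≡ n)
        dg {u} {w} _ _ h with ends-elim B u w h
        ... | ℓ , refl , _ , b = subst (_≤ u + ℓ) (+-comm u 2) (+-monoʳ-≤ u (len₂ b))
            , λ (e , e′) → lin 3 (λ u ℓ T → u ≐ con 0 ⇒ con 1 ⊕ (u ⊕ ℓ) ≐ con 3 ⊕ T ⇒ ℓ ≼ con 1 ⊕ T ⇒ ff) u ℓ T e e′ (len b)
        cr : ∀ {p q r s} → p < q → q < r → r < s → s < n → ends B p r ≡ true → ends B q s ≡ true → ⊥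
        cr {p} {q} {r} {s} p<q q<r r<s _ h h′ with ends-elim B p r h | ends-elim B q s h′ | m≤n⇒∃ (<⇒≤ p<q)
        ... | ℓ , refl , _ , b | m , refl , _ , b′ | i , refl =
          lin 4 (λ p i ℓ m → i ⊕ m ≼ ℓ ⇒ p ⊕ ℓ ≺ (p ⊕ i) ⊕ m ⇒ ff) p i ℓ m
            (nc b b′ (lin 2 (λ p i → p ≺ p ⊕ i ⇒ con 0 ≺ i) p i p<q) (+-cancelˡ-< p i ℓ q<r)) r<s
        ct : ∑ n (λ u → ∑ n (𝟙 ∘ ends B u)) ≡ k
        ct = begin
          ∑ n (λ u → ∑ n (𝟙 ∘ ends B u)) ≡⟨ ∑-last N (λ u → ∑ n (𝟙 ∘ ends B u)) ⟩
          ∑ N (λ u → ∑ n (𝟙 ∘ ends B u)) + ∑ n (𝟙 ∘ ends B N)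
            ≡⟨ cong₂ _+_ (∑-cong N ends-row) (∑-0 n λ w w<n → cong 𝟙 (¬true⇒false λ h →
                 let _ , _ , N<w , _ = ends-elim B N w h in n≮n _ (≤-trans w<n N<w))) ⟩
          ∑ N (λ u → ∑ N (𝟙 ∘ B u)) + 0 ≡⟨ +-identityʳ _ ⟩
          ∑ N (λ u → ∑ N (𝟙 ∘ B u)) ≡⟨ cnt ⟩
          k ∎

      toB-ends : toB (ends B) ≈ B
      toB-ends v ℓ = trans (bool-ext fwd bwd) (sym (periodic-% {N = N} (per ℓ) v))
        where
        a = v % N
        fwd : toB (ends B) v ℓ ≡ true → B a ℓ ≡ true
        fwd h with ends-elim B a (a + ℓ) (∧-snd {does (a + ℓ ≤? N)} h)
        ... | m , e , _ , b = trans (cong (B a) (sym (+-cancelˡ-≡ a m ℓ e))) b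
        bwd : B a ℓ ≡ true → toB (ends B) v ℓ ≡ true
        bwd b = ∧-intro (⇒does (a + ℓ ≤? N) (fits (m%n<n v N) b)) (ends-intro B a ℓ (≤-trans z<s (len₂ b)) b)

    -- Endpoints are reduced modulo n, so without the bound on ℓ each chord would recur at length ℓ
    -- + n.
    toC : Tab → Tab
    toC E v ℓ = does (ℓ <? n) ∧ (E (v % n) ((v + ℓ) % n) ∨ E ((v + ℓ) % n) (v % n))

    toC-cong : ∀ {E E′} → E ≈[ n ] E′ → toC E ≈ toC E′
    toC-cong h v ℓ = cong₂ (λ x y → does (ℓ <? n) ∧ (x ∨ y))
      (h _ _ (m%n<n v n) (m%n<n (v + ℓ) n)) (h _ _ (m%n<n (v + ℓ) n) (m%n<n v n))

    data Wrap (a ℓ : ℕ) : Set where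
      direct : a + ℓ < n → (a + ℓ) % n ≡ a + ℓ → Wrap a ℓ
      around : ∀ b → n + b ≡ a + ℓ → b < a → (a + ℓ) % n ≡ b → Wrap a ℓ

    n+b%n : ∀ b → b < n → (n + b) % n ≡ b
    n+b%n b b<n = trans (cong (_% n) (+-comm n b)) (trans ([m+n]%n≡m%n b n) (m<n⇒m%n≡m b<n))

    wrap : ∀ a ℓ → a < n → ℓ < n → Wrap a ℓ
    wrap a ℓ a<n ℓ<n with a + ℓ <? n
    ... | yes p = direct p (m<n⇒m%n≡m p)
    ... | no ¬p with m≤n⇒∃ (≮⇒≥ ¬p)
    ... | b , e = around b e b<a (trans (cong (_% n) (sym e)) (n+b%n b (≤-trans b<a (<⇒≤ a<n))))
      where
      b<a : b < a
      b<a = lin 4 (λ a ℓ b n → n ⊕ b ≐ a ⊕ ℓ ⇒ ℓ ≺ n ⇒ b ≺ a) a ℓ b n e ℓ<n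

    module _ {k E} (dis : Dis n k E) where
      open Dis dis

      forward : ∀ {u w} → u < n → w < n → E u w ≡ true → u < w
      forward u<n w<n e = ≤-trans (n≤1+n _) (proj₁ (diag u<n w<n e))

      ends-toB : ends (toB E) ≈[ n ] E
      ends-toB u w u<n w<n = bool-ext fwd bwd
        where
        small : u < w → u % N ≡ u
        small u<w = m<n⇒m%n≡m (≤-trans u<w (≤-pred w<n))
        fwd : ends (toB E) u w ≡ true → E u w ≡ true
        fwd h with ends-elim (toB E) u w h
        ... | ℓ , e , u<w , b = subst₂ (λ x y → E x y ≡ true) (small u<w) (trans (cong (_+ ℓ) (small u<w)) e) (∧-snd {does (u % N + ℓ ≤? N)} b)
        bwd : E u w ≡ true → ends (toB E) u w ≡ true
        bwd h with m≤n⇒∃ (<⇒≤ (forward u<n w<n h))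
        ... | ℓ , refl = ends-intro (toB E) u ℓ (lin 2 (λ u ℓ → u ≺ u ⊕ ℓ ⇒ con 0 ≺ ℓ) u ℓ u<w)
            (∧-intro (⇒does (u % N + ℓ ≤? N) (subst (λ x → x + ℓ ≤ N) (sym (small u<w)) (≤-pred w<n)))
              (subst (λ x → E x (x + ℓ) ≡ true) (sym (small u<w)) h))
          where u<w = forward u<n w<n h

      toB-root : Root k (toB E)
      toB-root = subst (λ k → Fam N T k (toB E)) same (proj₁ root) , proj₂ root
        where
        elim : ∀ v ℓ → toB E v ℓ ≡ true → v % N + ℓ ≤ N × E (v % N) (v % N + ℓ) ≡ true
        elim v ℓ h = does⇒ (v % N + ℓ ≤? N) (∧-fst h) , ∧-snd {does (v % N + ℓ ≤? N)} h
        dg : ∀ v ℓ → toB E v ℓ ≡ true → 2 + v % N ≤ v % N + ℓ × ¬ (v % N ≡ 0 × suc (v % N + ℓ) ≡ n)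
        dg v ℓ h = let le , e = elim v ℓ h in diag (≤-trans (m%n<n v N) (n≤1+n N)) (s≤s le) e
        ln : ∀ {v ℓ} → toB E v ℓ ≡ true → ℓ ≤ suc T
        ln {v} {ℓ} h with ℓ ≤? suc T
        ... | yes p = p
        ... | no ¬p = ⊥-elim (proj₂ (dg v ℓ h)
              ( lin 3 (λ a ℓ T → a ⊕ ℓ ≼ con 2 ⊕ T ⇒ con 1 ⊕ T ≺ ℓ ⇒ a ≐ con 0) (v % N) ℓ T (proj₁ (elim v ℓ h)) (≰⇒> ¬p)
              , lin 3 (λ a ℓ T → a ⊕ ℓ ≼ con 2 ⊕ T ⇒ con 1 ⊕ T ≺ ℓ ⇒ con 1 ⊕ (a ⊕ ℓ) ≐ con 3 ⊕ T) (v % N) ℓ T (proj₁ (elim v ℓ h)) (≰⇒> ¬p)))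
        nest : ∀ {v ℓ i m} → toB E v ℓ ≡ true → toB E (v + i) m ≡ true → 0 < i → i < ℓ → i + m ≤ ℓ
        nest {v} {ℓ} {i} {m} h h′ 0<i i<ℓ with i + m ≤? ℓ
        ... | yes p = p
        ... | no ¬p = ⊥-elim (Dis.nc dis {a} {a + i} {a + ℓ} {a + i + m}
                (lin 2 (λ a i → con 0 ≺ i ⇒ a ≺ a ⊕ i) a i 0<i) (+-monoʳ-< a i<ℓ)
                (subst (a + ℓ <_) (sym (+-assoc a i m)) (+-monoʳ-< a (≰⇒> ¬p)))
                (s≤s (subst (λ x → x + m ≤ N) eq (proj₁ (elim (v + i) m h′))))
                (proj₂ (elim v ℓ h)) (subst (λ x → E x (x + m) ≡ true) eq (proj₂ (elim (v + i) m h′))))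
          where
          a = v % N
          eq : (v + i) % N ≡ a + i
          eq = trans (%-+ v i N) (m<n⇒m%n≡m (≤-trans (+-monoʳ-< a i<ℓ) (proj₁ (elim v ℓ h))))
        root : Root (∑ N (λ v → ∑ N (𝟙 ∘ toB E v))) (toB E)
        root = record
          { per = λ ℓ v → cong (λ a → does (a + ℓ ≤? N) ∧ E a (a + ℓ)) ([m+n]%n≡m%n v N)
          ; len₂ = λ {v} {ℓ} h → +-cancelˡ-≤ (v % N) 2 ℓ (subst (_≤ v % N + ℓ) (+-comm 2 (v % N)) (proj₁ (dg v ℓ h)))
          ; len = λ {v} → ln {v}
          ; nc = λ {v} {ℓ} {i} {m} → nest {v} {ℓ} {i} {m}
          ; cnt = refl
          } , ⇒does (uncovered? N T (toB E) 0) λ {i} i<N _ {ℓ} _ h →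
                subst (λ x → x + ℓ ≤ N) (m<n⇒m%n≡m i<N) (proj₁ (elim i ℓ h))
        same : ∑ N (λ v → ∑ N (𝟙 ∘ toB E v)) ≡ k
        same = trans (sym (Dis.cnt (ends-dis root)))
          (trans (∑-cong n λ u u<n → ∑-cong n λ w w<n → cong 𝟙 (ends-toB u w u<n w<n)) cnt)

      private
        S : Tab
        S u w = E u w ∨ E w u

        C : Tab
        C = toC E

      C⇒S : ∀ v ℓ → C v ℓ ≡ true → S (v % n) ((v + ℓ) % n) ≡ true
      C⇒S v ℓ h = ∧-snd {does (ℓ <? n)} h

      C<n : ∀ v ℓ → C v ℓ ≡ true → ℓ < n
      C<n v ℓ h = does⇒ (ℓ <? n) (∧-fst h)

      S⇒E : ∀ {u w} → u < n → w < n → u ≤ w → S u w ≡ true → E u w ≡ true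
      S⇒E {u} {w} u<n w<n u≤w h with ∨-elim {E u w} h
      ... | inj₁ e = e
      ... | inj₂ e = ⊥-elim (n≮n _ (≤-trans (forward w<n u<n e) u≤w))

      S-sym : ∀ {u w} → S u w ≡ true → S w u ≡ true
      S-sym {u} {w} h = trans (∨-comm (E w u) (E u w)) h

      S-nc : ∀ {p q r s} → p < q → q < r → r < s → s < n → S p r ≡ true → S q s ≡ true → ⊥
      S-nc p<q q<r r<s s<n a b = nc p<q q<r r<s s<n
        (S⇒E p<n r<n (<⇒≤ (<-trans p<q q<r)) a)
        (S⇒E q<n s<n (<⇒≤ (<-trans q<r r<s)) b)
        where
        r<n = <-trans r<s s<n
        q<n = <-trans q<r r<n
        p<n = <-trans p<q q<n

      C-% : ∀ v ℓ → C v ℓ ≡ true → S (v % n) ((v % n + ℓ) % n) ≡ true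
      C-% v ℓ h = subst (λ x → S (v % n) x ≡ true) (%-+ v ℓ n) (C⇒S v ℓ h)

      C-bounds : ∀ v ℓ → C v ℓ ≡ true → 2 ≤ ℓ × 2 + ℓ ≤ n
      C-bounds v ℓ h with wrap (v % n) ℓ (m%n<n v n) (C<n v ℓ h) | C-% v ℓ h
      ... | direct lt e | s = +-cancelˡ-≤ a 2 ℓ (subst (_≤ a + ℓ) (+-comm 2 a) (proj₁ d)) , bound a lt (proj₂ d)
        where
        a = v % n
        d = diag (m%n<n v n) lt (S⇒E (m%n<n v n) lt (m≤m+n a ℓ) (subst (λ x → S a x ≡ true) e s))
        bound : ∀ a → a + ℓ < n → ¬ (a ≡ 0 × suc (a + ℓ) ≡ n) → 2 + ℓ ≤ n
        bound zero lt ¬d = ≤∧≢⇒< lt λ e → ¬d (refl , e)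
        bound (suc a) lt _ = ≤-trans (s≤s (s≤s (m≤n+m ℓ a))) lt
      ... | around b e b<a e′ | s = bound₂ b e (proj₂ d)
          , lin 4 (λ a ℓ b n → n ⊕ b ≐ a ⊕ ℓ ⇒ con 2 ⊕ b ≼ a ⇒ con 2 ⊕ ℓ ≼ n) a ℓ b n e (proj₁ d)
        where
        a = v % n
        b<n : b < n
        b<n = <-trans b<a (m%n<n v n)
        d = diag b<n (m%n<n v n) (S⇒E b<n (m%n<n v n) (<⇒≤ b<a) (S-sym {a} {b} (subst (λ x → S a x ≡ true) e′ s)))
        bound₂ : ∀ b → n + b ≡ a + ℓ → ¬ (b ≡ 0 × suc a ≡ n) → 2 ≤ ℓ
        bound₂ zero e ¬d = lin 3 (λ a ℓ n → n ⊕ con 0 ≐ a ⊕ ℓ ⇒ con 2 ⊕ a ≼ n ⇒ con 2 ≼ ℓ) a ℓ n e (≤∧≢⇒< (m%n<n v n) λ e → ¬d (refl , e))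
        bound₂ (suc b) e _ = lin 4 (λ a ℓ b n → n ⊕ (con 1 ⊕ b) ≐ a ⊕ ℓ ⇒ a ≺ n ⇒ con 2 ≼ ℓ) a ℓ b n e (m%n<n v n)

      C-per : Period n C
      C-per ℓ v = cong₂ (λ x y → does (ℓ <? n) ∧ S x y) ([m+n]%n≡m%n v n)
        (trans (cong (_% n) (+-swapʳ v n ℓ)) ([m+n]%n≡m%n (v + ℓ) n))

      C-flip : ∀ v ℓ m → ℓ + m ≡ n → C v ℓ ≡ true → C (v + ℓ) m ≡ true
      C-flip v ℓ m e h = ∧-intro
        (⇒does (m <? n) (lin 3 (λ ℓ m n → ℓ ⊕ m ≐ n ⇒ con 2 ≼ ℓ ⇒ m ≺ n) ℓ m n e (proj₁ (C-bounds v ℓ h))))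
        (subst (λ x → S ((v + ℓ) % n) x ≡ true)
          (sym (trans (cong (_% n) (trans (+-assoc v ℓ m) (cong (v +_) e))) ([m+n]%n≡m%n v n)))
          (S-sym {v % n} (C⇒S v ℓ h)))

      -- The points v, v + i, v + ℓ, v + i + m are in cyclic order. Once one of them wraps past n
      -- the later ones do as well, which leaves four linear orders; each is a crossing of pairs.
      C-nc : ∀ {v ℓ i m} → C v ℓ ≡ true → C (v + i) m ≡ true → 0 < i → i < ℓ → ℓ < i + m → i + m < n → ⊥
      C-nc {v} {ℓ} {i} {m} h h′ 0<i i<ℓ ℓ<j j<n = go (wrap a i a<n i<n) (wrap a ℓ a<n ℓ<n) (wrap a j a<n j<n)
        where
        a = v % n
        j = i + m
        a<n = m%n<n v n
        ℓ<n : ℓ < n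
        ℓ<n = <-trans ℓ<j j<n
        i<n : i < n
        i<n = <-trans i<ℓ ℓ<n
        s₁ : S a ((a + ℓ) % n) ≡ true
        s₁ = C-% v ℓ h
        s₂ : S ((a + i) % n) ((a + j) % n) ≡ true
        s₂ = subst₂ (λ x y → S x y ≡ true) (%-+ v i n)
          (trans (cong (_% n) (+-assoc v i m)) (%-+ v j n)) (C⇒S (v + i) m h′)
        use : ∀ {x y z} → (a + i) % n ≡ x → (a + ℓ) % n ≡ y → (a + j) % n ≡ z → S a y ≡ true × S x z ≡ true
        use refl refl refl = s₁ , s₂
        step : ∀ {b c x y} → n + b ≡ a + x → n + c ≡ a + y → x < y → b < c
        step {b} {c} {x} {y} e e′ lt = lin 6 (λ n a b c x y → n ⊕ b ≐ a ⊕ x ⇒ n ⊕ c ≐ a ⊕ y ⇒ x ≺ y ⇒ b ≺ c) n a b c x y e e′ lt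
        late : ∀ {b x y} {Z : Set} → n + b ≡ a + x → a + y < n → x < y → Z
        late {b} {x} {y} e lt x<y = ⊥-elim (lin 5 (λ n a b x y → n ⊕ b ≐ a ⊕ x ⇒ a ⊕ y ≺ n ⇒ x ≺ y ⇒ ff) n a b x y e lt x<y)
        a<a+i : a < a + i
        a<a+i = lin 2 (λ a i → con 0 ≺ i ⇒ a ≺ a ⊕ i) a i 0<i
        go : Wrap a i → Wrap a ℓ → Wrap a j → ⊥
        go (direct p e) (direct q e₁) (direct r e₂) =
          let x , y = use e e₁ e₂ in S-nc a<a+i (+-monoʳ-< a i<ℓ) (+-monoʳ-< a ℓ<j) r x y
        go (direct p e) (direct q e₁) (around b r b<a e₂) =
          let x , y = use e e₁ e₂ in S-nc b<a a<a+i (+-monoʳ-< a i<ℓ) q (S-sym {a + i} y) x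
        go (direct p e) (around b q b<a e₁) (around c r c<a e₂) =
          let x , y = use e e₁ e₂ in S-nc (step q r ℓ<j) c<a a<a+i p (S-sym {a} x) (S-sym {a + i} y)
        go (around b p b<a e) (around c q c<a e₁) (around d r d<a e₂) =
          let x , y = use e e₁ e₂ in S-nc (step p q i<ℓ) (step q r ℓ<j) d<a a<n y (S-sym {a} x)
        go (around b p _ _) (direct q _) _ = late p q i<ℓ
        go _ (around b q _ _) (direct r _) = late q r ℓ<j

      C-cnt : ∑ n (λ v → ∑ n (𝟙 ∘ C v)) ≡ 2 * k
      C-cnt = begin
        ∑ n (λ v → ∑ n (𝟙 ∘ C v)) ≡⟨ ∑-cong n (λ v v<n → chords v v<n) ⟩
        ∑ n (λ v → ∑ n (λ w → 𝟙 (E v w) + 𝟙 (E w v))) ≡⟨ ∑-cong n (λ v _ → ∑-+ n (𝟙 ∘ E v) (λ w → 𝟙 (E w v))) ⟩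
        ∑ n (λ v → ∑ n (𝟙 ∘ E v) + ∑ n (λ w → 𝟙 (E w v))) ≡⟨ ∑-+ n (λ v → ∑ n (𝟙 ∘ E v)) (λ v → ∑ n (λ w → 𝟙 (E w v))) ⟩
        ∑ n (λ v → ∑ n (𝟙 ∘ E v)) + ∑ n (λ v → ∑ n (λ w → 𝟙 (E w v))) ≡⟨ cong₂ _+_ cnt (trans (∑-swap n n (λ v w → 𝟙 (E w v))) cnt) ⟩
        k + k ≡⟨ cong (k +_) (+-identityʳ k) ⟨
        2 * k ∎
        where
        chords : ∀ v → v < n → ∑ n (𝟙 ∘ C v) ≡ ∑ n (λ w → 𝟙 (E v w) + 𝟙 (E w v))
        chords v v<n = begin
          ∑ n (𝟙 ∘ C v) ≡⟨ ∑-cong n (λ ℓ ℓ<n → cong (λ b → 𝟙 (b ∧ S (v % n) ((v + ℓ) % n))) (⇒does (ℓ <? n) ℓ<n)) ⟩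
          ∑ n (λ ℓ → 𝟙 (S (v % n) ((v + ℓ) % n)))
            ≡⟨ ∑-shift {n} {λ w → 𝟙 (S (v % n) (w % n))} (λ w → cong (λ x → 𝟙 (S (v % n) x)) ([m+n]%n≡m%n w n)) v ⟩
          ∑ n (λ w → 𝟙 (S (v % n) (w % n)))
            ≡⟨ ∑-cong n (λ w w<n → trans (cong₂ (λ x y → 𝟙 (S x y)) (m<n⇒m%n≡m v<n) (m<n⇒m%n≡m w<n))
                 (𝟙-∨ (E v w) (E w v) λ e e′ → n≮n _ (<-trans (forward v<n w<n e) (forward w<n v<n e′)))) ⟩
          ∑ n (λ w → 𝟙 (E v w) + 𝟙 (E w v)) ∎

      toC-cyc : Cyc n k C
      toC-cyc = record
        { per = C-per
        ; len₂ = λ {v} {ℓ} h → proj₁ (C-bounds v ℓ h)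
        ; len = λ {v} {ℓ} h → proj₂ (C-bounds v ℓ h)
        ; flip = λ v ℓ m e → bool-ext (C-flip v ℓ m e) (λ h → trans (sym (C-per ℓ v))
            (subst (λ x → C x ℓ ≡ true) (trans (+-assoc v ℓ m) (cong (v +_) e)) (C-flip (v + ℓ) m ℓ (trans (+-comm m ℓ) e) h)))
        ; nc = λ {v} {ℓ} {i} {m} → C-nc {v} {ℓ} {i} {m}
        ; cnt = C-cnt
        }

      ends-toC : ends C ≈[ n ] E
      ends-toC u w u<n w<n = bool-ext fwd bwd
        where
        fwd : ends C u w ≡ true → E u w ≡ true
        fwd h with ends-elim C u w h
        ... | ℓ , refl , u<w , c = S⇒E u<n w<n (<⇒≤ u<w)
                (subst₂ (λ x y → S x y ≡ true) (m<n⇒m%n≡m u<n) (m<n⇒m%n≡m w<n) (C⇒S u ℓ c))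
        bwd : E u w ≡ true → ends C u w ≡ true
        bwd e with m≤n⇒∃ (<⇒≤ (forward u<n w<n e))
        ... | ℓ , refl = ends-intro C u ℓ (lin 2 (λ u ℓ → u ≺ u ⊕ ℓ ⇒ con 0 ≺ ℓ) u ℓ (forward u<n w<n e))
                (∧-intro (⇒does (ℓ <? n) (≤-trans (s≤s (m≤n+m ℓ u)) w<n))
                  (subst₂ (λ x y → S x y ≡ true) (sym (m<n⇒m%n≡m u<n)) (sym (m<n⇒m%n≡m w<n)) (∨-introˡ e)))

    module _ {k C} (cyc : Cyc n k C) where
      open Cyc cyc

      toC-ends : toC (ends C) ≈ C
      toC-ends v ℓ = trans (bool-ext fwd bwd) (sym (periodic-% {N = n} (per ℓ) v))
        where
        a = v % n
        a<n = m%n<n v n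
        complement : ∀ {b} → n + b ≡ a + ℓ → b < a → ∃[ m ] (b + m ≡ a × m + ℓ ≡ n)
        complement {b} e b<a = let m , e′ = m≤n⇒∃ (<⇒≤ b<a) in
          m , e′ , lin 5 (λ a b m ℓ n → n ⊕ b ≐ a ⊕ ℓ ⇒ b ⊕ m ≐ a ⇒ m ⊕ ℓ ≐ n) a b m ℓ n e e′
        fwd : toC (ends C) v ℓ ≡ true → C a ℓ ≡ true
        fwd h with wrap a ℓ a<n (does⇒ (ℓ <? n) (∧-fst h)) | subst (λ x → ends C a x ∨ ends C x a ≡ true) (%-+ v ℓ n) (∧-snd {does (ℓ <? n)} h)
        ... | direct lt e | s with ∨-elim {ends C a (a + ℓ)} (subst (λ x → ends C a x ∨ ends C x a ≡ true) e s)
        ... | inj₁ x = let m , e′ , _ , c = ends-elim C a (a + ℓ) x in trans (cong (C a) (sym (+-cancelˡ-≡ a m ℓ e′))) c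
        ... | inj₂ x = let _ , _ , lt′ , _ = ends-elim C (a + ℓ) a x in ⊥-elim (n≮n _ (≤-trans lt′ (m≤m+n a ℓ)))
        fwd h | around b e b<a e″ | s with ∨-elim {ends C a b} (subst (λ x → ends C a x ∨ ends C x a ≡ true) e″ s)
        ... | inj₁ x = let _ , _ , lt′ , _ = ends-elim C a b x in ⊥-elim (n≮n _ (<-trans lt′ b<a))
        ... | inj₂ x = let m , e₁ , _ , c = ends-elim C b a x
                           m′ , e₂ , e₃ = complement e b<a
                           m≡ = +-cancelˡ-≡ b m m′ (trans e₁ (sym e₂))
                       in trans (cong (λ x → C x ℓ) (sym e₁)) (trans (sym (flip b m ℓ (trans (cong (_+ ℓ) m≡) e₃))) c)
        bwd : C a ℓ ≡ true → toC (ends C) v ℓ ≡ true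
        bwd c = ∧-intro (⇒does (ℓ <? n) ℓ<n) (subst (λ x → ends C a x ∨ ends C x a ≡ true) (sym (%-+ v ℓ n)) (go (wrap a ℓ a<n ℓ<n)))
          where
          ℓ<n : ℓ < n
          ℓ<n = ≤-trans (n≤1+n (suc ℓ)) (len c)
          go : Wrap a ℓ → ends C a ((a + ℓ) % n) ∨ ends C ((a + ℓ) % n) a ≡ true
          go (direct lt e) rewrite e = ∨-introˡ (ends-intro C a ℓ (≤-trans z<s (len₂ c)) c)
          go (around b e b<a e′) rewrite e′ = ∨-introʳ {ends C a b} (let m , e₁ , e₂ = complement e b<a in
            subst (λ x → ends C b x ≡ true) e₁ (ends-intro C b m (lin 3 (λ a b m → b ⊕ m ≐ a ⇒ b ≺ a ⇒ con 0 ≺ m) a b m e₁ b<a)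
              (trans (flip b m ℓ e₂) (trans (cong (λ x → C x ℓ) e₁) c))))

      -- The pairs are counted indirectly: the chord table built from them has two entries per pair
      -- and is C again by `toC-ends`.
      cyc-dis : Dis n k (ends C)
      cyc-dis = subst (λ k → Dis n k (ends C)) (*-cancelˡ-≡ _ _ 2 (trans (sym (C-cnt dis))
          (trans (∑-cong n λ v _ → ∑-cong n λ ℓ _ → cong 𝟙 (toC-ends v ℓ)) cnt))) dis
        where
        dis : Dis n (∑ n (λ u → ∑ n (𝟙 ∘ ends C u))) (ends C)
        dis = record { diag = dg ; nc = cr ; cnt = refl }
          where
          dg : ∀ {u w} → u < n → w < n → ends C u w ≡ true → 2 + u ≤ w × ¬ (u ≡ 0 × suc w ≡ n)
          dg {u} {w} _ _ h with ends-elim C u w h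
          ... | ℓ , refl , _ , b = subst (_≤ u + ℓ) (+-comm u 2) (+-monoʳ-≤ u (len₂ b))
              , λ (e , e′) → lin 3 (λ u ℓ n → u ≐ con 0 ⇒ con 1 ⊕ (u ⊕ ℓ) ≐ n ⇒ con 2 ⊕ ℓ ≼ n ⇒ ff) u ℓ n e e′ (len b)
          cr : ∀ {p q r s} → p < q → q < r → r < s → s < n → ends C p r ≡ true → ends C q s ≡ true → ⊥
          cr {p} {q} {r} {s} p<q q<r r<s s<n h h′ with ends-elim C p r h | ends-elim C q s h′ | m≤n⇒∃ (<⇒≤ p<q)
          ... | ℓ , refl , _ , b | m , refl , _ , b′ | i , refl =
            nc b b′ (lin 2 (λ p i → p ≺ p ⊕ i ⇒ con 0 ≺ i) p i p<q) (+-cancelˡ-< p i ℓ q<r)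
              (+-cancelˡ-< p ℓ (i + m) (subst (p + ℓ <_) (+-assoc p i m) r<s))
              (≤-trans (s≤s (m≤n+m (i + m) p)) (subst (_< n) (+-assoc p i m) s<n))

    cycEnum : ∀ k → Enum (Cyc n k) (RootedCount.rooted T k 0)
    cycEnum k = enum-map (RootedCount.uncEnum T k 0) (toC ∘ ends) (toB ∘ ends)
      (λ B r → toC-cyc (ends-dis r))
      (λ C c → toB-root (cyc-dis c))
      (λ h → toC-cong λ u w _ _ → ends-cong h u w)
      (λ C c → ≈-trans (toC-cong (ends-toB (cyc-dis c))) (toC-ends c))
      (λ B B′ r r′ h → ≈-trans (≈-sym (toB-ends r)) (≈-trans
        (toB-cong λ u w u<n w<n → trans (sym (ends-toC (ends-dis r) u w u<n w<n))
           (trans (ends-cong h u w) (ends-toC (ends-dis r′) u w u<n w<n)))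
        (toB-ends r′)))

open PairTables

-- Burnside's lemma for a cyclic action on a finite set.

module OrbitCounting where
  open import Data.Nat using (_+_; _*_)
  open import Data.Fin using (_≟_)

  sum-indicator : ∀ {m} (y : Fin m) → sum (λ x → 𝟙 (does (y ≟ x))) ≡ 1
  sum-indicator {suc m} zero = cong suc (sum-replicate-zero m)
  sum-indicator {suc m} (suc y) = sum-indicator y

  module Burnside {m n′ : ℕ} (act : ℕ → Fin m → Fin m) (act-0 : ∀ x → act 0 x ≡ x)
    (act-+ : ∀ r s x → act (r + s) x ≡ act r (act s x)) (act-n : ∀ x → act (suc n′) x ≡ x) where

    private n = suc n′

    act-per : ∀ x → Periodic n (λ r → act r x)
    act-per x r = trans (act-+ r n x) (cong (act r) (act-n x))

    infix 4 _~_
    _~_ : Fin m → Fin m → Set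
    x ~ y = ∃[ r ] x ≡ act r y

    ~-refl : ∀ {x} → x ~ x
    ~-refl {x} = 0 , sym (act-0 x)

    ~-trans : ∀ {x y z} → x ~ y → y ~ z → x ~ z
    ~-trans {z = z} (r , refl) (s , refl) = r + s , sym (act-+ r s z)

    ~-sym : ∀ {x y} → x ~ y → y ~ x
    -- (n - 1) r is an inverse of r modulo n.
    ~-sym {y = y} (r , refl) = n′ * r , sym (begin
      act (n′ * r) (act r y) ≡⟨ act-+ (n′ * r) r y ⟨
      act (n′ * r + r) y ≡⟨ cong (λ s → act s y) (trans (+-comm (n′ * r) r) (*-comm n r)) ⟩
      act (r * n) y ≡⟨ periodic-* {f = λ r → act r y} (act-per y) r 0 ⟩
      act 0 y ≡⟨ act-0 y ⟩
      y ∎)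

    _~?_ : ∀ x y → Dec (x ~ y)
    x ~? y = map′ (λ (r , _ , e) → r , e)
      (λ (r , e) → r % n , m%n<n r n , trans e (periodic-% {N = n} (act-per y) r))
      (anyUpTo? (λ r → x ≟ act r y) n)

    reps : List (Fin m) → List (Fin m)
    reps [] = []
    reps (x ∷ xs) with Any.any? (x ~?_) (reps xs)
    ... | yes _ = reps xs
    ... | no _ = x ∷ reps xs

    reps-distinct : ∀ xs → AllPairs (λ x y → ¬ x ~ y) (reps xs)
    reps-distinct [] = []
    reps-distinct (x ∷ xs) with Any.any? (x ~?_) (reps xs)
    ... | yes _ = reps-distinct xs
    ... | no ¬p = Allₚ.¬Any⇒All¬ _ ¬p ∷ reps-distinct xs

    reps-complete : ∀ xs {x} → x ∈ xs → Any (x ~_) (reps xs)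
    reps-complete (x ∷ xs) x∈ with Any.any? (x ~?_) (reps xs) | x∈
    ... | yes p | here refl = p
    ... | yes p | there h = reps-complete xs h
    ... | no ¬p | here refl = here ~-refl
    ... | no ¬p | there h = there (reps-complete xs h)

    orbits : List (Fin m)
    orbits = reps (allFin m)

    fixed : ℕ → ℕ
    fixed r = sum (λ x → 𝟙 (does (act r x ≟ x)))

    hits : Fin m → Fin m → ℕ
    hits x y = ∑ n (λ r → 𝟙 (does (act r y ≟ x)))

    -- The elements carrying y to x form a coset of the stabiliser of x.
    hits-~ : ∀ {x y} → x ~ y → hits x y ≡ hits x x
    hits-~ {x} {y} (s , e) = begin
      ∑ n f ≡⟨ ∑-shift {n} {f} (λ r → cong (λ z → 𝟙 (does (z ≟ x))) (act-per y r)) s ⟨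
      ∑ n (λ r → f (s + r)) ≡⟨ ∑-cong n (λ r _ → cong (λ z → 𝟙 (does (z ≟ x)))
          (trans (cong (λ t → act t y) (+-comm s r)) (trans (act-+ r s y) (cong (act r) (sym e))))) ⟩
      hits x x ∎
      where
      f : ℕ → ℕ
      f r = 𝟙 (does (act r y ≟ x))

    hits-≁ : ∀ {x y} → ¬ x ~ y → hits x y ≡ 0
    hits-≁ {x} {y} h = ∑-0 n λ r _ → cong 𝟙 (¬true⇒false λ e → h (r , sym (does⇒ (act r y ≟ x) e)))

    total : ∀ y → sum (λ x → hits x y) ≡ n
    total y = begin
      sum (λ x → hits x y) ≡⟨ sum-∑-swap n (λ x r → 𝟙 (does (act r y ≟ x))) ⟩
      ∑ n (λ r → sum (λ x → 𝟙 (does (act r y ≟ x)))) ≡⟨ ∑-cong n (λ r _ → sum-indicator (act r y)) ⟩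
      ∑ n (λ _ → 1) ≡⟨ ∑-const n 1 ⟩
      n * 1 ≡⟨ *-identityʳ n ⟩
      n ∎

    hitsᴸ : Fin m → List (Fin m) → ℕ
    hitsᴸ x [] = 0
    hitsᴸ x (y ∷ ys) = hits x y + hitsᴸ x ys

    hitsᴸ-none : ∀ {x} ys → All (λ y → ¬ x ~ y) ys → hitsᴸ x ys ≡ 0
    hitsᴸ-none [] [] = refl
    hitsᴸ-none (y ∷ ys) (p ∷ ps) = cong₂ _+_ (hits-≁ p) (hitsᴸ-none ys ps)

    hitsᴸ-one : ∀ {x} ys → AllPairs (λ x y → ¬ x ~ y) ys → Any (x ~_) ys → hitsᴸ x ys ≡ hits x x
    hitsᴸ-one (y ∷ ys) (p ∷ ps) (here h) =
      trans (cong₂ _+_ (hits-~ h) (hitsᴸ-none ys (All.map (λ q k → q (~-trans (~-sym h) k)) p))) (+-identityʳ _)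
    hitsᴸ-one {x} (y ∷ ys) (p ∷ ps) (there h) =
      cong₂ _+_ (hits-≁ (λ k → clash p h (~-sym k))) (hitsᴸ-one ys ps h)
      where
      clash : ∀ {ys} → All (λ z → ¬ y ~ z) ys → Any (x ~_) ys → y ~ x → ⊥
      clash (p ∷ _) (here h) k = p (~-trans k h)
      clash (_ ∷ ps) (there h) k = clash ps h k

    sum-hitsᴸ : ∀ ys → sum (λ x → hitsᴸ x ys) ≡ length ys * n
    sum-hitsᴸ [] = sum-replicate-zero m
    sum-hitsᴸ (y ∷ ys) = trans (∑-distrib-+ (λ x → hits x y) (λ x → hitsᴸ x ys)) (cong₂ _+_ (total y) (sum-hitsᴸ ys))

    -- Triples of x, a representative y and a rotation from y to x: each y accounts for n of them,
    -- while each x meets only its own representative, in as many ways as x has stabilising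
    -- rotations.
    burnside : length orbits * n ≡ ∑ n fixed
    burnside = begin
      length orbits * n ≡⟨ sum-hitsᴸ orbits ⟨
      sum (λ x → hitsᴸ x orbits) ≡⟨ sum-cong-≗ (λ x → hitsᴸ-one orbits (reps-distinct (allFin m)) (reps-complete (allFin m) (∈-allFin x))) ⟩
      sum (λ x → hits x x) ≡⟨ sum-∑-swap n (λ x r → 𝟙 (does (act r x ≟ x))) ⟩
      ∑ n fixed ∎

open OrbitCounting

-- Rotation orbits of dissections in the encoding of the statement.

module Rotations where
  open import Data.Nat using (_+_; _*_)
  open import Data.Fin using (_≟_)

  sumᴸ-allFin : ∀ n (f : Fin n → ℕ) (F : ℕ → ℕ) → (∀ i → f i ≡ F (toℕ i)) → sumᴸ (map f (allFin n)) ≡ ∑ n F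
  sumᴸ-allFin n f F h = trans (cong sumᴸ (map-tabulate id f)) (go n f F h)
    where
    go : ∀ n (f : Fin n → ℕ) (F : ℕ → ℕ) → (∀ i → f i ≡ F (toℕ i)) → sumᴸ (tabulate f) ≡ ∑ n F
    go zero f F h = refl
    go (suc n) f F h = cong₂ _+_ (h zero) (go n (f ∘ suc) (F ∘ suc) (h ∘ suc))

  shift-cyc : ∀ {n k C} r → Cyc n k C → Cyc n k (shift r C)
  shift-cyc {n} {k} {C} r c = record
    { per = λ ℓ v → trans (cong (λ x → C x ℓ) (+-swapʳ v n r)) (per ℓ (v + r))
    ; len₂ = len₂
    ; len = len
    ; flip = λ v ℓ m e → trans (flip (v + r) ℓ m e) (cong (λ x → C x m) (+-swapʳ v r ℓ))
    ; nc = λ {v} {ℓ} {i} {m} a b → nc a (subst (λ x → C x m ≡ true) (+-swapʳ v i r) b)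
    ; cnt = trans (trans (∑-cong n λ v _ → cong (λ x → ∑ n (𝟙 ∘ C x)) (+-comm v r))
        (∑-shift {n} {λ v → ∑ n (𝟙 ∘ C v)} (λ v → ∑-cong n λ ℓ _ → cong 𝟙 (per ℓ v)) r)) cnt
    }
    where open Cyc c

  module Orbits (T k : ℕ) {m : ℕ} (cycs : Enum (Cyc (3 + T) k) m) where
    open Linear T
    open Enum cycs

    act : ℕ → Fin m → Fin m
    act r x = idx (shift r (at x)) (shift-cyc r (at-P x))

    at-act : ∀ r x → at (act r x) ≈ shift r (at x)
    at-act r x = at-idx (shift r (at x)) (shift-cyc r (at-P x))

    act-0 : ∀ x → act 0 x ≡ x
    act-0 x = at-inj (≈-trans (at-act 0 x) λ v ℓ → cong (λ u → at x u ℓ) (+-identityʳ v))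

    act-+ : ∀ r s x → act (r + s) x ≡ act r (act s x)
    act-+ r s x = at-inj (≈-trans (at-act (r + s) x) (≈-sym (≈-trans (at-act r (act s x))
      λ v ℓ → trans (at-act s x (v + r) ℓ) (cong (λ u → at x u ℓ) (+-assoc v r s)))))

    act-n : ∀ x → act n x ≡ x
    act-n x = at-inj (≈-trans (at-act n x) λ v ℓ → Cyc.per (at-P x) ℓ v)

    open Burnside act act-0 act-+ act-n public

    -- Being fixed by the rotation by r means having period r, so any other enumeration of the
    -- tables with that period computes `fixed r`.
    periodicEnum : ∀ r → Enum (λ C → Cyc n k C × Period r C) (fixed r)
    periodicEnum r = enum-sub cycs (λ x → does (act r x ≟ x)) (Period r)
      (λ x h ℓ v → trans (sym (at-act r x v ℓ)) (cong (λ y → at y v ℓ) (does⇒ (act r x ≟ x) h)))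
      (λ t p h → ⇒does (act r (idx t p) ≟ idx t p) (at-inj (≈-trans (at-act r (idx t p))
        (λ v ℓ → trans (at-idx t p (v + r) ℓ) (trans (h ℓ v) (sym (at-idx t p v ℓ)))))))

    fixed-0 : fixed 0 ≡ m
    fixed-0 = enum-unique (periodicEnum 0) (enum-map cycs id id
      (λ C c → c , λ ℓ v → cong (λ u → C u ℓ) (+-identityʳ v)) (λ C → proj₁) id (λ _ _ _ _ → refl) (λ _ _ _ _ h → h))

    cell : Config n → Tab
    cell D u w = D (u mod n) (w mod n)

    toℕ-mod : ∀ v → toℕ (v mod n) ≡ v % n
    toℕ-mod v = toℕ-fromℕ< (m%n<n v n)

    mod-≡ : ∀ u w → u % n ≡ w % n → u mod n ≡ w mod n
    mod-≡ u w e = toℕ-injective (trans (toℕ-mod u) (trans e (sym (toℕ-mod w))))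

    mod-toℕ : ∀ (i : Fin n) → toℕ i mod n ≡ i
    mod-toℕ i = toℕ-injective (trans (toℕ-mod (toℕ i)) (m<n⇒m%n≡m (toℕ<n i)))

    cell-toℕ : ∀ D i j → cell D (toℕ i) (toℕ j) ≡ D i j
    cell-toℕ D i j = cong₂ D (mod-toℕ i) (mod-toℕ j)

    count-cell : ∀ D → count D ≡ ∑ n (λ u → ∑ n (𝟙 ∘ cell D u))
    count-cell D = sumᴸ-allFin n _ (λ u → ∑ n (𝟙 ∘ cell D u)) λ i →
      sumᴸ-allFin n _ (𝟙 ∘ cell D (toℕ i)) λ j → cong 𝟙 (sym (cell-toℕ D i j))

    dis-cell : ∀ D → IsDissection n k D → Dis n k (cell D)
    dis-cell D (dg , cr , ct) = record
      { diag = λ {u} {w} u<n w<n h → subst₂ (λ x y → 2 + x ≤ y × ¬ (x ≡ 0 × suc y ≡ n)) (val u<n) (val w<n) (dg (u mod n) (w mod n) h)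
      ; nc = λ {p} {q} {r} {s} p<q q<r r<s s<n h h′ →
          let r<n = <-trans r<s s<n
              q<n = <-trans q<r r<n
              p<n = <-trans p<q q<n
          in cr (p mod n) (r mod n) (q mod n) (s mod n) h h′
               ( subst₂ _<_ (sym (val p<n)) (sym (val q<n)) p<q
               , subst₂ _<_ (sym (val q<n)) (sym (val r<n)) q<r
               , subst₂ _<_ (sym (val r<n)) (sym (val s<n)) r<s)
      ; cnt = trans (sym (count-cell D)) ct
      }
      where
      val : ∀ {u} → u < n → toℕ (u mod n) ≡ u
      val {u} u<n = trans (toℕ-mod u) (m<n⇒m%n≡m u<n)

    config : Tab → Config n
    config E i j = E (toℕ i) (toℕ j)

    cell-config : ∀ E → cell (config E) ≈[ n ] E
    cell-config E u w u<n w<n = cong₂ E (trans (toℕ-mod u) (m<n⇒m%n≡m u<n)) (trans (toℕ-mod w) (m<n⇒m%n≡m w<n))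

    config-dissection : ∀ {E} → Dis n k E → IsDissection n k (config E)
    config-dissection {E} d =
        (λ i j h → Dis.diag d (toℕ<n i) (toℕ<n j) h)
      , (λ i j i′ j′ h h′ (p , q , r) → Dis.nc d p q r (toℕ<n j′) h h′)
      , trans (count-cell (config E)) (trans (∑-cong n λ u u<n → ∑-cong n λ w w<n → cong 𝟙 (cell-config E u w u<n w<n)) (Dis.cnt d))

    -- In this form a rotation merely translates the first argument, whereas on ordered pairs it may
    -- swap the endpoints.
    chords : Config n → Tab
    chords D = toC (cell D)

    chords-Mem : ∀ D v ℓ → chords D v ℓ ≡ does (ℓ <? n) ∧ Mem D (v mod n) ((v + ℓ) mod n)
    chords-Mem D v ℓ = cong₂ (λ x y → does (ℓ <? n) ∧ (D x y ∨ D y x)) (mod-≡ (v % n) v (m%n%n≡m%n v n)) (mod-≡ ((v + ℓ) % n) (v + ℓ) (m%n%n≡m%n (v + ℓ) n))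

    rot-mod : ∀ r v → rot n r (v mod n) ≡ (v + toℕ r) mod n
    rot-mod r v = mod-≡ (toℕ (v mod n) + toℕ r) (v + toℕ r) (trans (cong (λ x → (x + toℕ r) % n) (toℕ-mod v)) (sym (%-+ v (toℕ r) n)))

    rotated⇒ : ∀ {D D′} → Rotated n D D′ → ∃[ r ] chords D ≈ shift r (chords D′)
    rotated⇒ {D} {D′} (r , h) = toℕ r , λ v ℓ → begin
      chords D v ℓ ≡⟨ chords-Mem D v ℓ ⟩
      does (ℓ <? n) ∧ Mem D (v mod n) ((v + ℓ) mod n) ≡⟨ cong (does (ℓ <? n) ∧_) (h (v mod n) ((v + ℓ) mod n)) ⟩
      does (ℓ <? n) ∧ Mem D′ (rot n r (v mod n)) (rot n r ((v + ℓ) mod n))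
        ≡⟨ cong₂ (λ x y → does (ℓ <? n) ∧ Mem D′ x y) (rot-mod r v)
             (trans (rot-mod r (v + ℓ)) (cong (_mod n) (+-swapʳ v ℓ (toℕ r)))) ⟩
      does (ℓ <? n) ∧ Mem D′ ((v + toℕ r) mod n) ((v + toℕ r + ℓ) mod n) ≡⟨ chords-Mem D′ (v + toℕ r) ℓ ⟨
      chords D′ (v + toℕ r) ℓ ∎

    rot-≡ : ∀ r i → rot n (r mod n) i ≡ (toℕ i + r) mod n
    rot-≡ r i = mod-≡ (toℕ i + toℕ (r mod n)) (toℕ i + r) (begin
      (toℕ i + toℕ (r mod n)) % n ≡⟨ cong (λ x → (toℕ i + x) % n) (toℕ-mod r) ⟩
      (toℕ i + r % n) % n ≡⟨ cong (_% n) (+-comm (toℕ i) (r % n)) ⟩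
      (r % n + toℕ i) % n ≡⟨ %-+ r (toℕ i) n ⟨
      (r + toℕ i) % n ≡⟨ cong (_% n) (+-comm r (toℕ i)) ⟩
      (toℕ i + r) % n ∎)

    chords-strip : ∀ D u ℓ → ℓ < n → chords D u ℓ ≡ Mem D (u mod n) ((u + ℓ) mod n)
    chords-strip D u ℓ ℓ<n = trans (chords-Mem D u ℓ) (cong (_∧ Mem D (u mod n) ((u + ℓ) mod n)) (⇒does (ℓ <? n) ℓ<n))

    -- Every ordered pair of vertices is reached as v and v + ℓ with ℓ < n, so agreement of chord
    -- tables covers all of `Mem`.
    gap : ∀ (i j : Fin n) → ∃[ ℓ ] (ℓ < n × (toℕ i + ℓ) % n ≡ toℕ j)
    gap i j = x % n , m%n<n x n , (begin
      (toℕ i + x % n) % n ≡⟨ cong (_% n) (+-comm (toℕ i) (x % n)) ⟩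
      (x % n + toℕ i) % n ≡⟨ %-+ x (toℕ i) n ⟨
      (x + toℕ i) % n ≡⟨ cong (_% n) (trans (+-assoc (toℕ j) (n ∸ toℕ i) (toℕ i)) (cong (toℕ j +_) (m∸n+n≡m (<⇒≤ (toℕ<n i))))) ⟩
      (toℕ j + n) % n ≡⟨ [m+n]%n≡m%n (toℕ j) n ⟩
      toℕ j % n ≡⟨ m<n⇒m%n≡m (toℕ<n j) ⟩
      toℕ j ∎)
      where x = toℕ j + (n ∸ toℕ i)

    ⇒rotated : ∀ {D D′} r → chords D ≈ shift r (chords D′) → Rotated n D D′
    ⇒rotated {D} {D′} r h = r mod n , λ i j → go i j (gap i j)
      where
      go : ∀ i j → ∃[ ℓ ] (ℓ < n × (toℕ i + ℓ) % n ≡ toℕ j) → Mem D i j ≡ Mem D′ (rot n (r mod n) i) (rot n (r mod n) j)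
      go i j (ℓ , ℓ<n , e) = begin
        Mem D i j ≡⟨ cong₂ (Mem D) (mod-toℕ i) (trans (mod-≡ (v + ℓ) (toℕ j) (trans e (sym (m<n⇒m%n≡m (toℕ<n j))))) (mod-toℕ j)) ⟨
        Mem D (v mod n) ((v + ℓ) mod n) ≡⟨ chords-strip D v ℓ ℓ<n ⟨
        chords D v ℓ ≡⟨ h v ℓ ⟩
        chords D′ (v + r) ℓ ≡⟨ chords-strip D′ (v + r) ℓ ℓ<n ⟩
        Mem D′ ((v + r) mod n) ((v + r + ℓ) mod n)
          ≡⟨ cong₂ (Mem D′) (sym (rot-≡ r i)) (trans (mod-≡ (v + r + ℓ) (toℕ j + r) (trans (cong (_% n) (+-swapʳ v r ℓ))
                (trans (%-+ (v + ℓ) r n) (cong (λ x → (x + r) % n) e)))) (sym (rot-≡ r j))) ⟩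
        Mem D′ (rot n (r mod n) i) (rot n (r mod n) j) ∎
        where v = toℕ i

    dissection : Fin m → Config n
    dissection x = config (ends (at x))

    chords-dissection : ∀ x → chords (dissection x) ≈ at x
    chords-dissection x = ≈-trans (toC-cong (cell-config (ends (at x)))) (toC-ends (at-P x))

    numOrbits : NumOrbits n k (length orbits)
    numOrbits = map dissection orbits
      , Allₚ.map⁺ (All.universal (λ x → config-dissection (cyc-dis (at-P x))) orbits)
      , AllPairsₚ.map⁺ (AllPairs.map (λ {x} {y} ≁ rt → ≁ (related x y rt)) (reps-distinct (allFin m)))
      , (λ D d → Anyₚ.map⁺ (Any.map (λ {y} → represented D d y) (reps-complete (allFin m) (∈-allFin (position D d)))))
      , length-map dissection orbits
      where
      related : ∀ x y → Rotated n (dissection x) (dissection y) → x ~ y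
      related x y rt with rotated⇒ {dissection x} {dissection y} rt
      ... | r , h = r , at-inj (≈-trans (≈-sym (chords-dissection x)) (≈-trans h (≈-trans
              (λ v ℓ → chords-dissection y (v + r) ℓ) (≈-sym (at-act r y)))))
      position : ∀ D → IsDissection n k D → Fin m
      position D d = idx (chords D) (toC-cyc (dis-cell D d))
      represented : ∀ D d y → position D d ~ y → Rotated n D (dissection y)
      represented D d y (r , e) = ⇒rotated {D} {dissection y} r (≈-trans (≈-sym (at-idx (chords D) (toC-cyc (dis-cell D d))))
        (≈-trans (λ v ℓ → cong (λ z → at z v ℓ) e) (≈-trans (at-act r y) λ v ℓ → sym (chords-dissection y (v + r) ℓ))))

open Rotations

-- Dissections with n - 6 diagonals fixed by a rotation.

module FixedPoints where
  open import Data.Nat using (_+_; _*_; _≟_)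

  period-∸ : ∀ {C a b} c → Period a C → Period b C → a ≡ b + c → Period c C
  period-∸ {C} c p q e ℓ = periodic-∸ {f = λ v → C v ℓ} c (p ℓ) (q ℓ) e

  period-* : ∀ {C a} d → Period a C → Period (d * a) C
  period-* {C} d p ℓ = periodic-* {f = λ v → C v ℓ} (p ℓ) d

  -- Bézout over ℕ writes the gcd as a difference of multiples of the two periods, in one order or
  -- the other, and periods may be subtracted.
  period-gcd : ∀ {C a b} → Period a C → Period b C → Period (gcd a b) C
  period-gcd {C} {a} {b} p q with Bézout.identity (gcd-GCD a b)
  ... | Bézout.+- x y e = period-∸ {C} (gcd a b) (period-* {C} x p) (period-* {C} y q) (trans (sym e) (+-comm (gcd a b) (y * b)))
  ... | Bézout.-+ x y e = period-∸ {C} (gcd a b) (period-* {C} y q) (period-* {C} x p) (trans (sym e) (+-comm (gcd a b) (x * a)))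

  -- Here T = g - 1, so length g stays admissible: chords of that length, with their rotations,
  -- bound the central cell.
  short-≥3 : ∀ d h {k C} (d≥3 : 3 ≤ d) (lt : 2 * suc h < d * suc h) → Cyc (d * suc h) k C → Period (suc h) C → Fixed.Short d (suc h) h ≤-refl lt C
  short-≥3 d h d≥3 lt c p = no-middle c z<s p

  -- Here n = 2 g and a chord of length g is a diameter. Once `no-diameter` removes it, every chord
  -- has a side of length at most g - 1, whence T = g - 2.
  short-2 : ∀ h {k C} (lt : 2 * suc h < 2 * suc (suc h)) → Cyc (2 * suc (suc h)) (2 * k) C → Period (suc (suc h)) C →
    Fixed.Short 2 (suc (suc h)) h (n≤1+n (suc h)) lt C
  short-2 h {k} {C} lt c p v ℓ e with no-middle c z<s p v ℓ e
  ... | inj₁ ℓ≤g with m≤n⇒m<n∨m≡n ℓ≤g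
  ... | inj₁ (s≤s q) = inj₁ q
  ... | inj₂ refl = ⊥-elim (no-diameter {k} {suc h} (subst (λ n → Cyc n (2 * k) C) (cong (suc (suc h) +_) (+-identityʳ (suc (suc h)))) c) p v e)
  short-2 h {k} {C} lt c p v ℓ e | inj₂ n≤ with ℓ ≟ suc (suc h)
  ... | yes refl = ⊥-elim (no-diameter {k} {suc h} (subst (λ n → Cyc n (2 * k) C) (cong (suc (suc h) +_) (+-identityʳ (suc (suc h)))) c) p v e)
  ... | no ℓ≢g = inj₂ (lin 2 (λ h ℓ → con 2 ⊕ h ≺ ℓ ⇒ 2 ⊛ (con 2 ⊕ h) ≼ ℓ ⊕ (con 1 ⊕ h)) h ℓ
          (≤∧≢⇒< (lin 2 (λ h ℓ → 2 ⊛ (con 2 ⊕ h) ≼ ℓ ⊕ (con 2 ⊕ h) ⇒ con 2 ⊕ h ≼ ℓ) h ℓ n≤) (ℓ≢g ∘ sym)))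

  -- From here on n = 6 + p, and p = n - 6 is the number of diagonals.
  module FixedCounts (p : ℕ) {m : ℕ} (cycs : Enum (Cyc (6 + p) p) m) where
    open Orbits (3 + p) p cycs public

    n : ℕ
    n = 6 + p

    SamePeriods : ℕ → ℕ → Set
    SamePeriods r g = ∀ C → Period n C → (Period r C → Period g C) × (Period g C → Period r C)

    fixed-by-period : ∀ {r g K} → SamePeriods r g → Enum (λ C → Cyc n p C × Period g C) K → fixed r ≡ K
    fixed-by-period {r} same e = enum-unique (periodicEnum r) (enum-map e id id
      (λ C (c , q) → c , proj₂ (same C (Cyc.per c)) q) (λ C (c , q) → c , proj₁ (same C (Cyc.per c)) q)
      id (λ _ _ _ _ → refl) (λ _ _ _ _ h → h))

    transport : ∀ d g k {K} → n ≡ d * g → p ≡ d * k → Enum (λ C → Cyc (d * g) (d * k) C × Period g C) K → Enum (λ C → Cyc n p C × Period g C) K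
    transport d g k {K} e e′ = subst₂ (λ n p → Enum (λ C → Cyc n p C × Period g C) K) (sym e) (sym e′)

    fixed-≥3 : ∀ d h k r → 3 ≤ d → n ≡ d * suc h → p ≡ d * k → SamePeriods r (suc h) → fixed r ≡ num (suc h) k h
    fixed-≥3 d h k r d≥3 e e′ same = fixed-by-period same (transport d (suc h) k e e′
      (Fixed.fixedEnum d (suc h) h ≤-refl lt k (≤-trans z<s d≥3) (λ C → short-≥3 d h d≥3 lt)
        (FamEnum.famEnum ≤-refl (n≤1+n (suc h)) k)))
      where
      lt : 2 * suc h < d * suc h
      lt = *-monoˡ-< (suc h) d≥3

    fixed-2 : ∀ h k r → n ≡ 2 * suc (suc h) → p ≡ 2 * k → SamePeriods r (suc (suc h)) → fixed r ≡ num (suc (suc h)) k h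
    fixed-2 h k r e e′ same = fixed-by-period same (transport 2 (suc (suc h)) k e e′
      (Fixed.fixedEnum 2 (suc (suc h)) h (n≤1+n (suc h)) lt k z<s (λ C → short-2 h {k} lt)
        (FamEnum.famEnum (n≤1+n (suc h)) ≤-refl k)))
      where
      lt : 2 * suc h < 2 * suc (suc h)
      lt = *-monoʳ-< 2 (n<1+n (suc h))

    -- For d at least 3 the diagonals fall into rotation classes of exactly d members, so d divides
    -- p as well as 6 + p. The value d = 2 divides 6 anyway.
    order-∣6 : ∀ d g {C} → 2 ≤ d → n ≡ d * g → Cyc n p C → Period g C → d ∣ 6
    order-∣6 d zero d≥2 e c q with () ← trans e (*-zeroʳ d)
    order-∣6 d (suc h) {C} d≥2 e c q with d ≟ 2
    ... | yes refl = divides 3 refl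
    ... | no d≢2 = ∣m+n∣m⇒∣n {d} {p} {6} (divides (suc h) (trans (+-comm p 6) (trans e (*-comm d (suc h)))))
          (subst (d ∣_) (Fixed.count-split d (suc h) h ≤-refl lt c′ q (short-≥3 d h d≥3 lt c′ q)) (m∣m*n _))
      where
      d≥3 : 3 ≤ d
      d≥3 = ≤∧≢⇒< d≥2 (d≢2 ∘ sym)
      lt : 2 * suc h < d * suc h
      lt = *-monoˡ-< (suc h) d≥3
      c′ : Cyc (d * suc h) p C
      c′ = subst (λ n → Cyc n p C) e c

    -- A fixed table also has period gcd(r, n), so the order n / gcd(r, n) of the rotation divides 6
    -- and r is a multiple of n / 6.
    fixed-support : ∀ r → r < n → fixed r ≢ 0 → ∃[ j ] (j < 6 × 6 * r ≡ j * n)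
    fixed-support zero r<n _ = 0 , s≤s z≤n , refl
    fixed-support r@(suc _) r<n f≢0 with nonempty (fixed r) f≢0 (periodicEnum r)
      where
      nonempty : ∀ K → K ≢ 0 → Enum (λ C → Cyc n p C × Period r C) K → ∃[ C ] (Cyc n p C × Period r C)
      nonempty zero K≢0 _ = ⊥-elim (K≢0 refl)
      nonempty (suc K) _ e = Enum.at e zero , Enum.at-P e zero
    ... | C , c , q with gcd[m,n]∣m r n | gcd[m,n]∣n r n
    ... | divides x er | divides d en = j , j<6 , eq
      where
      g = gcd r n
      d≥2 : 2 ≤ d
      d≥2 = two d en
        where
        two : ∀ d → n ≡ d * g → 2 ≤ d
        two zero ()
        two (suc zero) e = ⊥-elim (n≮n _ (≤-trans r<n (subst (_≤ r) (sym (trans e (+-identityʳ g))) (x-pos x er))))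
          where
          x-pos : ∀ x → r ≡ x * g → g ≤ r
          x-pos zero ()
          x-pos (suc x) e = subst (g ≤_) (sym e) (m≤m+n g (x * g))
        two (suc (suc d)) e = s≤s z<s
      six : d ∣ 6
      six = order-∣6 d g d≥2 en c (period-gcd {C} q (Cyc.per c))
      z = _∣_.quotient six
      -- From r = x g, 6 = z d and n = d g.
      j = x * z
      eq : 6 * r ≡ j * n
      eq = begin
        6 * r ≡⟨ cong₂ _*_ (_∣_.equality six) er ⟩
        (z * d) * (x * g) ≡⟨ lem z d x g ⟩
        x * z * (d * g) ≡⟨ cong (x * z *_) en ⟨
        j * n ∎
        where
        lem : ∀ z d x g → (z * d) * (x * g) ≡ x * z * (d * g)
        lem = solve-∀
      j<6 : j < 6
      j<6 = *-cancelʳ-< n j 6 (subst (_< 6 * n) eq (*-monoʳ-< 6 r<n))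

    δ : ℕ → ℕ → ℕ
    δ j r = 𝟙 (does (6 * r ≟ j * n))

    -- The contribution of the rotation by j n / 6, if that is an integer.
    fixedʲ : ℕ → ℕ
    fixedʲ j = ∑ n (λ r → δ j r * fixed r)

    fixed-split : ∀ r → r < n → fixed r ≡ ∑ 6 (λ j → δ j r * fixed r)
    fixed-split r r<n with fixed r ≟ 0
    ... | yes z = trans z (sym (∑-0 6 λ j _ → trans (cong (δ j r *_) z) (*-zeroʳ (δ j r))))
    ... | no nz with fixed-support r r<n nz
    ... | j , j<6 , e = sym (trans (∑-single 6 (λ j → δ j r * fixed r) j j<6 λ i _ i≢j →
            cong (_* fixed r) (cong 𝟙 (¬true⇒false λ h → i≢j (*-cancelʳ-≡ i j n (trans (sym (does⇒ (6 * r ≟ i * n) h)) e)))))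
          (trans (cong (λ b → 𝟙 b * fixed r) (⇒does (6 * r ≟ j * n) e)) (+-identityʳ _)))

    ∑-fixed : ∑ n fixed ≡ ∑ 6 fixedʲ
    ∑-fixed = trans (∑-cong n fixed-split) (∑-swap n 6 (λ r j → δ j r * fixed r))

    fixedʲ-at : ∀ j r → r < n → 6 * r ≡ j * n → fixedʲ j ≡ fixed r
    fixedʲ-at j r r<n e = trans (∑-single n (λ r → δ j r * fixed r) r r<n λ s _ s≢r →
        cong (_* fixed s) (cong 𝟙 (¬true⇒false λ h → s≢r (*-cancelˡ-≡ s r 6 (trans (does⇒ (6 * s ≟ j * n) h) (sym e))))))
      (trans (cong (λ b → 𝟙 b * fixed r) (⇒does (6 * r ≟ j * n) e)) (+-identityʳ _))

    fixedʲ-none : ∀ j → (∀ r → 6 * r ≢ j * n) → fixedʲ j ≡ 0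
    fixedʲ-none j h = ∑-0 n λ r _ → cong (_* fixed r) (cong 𝟙 (¬true⇒false λ e → h r (does⇒ (6 * r ≟ j * n) e)))

    same-refl : ∀ {g} → SamePeriods g g
    same-refl C _ = id , id

    -- The hypotheses make r and g generate the same subgroup of ℤ/n.
    same-periods : ∀ {r g} q e c → r ≡ q * g → e * r ≡ c * n + g → SamePeriods r g
    same-periods {r} {g} q e c er ec C pn =
        (λ pr → period-∸ {C} g (period-* {C} e pr) (period-* {C} c pn) ec)
      , (λ pg → subst (λ r → Period r C) (sym er) (period-* {C} q pg))

  quotient-of : ∀ d p → d ∣ 6 → d ∣ 6 + p → ∃[ x ] p ≡ d * x
  quotient-of d p d∣6 d∣n with ∣m+n∣m⇒∣n d∣n d∣6
  ... | divides x e = x , trans e (*-comm x d)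

  -- Indices j are grouped by the order of the rotation by j n / 6: order 2 for j = 3, order 3 for 2
  -- and 4, order 6 for 1 and 5. Each group becomes one term of the formula.
  module Values (p : ℕ) {m : ℕ} (cycs : Enum (Cyc (6 + p) p) m) where
    open FixedCounts p cycs public

    value₀ : fixedʲ 0 ≡ m
    value₀ = trans (fixedʲ-at 0 0 z<s refl) fixed-0

    none₃ : ¬ 2 ∣ n → fixedʲ 3 ≡ 0
    none₃ 2∤n = fixedʲ-none 3 λ r e → 2∤n (divides r (trans (lin 2 (λ r n → 6 ⊛ r ≐ 3 ⊛ n ⇒ n ≐ 2 ⊛ r) r n e) (*-comm 2 r)))

    value₃ : ∀ x → p ≡ 2 * x → fixedʲ 3 ≡ num (3 + x) x (1 + x)
    value₃ x e = trans (fixedʲ-at 3 (3 + x)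
        (lin 2 (λ p x → p ≐ 2 ⊛ x ⇒ con 3 ⊕ x ≺ con 6 ⊕ p) p x e)
        (lin 2 (λ p x → p ≐ 2 ⊛ x ⇒ 6 ⊛ (con 3 ⊕ x) ≐ 3 ⊛ (con 6 ⊕ p)) p x e))
      (fixed-2 (1 + x) x (3 + x) (lin 2 (λ p x → p ≐ 2 ⊛ x ⇒ con 6 ⊕ p ≐ 2 ⊛ (con 3 ⊕ x)) p x e) e same-refl)

    none₂₄ : ¬ 3 ∣ n → fixedʲ 2 + fixedʲ 4 ≡ 0
    none₂₄ 3∤n = cong₂ _+_
      (fixedʲ-none 2 λ r e → 3∤n (divides r (trans (lin 2 (λ r n → 6 ⊛ r ≐ 2 ⊛ n ⇒ n ≐ 3 ⊛ r) r n e) (*-comm 3 r))))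
      (fixedʲ-none 4 λ r e → 3∤n (multiple r e))
      where
      multiple : ∀ r → 6 * r ≡ 4 * n → 3 ∣ n
      -- r is two thirds of n, so the witness is s = n - r, a third of n.
      multiple r e = let s , e′ = m≤n⇒∃ {r} {n} (lin 2 (λ r n → 6 ⊛ r ≐ 4 ⊛ n ⇒ r ≼ n) r n e) in
        divides s (trans (lin 3 (λ r n s → 6 ⊛ r ≐ 4 ⊛ n ⇒ r ⊕ s ≐ n ⇒ n ≐ 3 ⊛ s) r n s e e′) (*-comm 3 s))

    value₂₄ : ∀ x → p ≡ 3 * x → fixedʲ 2 + fixedʲ 4 ≡ num (2 + x) x (1 + x) + num (2 + x) x (1 + x)
    value₂₄ x e = cong₂ _+_
      (trans (fixedʲ-at 2 g
          (lin 2 (λ p x → p ≐ 3 ⊛ x ⇒ con 2 ⊕ x ≺ con 6 ⊕ p) p x e)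
          (lin 2 (λ p x → p ≐ 3 ⊛ x ⇒ 6 ⊛ (con 2 ⊕ x) ≐ 2 ⊛ (con 6 ⊕ p)) p x e))
        (fixed-≥3 3 (1 + x) x g ≤-refl n≡ e same-refl))
      (trans (fixedʲ-at 4 (2 * g)
          (lin 2 (λ p x → p ≐ 3 ⊛ x ⇒ 2 ⊛ (con 2 ⊕ x) ≺ con 6 ⊕ p) p x e)
          (lin 2 (λ p x → p ≐ 3 ⊛ x ⇒ 6 ⊛ (2 ⊛ (con 2 ⊕ x)) ≐ 4 ⊛ (con 6 ⊕ p)) p x e))
        (fixed-≥3 3 (1 + x) x (2 * g) ≤-refl n≡ e (same-periods 2 2 1 refl
          (lin 2 (λ p x → p ≐ 3 ⊛ x ⇒ 2 ⊛ (2 ⊛ (con 2 ⊕ x)) ≐ 1 ⊛ (con 6 ⊕ p) ⊕ (con 2 ⊕ x)) p x e))))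
      where
      g = 2 + x
      n≡ : n ≡ 3 * g
      n≡ = lin 2 (λ p x → p ≐ 3 ⊛ x ⇒ con 6 ⊕ p ≐ 3 ⊛ (con 2 ⊕ x)) p x e

    none₁₅ : ¬ 6 ∣ n → fixedʲ 1 + fixedʲ 5 ≡ 0
    none₁₅ 6∤n = cong₂ _+_
      (fixedʲ-none 1 λ r e → 6∤n (divides r (trans (lin 2 (λ r n → 6 ⊛ r ≐ 1 ⊛ n ⇒ n ≐ 6 ⊛ r) r n e) (*-comm 6 r))))
      (fixedʲ-none 5 λ r e → 6∤n (multiple r e))
      where
      multiple : ∀ r → 6 * r ≡ 5 * n → 6 ∣ n
      multiple r e = let s , e′ = m≤n⇒∃ {r} {n} (lin 2 (λ r n → 6 ⊛ r ≐ 5 ⊛ n ⇒ r ≼ n) r n e) in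
        divides s (trans (lin 3 (λ r n s → 6 ⊛ r ≐ 5 ⊛ n ⇒ r ⊕ s ≐ n ⇒ n ≐ 6 ⊛ s) r n s e e′) (*-comm 6 s))

    value₁₅ : ∀ x → p ≡ 6 * x → fixedʲ 1 + fixedʲ 5 ≡ num (1 + x) x x + num (1 + x) x x
    value₁₅ x e = cong₂ _+_
      (trans (fixedʲ-at 1 g
          (lin 2 (λ p x → p ≐ 6 ⊛ x ⇒ con 1 ⊕ x ≺ con 6 ⊕ p) p x e)
          (lin 2 (λ p x → p ≐ 6 ⊛ x ⇒ 6 ⊛ (con 1 ⊕ x) ≐ 1 ⊛ (con 6 ⊕ p)) p x e))
        (fixed-≥3 6 x x g (s≤s (s≤s z<s)) n≡ e same-refl))
      (trans (fixedʲ-at 5 (5 * g)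
          (lin 2 (λ p x → p ≐ 6 ⊛ x ⇒ 5 ⊛ (con 1 ⊕ x) ≺ con 6 ⊕ p) p x e)
          (lin 2 (λ p x → p ≐ 6 ⊛ x ⇒ 6 ⊛ (5 ⊛ (con 1 ⊕ x)) ≐ 5 ⊛ (con 6 ⊕ p)) p x e))
        (fixed-≥3 6 x x (5 * g) (s≤s (s≤s z<s)) n≡ e (same-periods 5 5 4 refl
          (lin 2 (λ p x → p ≐ 6 ⊛ x ⇒ 5 ⊛ (5 ⊛ (con 1 ⊕ x)) ≐ 4 ⊛ (con 6 ⊕ p) ⊕ (con 1 ⊕ x)) p x e))))
      where
      g = 1 + x
      n≡ : n ≡ 6 * g
      n≡ = lin 2 (λ p x → p ≐ 6 ⊛ x ⇒ con 6 ⊕ p ≐ 6 ⊛ (con 1 ⊕ x)) p x e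

    sums : length orbits * n ≡ fixedʲ 0 + fixedʲ 3 + (fixedʲ 2 + fixedʲ 4) + (fixedʲ 1 + fixedʲ 5)
    sums = trans burnside (trans ∑-fixed (lem (fixedʲ 0) (fixedʲ 1) (fixedʲ 2) (fixedʲ 3) (fixedʲ 4) (fixedʲ 5)))
      where
      lem : ∀ a b c d e f → a + (b + (c + (d + (e + (f + 0))))) ≡ a + d + (c + e) + (b + f)
      lem = solve-∀

open FixedPoints

-- Identities for binomial coefficients near the centre.

module Binomials where
  open import Data.Nat using (_+_; _*_)
  open import Data.Nat.Combinatorics using (_C_; nC1≡n; nCk≡nC[n∸k]; nCk+nC[k+1]≡[n+1]C[k+1]; k>n⇒nCk≡0)

  pascal : ∀ n k → suc n C suc k ≡ n C k + n C suc k
  pascal n k = sym (nCk+nC[k+1]≡[n+1]C[k+1] n k)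

  absorption : ∀ n k → suc k * (suc n C suc k) ≡ suc n * (n C k)
  absorption zero zero = refl
  absorption zero (suc k) = trans (cong (suc (suc k) *_) (k>n⇒nCk≡0 {1} {suc (suc k)} (s≤s z<s)))
    (trans (*-zeroʳ (suc (suc k))) (sym (trans (+-identityʳ _) (k>n⇒nCk≡0 {0} {suc k} z<s))))
  absorption (suc n) zero = begin
    1 * (suc (suc n) C 1) ≡⟨ cong (1 *_) (nC1≡n (suc (suc n))) ⟩
    1 * suc (suc n) ≡⟨ *-comm 1 (suc (suc n)) ⟩
    suc (suc n) * 1 ∎
  absorption (suc n) (suc k) = begin
    suc (suc k) * (suc (suc n) C suc (suc k)) ≡⟨ cong (suc (suc k) *_) (pascal (suc n) (suc k)) ⟩
    suc (suc k) * (a + b) ≡⟨ lem₁ k a b ⟩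
    suc k * a + a + suc (suc k) * b ≡⟨ cong₂ (λ x y → x + a + y) (absorption n k) (absorption n (suc k)) ⟩
    suc n * (n C k) + a + suc n * (n C suc k) ≡⟨ lem₂ (suc n) (n C k) a (n C suc k) ⟩
    suc n * (n C k + n C suc k) + a ≡⟨ cong (λ x → suc n * x + a) (pascal n k) ⟨
    suc n * a + a ≡⟨ lem₃ (suc n) a ⟩
    suc (suc n) * a ∎
    where
    a = suc n C suc k
    b = suc n C suc (suc k)
    lem₁ : ∀ k a b → suc (suc k) * (a + b) ≡ suc k * a + a + suc (suc k) * b
    lem₁ = solve-∀
    lem₂ : ∀ n x a y → n * x + a + n * y ≡ n * (x + y) + a
    lem₂ = solve-∀
    lem₃ : ∀ n a → n * a + a ≡ suc n * a
    lem₃ = solve-∀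

  ratio : ∀ k d → suc k * ((k + d) C suc k) ≡ d * ((k + d) C k)
  ratio k d = +-cancelˡ-≡ (suc k * ((k + d) C k)) _ _ (begin
    suc k * ((k + d) C k) + suc k * ((k + d) C suc k) ≡⟨ *-distribˡ-+ (suc k) ((k + d) C k) _ ⟨
    suc k * ((k + d) C k + (k + d) C suc k) ≡⟨ cong (suc k *_) (pascal (k + d) k) ⟨
    suc k * (suc (k + d) C suc k) ≡⟨ absorption (k + d) k ⟩
    suc (k + d) * ((k + d) C k) ≡⟨ *-distribʳ-+ ((k + d) C k) (suc k) d ⟩
    suc k * ((k + d) C k) + d * ((k + d) C k) ∎)

  ratio′ : ∀ {n} k d → n ≡ k + d → suc k * (n C suc k) ≡ d * (n C k)
  ratio′ k d refl = ratio k d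

  odd-symmetric : ∀ {n} j → n ≡ suc (2 * j) → n C suc j ≡ n C j
  odd-symmetric {n} j e = *-cancelˡ-≡ _ _ (suc j) (ratio′ j (suc j) (trans e (lem j)))
    where
    lem : ∀ j → suc (2 * j) ≡ j + suc j
    lem = solve-∀

  central-half : ∀ {n m} j → n ≡ 2 * suc j → m ≡ suc (2 * j) → n C suc j ≡ 2 * (m C j)
  central-half {n} {m} j e refl = begin
    n C suc j ≡⟨ cong (_C suc j) (trans e (lem j)) ⟩
    suc m C suc j ≡⟨ pascal m j ⟩
    m C j + m C suc j ≡⟨ cong (m C j +_) (odd-symmetric j refl) ⟩
    m C j + m C j ≡⟨ cong (m C j +_) (+-identityʳ _) ⟨
    2 * (m C j) ∎
    where
    lem : ∀ j → 2 * suc j ≡ suc (suc (2 * j))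
    lem = solve-∀

  central-step : ∀ j → suc j * ((2 * suc j) C suc j) ≡ 2 * suc (2 * j) * ((2 * j) C j)
  central-step j = begin
    suc j * ((2 * suc j) C suc j) ≡⟨ cong (suc j *_) (central-half {2 * suc j} {suc (2 * j)} j refl refl) ⟩
    suc j * (2 * (suc (2 * j) C j)) ≡⟨ cong (λ x → suc j * (2 * x)) (odd-symmetric {suc (2 * j)} j refl) ⟨
    suc j * (2 * (suc (2 * j) C suc j)) ≡⟨ lem₁ (suc j) (suc (2 * j) C suc j) ⟩
    2 * (suc j * (suc (2 * j) C suc j)) ≡⟨ cong (2 *_) (absorption (2 * j) j) ⟩
    2 * (suc (2 * j) * ((2 * j) C j)) ≡⟨ *-assoc 2 (suc (2 * j)) _ ⟨
    2 * suc (2 * j) * ((2 * j) C j) ∎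
    where
    lem₁ : ∀ a b → a * (2 * b) ≡ 2 * (a * b)
    lem₁ = solve-∀

  C-sym : ∀ a b → (a + b) C b ≡ (a + b) C a
  C-sym a b = trans (nCk≡nC[n∸k] (m≤n+m b a)) (cong ((a + b) C_) (m+n∸n≡m a b))

  C-2 : ∀ n → 2 * (suc n C 2) ≡ suc n * n
  C-2 n = trans (absorption n 1) (cong (suc n *_) (nC1≡n n))

  C-3 : ∀ n → 6 * (suc (suc n) C 3) ≡ suc (suc n) * (suc n * n)
  C-3 n = begin
    6 * (suc (suc n) C 3) ≡⟨ *-assoc 2 3 (suc (suc n) C 3) ⟩
    2 * (3 * (suc (suc n) C 3)) ≡⟨ cong (2 *_) (absorption (suc n) 2) ⟩
    2 * (suc (suc n) * (suc n C 2)) ≡⟨ lem (suc (suc n)) (suc n C 2) ⟩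
    suc (suc n) * (2 * (suc n C 2)) ≡⟨ cong (suc (suc n) *_) (C-2 n) ⟩
    suc (suc n) * (suc n * n) ∎
    where
    lem : ∀ a b → 2 * (a * b) ≡ a * (2 * b)
    lem = solve-∀

  -- By symmetry both binomials have lower entries 3 and 2; the factor 6 clears their denominators.
  slack-6 : ∀ p → 6 * (2 * ((3 + p) C p) + (3 + p) C suc p) ≡ (3 + p) * (2 + p) * (5 + 2 * p)
  slack-6 p = begin
    6 * (2 * ((3 + p) C p) + (3 + p) C suc p) ≡⟨ cong₂ (λ x y → 6 * (2 * x + y)) (C-sym 3 p) swap ⟩
    6 * (2 * ((3 + p) C 3) + (3 + p) C 2) ≡⟨ lem₁ ((3 + p) C 3) ((3 + p) C 2) ⟩
    2 * (6 * ((3 + p) C 3)) + 3 * (2 * ((3 + p) C 2)) ≡⟨ cong₂ (λ x y → 2 * x + 3 * y) (C-3 (1 + p)) (C-2 (2 + p)) ⟩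
    2 * ((3 + p) * ((2 + p) * (1 + p))) + 3 * ((3 + p) * (2 + p)) ≡⟨ lem₂ p ⟩
    (3 + p) * (2 + p) * (5 + 2 * p) ∎
    where
    swap : (3 + p) C suc p ≡ (3 + p) C 2
    swap = begin
      (3 + p) C suc p ≡⟨ cong (_C suc p) (+-suc 2 p) ⟨
      (2 + suc p) C suc p ≡⟨ C-sym 2 (suc p) ⟩
      (2 + suc p) C 2 ≡⟨ cong (_C 2) (+-suc 2 p) ⟩
      (3 + p) C 2 ∎
    lem₁ : ∀ a b → 6 * (2 * a + b) ≡ 2 * (6 * a) + 3 * (2 * b)
    lem₁ = solve-∀
    lem₂ : ∀ p → 2 * ((3 + p) * ((2 + p) * (1 + p))) + 3 * ((3 + p) * (2 + p)) ≡ (3 + p) * (2 + p) * (5 + 2 * p)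
    lem₂ = solve-∀

  -- Two central steps lead from row 2 (4 + p) to row 2 (2 + p), and two ratio steps lead there from
  -- the middle column 2 + p to column p. The factors 3 + p and 4 + p are put in for the central
  -- steps and cancelled at the end.
  central-shift : ∀ p → (2 + p) * ((1 + p) * ((2 * (4 + p)) C (4 + p))) ≡ 4 * ((5 + 2 * p) * ((7 + 2 * p) * ((4 + p + p) C p)))
  central-shift p = *-cancelˡ-≡ _ _ (4 + p) (*-cancelˡ-≡ _ _ (3 + p) (begin
    (3 + p) * ((4 + p) * ((2 + p) * ((1 + p) * c₄))) ≡⟨ lem₁ p c₄ ⟩
    (3 + p) * ((2 + p) * (1 + p)) * ((4 + p) * c₄) ≡⟨ cong ((3 + p) * ((2 + p) * (1 + p)) *_) (central-step (3 + p)) ⟩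
    (3 + p) * ((2 + p) * (1 + p)) * (2 * suc (2 * (3 + p)) * c₃) ≡⟨ lem₂ p c₃ ⟩
    (2 + p) * (1 + p) * (2 * (7 + 2 * p)) * ((3 + p) * c₃) ≡⟨ cong ((2 + p) * (1 + p) * (2 * (7 + 2 * p)) *_) (central-step (2 + p)) ⟩
    (2 + p) * (1 + p) * (2 * (7 + 2 * p)) * (2 * suc (2 * (2 + p)) * c₂) ≡⟨ lem₃ p c₂ ⟩
    4 * (5 + 2 * p) * (7 + 2 * p) * (1 + p) * ((2 + p) * c₂) ≡⟨ cong (4 * (5 + 2 * p) * (7 + 2 * p) * (1 + p) *_) (ratio′ (1 + p) (3 + p) (lem₄ p)) ⟩
    4 * (5 + 2 * p) * (7 + 2 * p) * (1 + p) * ((3 + p) * d₁) ≡⟨ lem₅ p d₁ ⟩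
    4 * (5 + 2 * p) * (7 + 2 * p) * (3 + p) * ((1 + p) * d₁) ≡⟨ cong (4 * (5 + 2 * p) * (7 + 2 * p) * (3 + p) *_) (ratio′ p (4 + p) (lem₆ p)) ⟩
    4 * (5 + 2 * p) * (7 + 2 * p) * (3 + p) * ((4 + p) * ((2 * (2 + p)) C p)) ≡⟨ cong (λ n → 4 * (5 + 2 * p) * (7 + 2 * p) * (3 + p) * ((4 + p) * (n C p))) (lem₇ p) ⟩
    4 * (5 + 2 * p) * (7 + 2 * p) * (3 + p) * ((4 + p) * ((4 + p + p) C p)) ≡⟨ lem₈ p ((4 + p + p) C p) ⟩
    (3 + p) * ((4 + p) * (4 * ((5 + 2 * p) * ((7 + 2 * p) * ((4 + p + p) C p))))) ∎))
    where
    c₄ = (2 * (4 + p)) C (4 + p)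
    c₃ = (2 * (3 + p)) C (3 + p)
    c₂ = (2 * (2 + p)) C (2 + p)
    d₁ = (2 * (2 + p)) C (1 + p)
    lem₁ : ∀ p c → (3 + p) * ((4 + p) * ((2 + p) * ((1 + p) * c))) ≡ (3 + p) * ((2 + p) * (1 + p)) * ((4 + p) * c)
    lem₁ = solve-∀
    lem₂ : ∀ p c → (3 + p) * ((2 + p) * (1 + p)) * (2 * suc (2 * (3 + p)) * c) ≡ (2 + p) * (1 + p) * (2 * (7 + 2 * p)) * ((3 + p) * c)
    lem₂ = solve-∀
    lem₃ : ∀ p c → (2 + p) * (1 + p) * (2 * (7 + 2 * p)) * (2 * suc (2 * (2 + p)) * c) ≡ 4 * (5 + 2 * p) * (7 + 2 * p) * (1 + p) * ((2 + p) * c)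
    lem₃ = solve-∀
    lem₄ : ∀ p → 2 * (2 + p) ≡ 1 + p + (3 + p)
    lem₄ = solve-∀
    lem₅ : ∀ p d → 4 * (5 + 2 * p) * (7 + 2 * p) * (1 + p) * ((3 + p) * d) ≡ 4 * (5 + 2 * p) * (7 + 2 * p) * (3 + p) * ((1 + p) * d)
    lem₅ = solve-∀
    lem₆ : ∀ p → 2 * (2 + p) ≡ p + (4 + p)
    lem₆ = solve-∀
    lem₇ : ∀ p → 2 * (2 + p) ≡ 4 + p + p
    lem₇ = solve-∀
    lem₈ : ∀ p d → 4 * (5 + 2 * p) * (7 + 2 * p) * (3 + p) * ((4 + p) * d) ≡ (3 + p) * ((4 + p) * (4 * ((5 + 2 * p) * ((7 + 2 * p) * d))))
    lem₈ = solve-∀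

open Binomials

-- Each fixed-point count against its Catalan term, with denominators cleared.

module Numerators where
  open import Data.Nat using (_+_; _*_)
  open import Data.Nat.Combinatorics using (_C_; nCn≡1; nC1≡n)

  1+xCx : ∀ x → (1 + x) C x ≡ 1 + x
  1+xCx x = trans (C-sym 1 x) (nC1≡n (1 + x))

  -- The factor 5 + 2 p from `central-shift` is absorbed into the slack weight by `slack-6`, while 7
  -- + 2 p remains as 2 n - 5; 24 is the product of the constants 4 and 6 of these two identities.
  numerator₁ : ∀ p m → (5 + p) * m ≡ ((4 + p + p) C p) * (2 * ((3 + p) C p) + (3 + p) C suc p) →
    (3 + p) * (2 + p) * (2 + p) * (1 + p) * ((2 * (4 + p)) C (4 + p)) * (6 + p)
      ≡ m * (24 * (6 + p) * (2 * (6 + p) ∸ 5) * suc (4 + p))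
  numerator₁ p m e = begin
    (3 + p) * (2 + p) * (2 + p) * (1 + p) * P * (6 + p) ≡⟨ lem₁ p P ⟩
    (3 + p) * (2 + p) * (6 + p) * ((2 + p) * ((1 + p) * P)) ≡⟨ cong ((3 + p) * (2 + p) * (6 + p) *_) (central-shift p) ⟩
    (3 + p) * (2 + p) * (6 + p) * (4 * ((5 + 2 * p) * ((7 + 2 * p) * B))) ≡⟨ lem₂ p B ⟩
    4 * (6 + p) * (7 + 2 * p) * B * ((3 + p) * (2 + p) * (5 + 2 * p)) ≡⟨ cong (4 * (6 + p) * (7 + 2 * p) * B *_) (slack-6 p) ⟨
    4 * (6 + p) * (7 + 2 * p) * B * (6 * W) ≡⟨ lem₃ p B W ⟩
    24 * (6 + p) * (7 + 2 * p) * (B * W) ≡⟨ cong (24 * (6 + p) * (7 + 2 * p) *_) e ⟨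
    24 * (6 + p) * (7 + 2 * p) * ((5 + p) * m) ≡⟨ lem₄ p m ⟩
    m * (24 * (6 + p) * (7 + 2 * p) * suc (4 + p)) ≡⟨ cong (λ x → m * (24 * (6 + p) * x * suc (4 + p))) (lem₅ p) ⟨
    m * (24 * (6 + p) * (2 * (6 + p) ∸ 5) * suc (4 + p)) ∎
    where
    P = (2 * (4 + p)) C (4 + p)
    B = ((4 + p) + p) C p
    W = 2 * ((3 + p) C p) + (3 + p) C suc p
    lem₁ : ∀ p P → (3 + p) * (2 + p) * (2 + p) * (1 + p) * P * (6 + p) ≡ (3 + p) * (2 + p) * (6 + p) * ((2 + p) * ((1 + p) * P))
    lem₁ = solve-∀
    lem₂ : ∀ p B → (3 + p) * (2 + p) * (6 + p) * (4 * ((5 + 2 * p) * ((7 + 2 * p) * B))) ≡ 4 * (6 + p) * (7 + 2 * p) * B * ((3 + p) * (2 + p) * (5 + 2 * p))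
    lem₂ = solve-∀
    lem₃ : ∀ p B W → 4 * (6 + p) * (7 + 2 * p) * B * (6 * W) ≡ 24 * (6 + p) * (7 + 2 * p) * (B * W)
    lem₃ = solve-∀
    lem₄ : ∀ p m → 24 * (6 + p) * (7 + 2 * p) * ((5 + p) * m) ≡ m * (24 * (6 + p) * (7 + 2 * p) * suc (4 + p))
    lem₄ = solve-∀
    lem₅ : ∀ p → suc (p + (6 + p + 0)) ≡ 7 + 2 * p
    lem₅ = solve-∀

  -- With n = 6 + 2 x the Catalan index n/2 - 2 is 1 + x. One ratio step from the middle column to
  -- column x gives the first factor of `num`, and its second factor is 1 + x.
  numerator₂ : ∀ p x → p ≡ 2 * x →
    (2 + p) * (2 + p) * ((2 * (1 + x)) C (1 + x)) * (6 + p) ≡ num (3 + x) x (1 + x) * (4 * (6 + p) * (2 + x))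
  numerator₂ _ x refl = begin
    (2 + 2 * x) * (2 + 2 * x) * P * (6 + 2 * x) ≡⟨ lem₁ x P ⟩
    4 * (1 + x) * (6 + 2 * x) * ((1 + x) * P) ≡⟨ cong (4 * (1 + x) * (6 + 2 * x) *_) (ratio′ x (2 + x) (lem₂ x)) ⟩
    4 * (1 + x) * (6 + 2 * x) * ((2 + x) * ((2 * (1 + x)) C x)) ≡⟨ cong (λ n → 4 * (1 + x) * (6 + 2 * x) * ((2 + x) * (n C x))) (lem₃ x) ⟩
    4 * (1 + x) * (6 + 2 * x) * ((2 + x) * Y) ≡⟨ lem₄ x Y ⟩
    Y * (1 + x) * (4 * (6 + 2 * x) * (2 + x)) ≡⟨ cong (λ z → Y * z * (4 * (6 + 2 * x) * (2 + x))) (1+xCx x) ⟨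
    Y * ((1 + x) C x) * (4 * (6 + 2 * x) * (2 + x)) ≡⟨ cong (_* (4 * (6 + 2 * x) * (2 + x))) (num≡ (3 + x) x (1 + x)) ⟨
    num (3 + x) x (1 + x) * (4 * (6 + 2 * x) * (2 + x)) ∎
    where
    P = (2 * (1 + x)) C (1 + x)
    Y = (2 + x + x) C x
    lem₁ : ∀ x P → (2 + 2 * x) * (2 + 2 * x) * P * (6 + 2 * x) ≡ 4 * (1 + x) * (6 + 2 * x) * ((1 + x) * P)
    lem₁ = solve-∀
    lem₂ : ∀ x → 2 * (1 + x) ≡ x + (2 + x)
    lem₂ = solve-∀
    lem₃ : ∀ x → 2 * (1 + x) ≡ 2 + x + x
    lem₃ = solve-∀
    lem₄ : ∀ x Y → 4 * (1 + x) * (6 + 2 * x) * ((2 + x) * Y) ≡ Y * (1 + x) * (4 * (6 + 2 * x) * (2 + x))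
    lem₄ = solve-∀

  -- The central binomial is twice its neighbour in the odd row above; this 2 matches the two
  -- rotations of order 3.
  numerator₃ : ∀ p x → p ≡ 3 * x →
    (3 + p) * ((2 * (1 + x)) C (1 + x)) * (6 + p) ≡ (num (2 + x) x (1 + x) + num (2 + x) x (1 + x)) * (9 * (2 + x))
  numerator₃ _ x refl = begin
    (3 + 3 * x) * ((2 * (1 + x)) C (1 + x)) * (6 + 3 * x) ≡⟨ cong (λ z → (3 + 3 * x) * z * (6 + 3 * x)) (central-half {2 * (1 + x)} {1 + x + x} x refl (lem₁ x)) ⟩
    (3 + 3 * x) * (2 * Z) * (6 + 3 * x) ≡⟨ lem₂ x Z ⟩
    (Z * (1 + x) + Z * (1 + x)) * (9 * (2 + x)) ≡⟨ cong (λ z → (Z * z + Z * z) * (9 * (2 + x))) (1+xCx x) ⟨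
    (Z * ((1 + x) C x) + Z * ((1 + x) C x)) * (9 * (2 + x)) ≡⟨ cong (λ z → (z + z) * (9 * (2 + x))) (num≡ (2 + x) x (1 + x)) ⟨
    (num (2 + x) x (1 + x) + num (2 + x) x (1 + x)) * (9 * (2 + x)) ∎
    where
    Z = (1 + x + x) C x
    lem₁ : ∀ x → 1 + x + x ≡ suc (2 * x)
    lem₁ = solve-∀
    lem₂ : ∀ x Z → (3 + 3 * x) * (2 * Z) * (6 + 3 * x) ≡ (Z * (1 + x) + Z * (1 + x)) * (9 * (2 + x))
    lem₂ = solve-∀

  numerator₆ : ∀ p x → p ≡ 6 * x →
    1 * ((2 * x) C x) * (6 + p) ≡ (num (1 + x) x x + num (1 + x) x x) * (3 * (1 + x))
  numerator₆ _ x refl = begin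
    1 * ((2 * x) C x) * (6 + 6 * x) ≡⟨ cong (λ n → 1 * (n C x) * (6 + 6 * x)) (cong (λ y → x + y) (+-identityʳ x)) ⟩
    1 * V * (6 + 6 * x) ≡⟨ lem x V ⟩
    (V * 1 + V * 1) * (3 * (1 + x)) ≡⟨ cong (λ z → (V * z + V * z) * (3 * (1 + x))) (nCn≡1 x) ⟨
    (V * (x C x) + V * (x C x)) * (3 * (1 + x)) ≡⟨ cong (λ z → (z + z) * (3 * (1 + x))) (num≡ (1 + x) x x) ⟨
    (num (1 + x) x x + num (1 + x) x x) * (3 * (1 + x)) ∎
    where
    V = (x + x) C x
    lem : ∀ x V → 1 * V * (6 + 6 * x) ≡ (V * 1 + V * 1) * (3 * (1 + x))
    lem = solve-∀

open Numerators

-- Rational arithmetic, the four terms and their sum.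

open import Data.Nat.Combinatorics using (_C_)
open import Data.Nat.Coprimality using (1-coprimeTo) renaming (sym to coprime-sym)
open import Data.Integer as ℤ using (+_; -[1+_])
import Data.Integer.Properties as ℤ
open import Data.Rational as ℚ using (ℚ; mkℚ; _+_; _*_; _-_; fromℚᵘ; toℚᵘ; 0ℚ)
import Data.Rational.Properties as ℚ
open import Data.Rational.Unnormalised as ℚᵘ using (ℚᵘ; mkℚᵘ; *≡*)
import Data.Rational.Unnormalised.Properties as ℚᵘ

fromℚᵘ-homo-* : ∀ p q → fromℚᵘ p * fromℚᵘ q ≡ fromℚᵘ (p ℚᵘ.* q)
fromℚᵘ-homo-* p q = ℚ.toℚᵘ-injective (ℚᵘ.≃-trans (ℚ.toℚᵘ-homo-* (fromℚᵘ p) (fromℚᵘ q))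
  (ℚᵘ.≃-trans (ℚᵘ.*-cong (ℚ.toℚᵘ-fromℚᵘ p) (ℚ.toℚᵘ-fromℚᵘ q)) (ℚᵘ.≃-sym (ℚ.toℚᵘ-fromℚᵘ (p ℚᵘ.* q)))))

fromℚᵘ-homo-+ : ∀ p q → fromℚᵘ p + fromℚᵘ q ≡ fromℚᵘ (p ℚᵘ.+ q)
fromℚᵘ-homo-+ p q = ℚ.toℚᵘ-injective (ℚᵘ.≃-trans (ℚ.toℚᵘ-homo-+ (fromℚᵘ p) (fromℚᵘ q))
  (ℚᵘ.≃-trans (ℚᵘ.+-cong (ℚ.toℚᵘ-fromℚᵘ p) (ℚ.toℚᵘ-fromℚᵘ q)) (ℚᵘ.≃-sym (ℚ.toℚᵘ-fromℚᵘ (p ℚᵘ.+ q)))))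

frac-≡ : ∀ a b c d → 0 < b → 0 < d → a ℕ.* d ≡ c ℕ.* b → frac (+ a) b ≡ frac (+ c) d
frac-≡ a (suc b) c (suc d) _ _ e = ℚ.fromℚᵘ-cong {mkℚᵘ (+ a) b} {mkℚᵘ (+ c) d}
  (*≡* (trans (sym (ℤ.pos-* a (suc d))) (trans (cong +_ e) (ℤ.pos-* c (suc b)))))

frac-inj : ∀ a b c d → 0 < b → 0 < d → frac (+ a) b ≡ frac (+ c) d → a ℕ.* d ≡ c ℕ.* b
frac-inj a (suc b) c (suc d) _ _ e with ℚᵘ.≃-trans (ℚᵘ.≃-sym (ℚ.toℚᵘ-fromℚᵘ (mkℚᵘ (+ a) b)))
    (ℚᵘ.≃-trans (ℚᵘ.≃-reflexive (cong toℚᵘ e)) (ℚ.toℚᵘ-fromℚᵘ (mkℚᵘ (+ c) d)))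
... | *≡* h = ℤ.+-injective (trans (ℤ.pos-* a (suc d)) (trans h (sym (ℤ.pos-* c (suc b)))))

frac-* : ∀ a b c d → 0 < b → 0 < d → frac (+ a) b * frac (+ c) d ≡ frac (+ (a ℕ.* c)) (b ℕ.* d)
frac-* a (suc b) c (suc d) _ _ = trans (fromℚᵘ-homo-* (mkℚᵘ (+ a) b) (mkℚᵘ (+ c) d))
  (cong (λ z → fromℚᵘ (mkℚᵘ z (d ℕ.+ b ℕ.* suc d))) (sym (ℤ.pos-* a c)))

frac-+ : ∀ a b n → 0 < n → frac (+ a) n + frac (+ b) n ≡ frac (+ (a ℕ.+ b)) n
frac-+ a b (suc n) _ = trans (fromℚᵘ-homo-+ (mkℚᵘ (+ a) n) (mkℚᵘ (+ b) n))
  (trans (cong (λ z → fromℚᵘ (mkℚᵘ z (n ℕ.+ n ℕ.* suc n)))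
      (trans (cong₂ ℤ._+_ (sym (ℤ.pos-* a (suc n))) (sym (ℤ.pos-* b (suc n)))) (sym (ℤ.pos-+ (a ℕ.* suc n) (b ℕ.* suc n)))))
    (frac-≡ (a ℕ.* suc n ℕ.+ b ℕ.* suc n) (suc n ℕ.* suc n) (a ℕ.+ b) (suc n) z<s z<s (lem a b (suc n))))
  where
  lem : ∀ a b n → (a ℕ.* n ℕ.+ b ℕ.* n) ℕ.* n ≡ (a ℕ.+ b) ℕ.* (n ℕ.* n)
  lem = solve-∀

term : ∀ a b c d G n → 0 < b → 0 < d → 0 < n → a ℕ.* c ℕ.* n ≡ G ℕ.* (b ℕ.* d) → frac (+ a) b * frac (+ c) d ≡ frac (+ G) n
term a b@(suc _) c d@(suc _) G n 0<b 0<d 0<n e = trans (frac-* a b c d 0<b 0<d) (frac-≡ (a ℕ.* c) (b ℕ.* d) G n z<s 0<n e)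

-- `Cat` inspects the reduced fraction, so k / 1 must first be recognised as already in lowest
-- terms.
Cat-ℕ : ∀ k → Cat (frac (+ k) 1) ≡ frac (+ ((2 ℕ.* k) C k)) (suc k)
Cat-ℕ k = cong Cat (ℚ.↥p/↧p≡p (mkℚ (+ k) 0 (coprime-sym (1-coprimeTo k))))

Cat-cases : ∀ q → Cat q ≡ 0ℚ ⊎ ∃[ k ] q ≡ frac (+ k) 1
Cat-cases q@(mkℚ (+ k) zero _) = inj₂ (k , sym (ℚ.↥p/↧p≡p q))
Cat-cases (mkℚ (+ k) (suc _) _) = inj₁ refl
Cat-cases (mkℚ -[1+ k ] _ _) = inj₁ refl

private
  add-sub : ∀ x y → x + y - y ≡ x
  add-sub x y = trans (ℚ.+-assoc x y (ℚ.- y)) (trans (cong (λ z → x + z) (ℚ.+-inverseʳ y)) (ℚ.+-identityʳ x))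

  sub-add : ∀ x y → x - y + y ≡ x
  sub-add x y = trans (ℚ.+-assoc x (ℚ.- y) y) (trans (cong (λ z → x + z) (ℚ.+-inverseˡ y)) (ℚ.+-identityʳ x))

Cat-integral : ∀ n d c k → 0 < d → n ≡ (k ℕ.+ c) ℕ.* d → Cat (frac (+ n) d - frac (+ c) 1) ≡ frac (+ ((2 ℕ.* k) C k)) (suc k)
Cat-integral n d c k 0<d e = trans (cong Cat (trans (cong (_- frac (+ c) 1)
    (trans (frac-≡ n d (k ℕ.+ c) 1 0<d z<s (trans (*-identityʳ n) e)) (sym (frac-+ k c 1 z<s))))
    (add-sub (frac (+ k) 1) (frac (+ c) 1)))) (Cat-ℕ k)

-- A nonzero value would make the argument a natural number k, and then n = (k + c) d.
Cat-fractional : ∀ n d c → 0 < d → ¬ d ∣ n → Cat (frac (+ n) d - frac (+ c) 1) ≡ 0ℚ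
Cat-fractional n d c 0<d d∤n with Cat-cases (frac (+ n) d - frac (+ c) 1)
... | inj₁ e = e
... | inj₂ (k , e) = ⊥-elim (d∤n (divides (k ℕ.+ c) (trans (sym (*-identityʳ n)) (frac-inj n d (k ℕ.+ c) 1 0<d z<s
        (trans (sym (sub-add (frac (+ n) d) (frac (+ c) 1))) (trans (cong (λ z → z + frac (+ c) 1) e) (frac-+ k c 1 z<s)))))))

term-0 : ∀ q {c} G n → 0 < n → c ≡ 0ℚ → G ≡ 0 → q * c ≡ frac (+ G) n
term-0 q G n 0<n refl refl = trans (ℚ.*-zeroʳ q) (frac-≡ 0 1 0 n z<s 0<n refl)

term₁ : ∀ p m → (5 ℕ.+ p) ℕ.* m ≡ ((4 ℕ.+ p ℕ.+ p) C p) ℕ.* (2 ℕ.* ((3 ℕ.+ p) C p) ℕ.+ (3 ℕ.+ p) C suc p) → let n = 6 ℕ.+ p in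
  frac ((+ n ℤ.- + 3) ℤ.* (+ n ℤ.- + 4) ℤ.* (+ n ℤ.- + 4) ℤ.* (+ n ℤ.- + 5)) (24 ℕ.* n ℕ.* (2 ℕ.* n ∸ 5))
    * Cat (frac (+ n ℤ.- + 2) 1) ≡ frac (+ m) n
-- Since n = 6 + p, the integer differences n - 2, ..., n - 5 evaluate to 4 + p, ..., 1 + p.
term₁ p m e = trans (cong (frac (+ ((3 ℕ.+ p) ℕ.* (2 ℕ.+ p) ℕ.* (2 ℕ.+ p) ℕ.* (1 ℕ.+ p))) (24 ℕ.* n ℕ.* (2 ℕ.* n ∸ 5)) *_) (Cat-ℕ (4 ℕ.+ p)))
  (term ((3 ℕ.+ p) ℕ.* (2 ℕ.+ p) ℕ.* (2 ℕ.+ p) ℕ.* (1 ℕ.+ p)) (24 ℕ.* n ℕ.* (2 ℕ.* n ∸ 5))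
    ((2 ℕ.* (4 ℕ.+ p)) C (4 ℕ.+ p)) (suc (4 ℕ.+ p)) m n z<s z<s z<s (numerator₁ p m e))
  where
  n = 6 ℕ.+ p

-- The fixed-point count f and the Catalan number vanish together when d does not divide n;
-- otherwise the claim reduces to an identity of natural numbers.
term-by-divisibility : ∀ A B n d c f → 0 < B → 0 < d → 0 < n → (¬ d ∣ n → f ≡ 0) →
  (d ∣ n → ∃[ k ] (n ≡ (k ℕ.+ c) ℕ.* d × A ℕ.* ((2 ℕ.* k) C k) ℕ.* n ≡ f ℕ.* (B ℕ.* suc k))) →
  frac (+ A) B * Cat (frac (+ n) d - frac (+ c) 1) ≡ frac (+ f) n
term-by-divisibility A B n d c f 0<B 0<d 0<n f-no f-yes with d ∣? n
... | no d∤n = term-0 (frac (+ A) B) f n 0<n (Cat-fractional n d c 0<d d∤n) (f-no d∤n)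
... | yes d∣n = let k , e , eq = f-yes d∣n in
  trans (cong (frac (+ A) B *_) (Cat-integral n d c k 0<d e)) (term A B ((2 ℕ.* k) C k) (suc k) f n 0<B z<s 0<n eq)

term₂ : ∀ p f → (¬ 2 ∣ 6 ℕ.+ p → f ≡ 0) → (∀ x → p ≡ 2 ℕ.* x → f ≡ num (3 ℕ.+ x) x (1 ℕ.+ x)) → let n = 6 ℕ.+ p in
  frac ((+ n ℤ.- + 4) ℤ.* (+ n ℤ.- + 4)) (4 ℕ.* n) * Cat (frac (+ n) 2 - frac (+ 2) 1) ≡ frac (+ f) n
term₂ p f f-no f-yes =
  term-by-divisibility ((2 ℕ.+ p) ℕ.* (2 ℕ.+ p)) (4 ℕ.* n) n 2 2 f z<s z<s z<s f-no λ 2∣n →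
    let x , e = quotient-of 2 p (divides 3 refl) 2∣n in
    1 ℕ.+ x , trans (cong (6 ℕ.+_) e) (lem x) , trans (numerator₂ p x e) (cong (ℕ._* (4 ℕ.* n ℕ.* (2 ℕ.+ x))) (sym (f-yes x e)))
  where
  n = 6 ℕ.+ p
  lem : ∀ x → 6 ℕ.+ 2 ℕ.* x ≡ ((1 ℕ.+ x) ℕ.+ 2) ℕ.* 2
  lem = solve-∀

term₃ : ∀ p f → (¬ 3 ∣ 6 ℕ.+ p → f ≡ 0) →
  (∀ x → p ≡ 3 ℕ.* x → f ≡ num (2 ℕ.+ x) x (1 ℕ.+ x) ℕ.+ num (2 ℕ.+ x) x (1 ℕ.+ x)) → let n = 6 ℕ.+ p in
  frac (+ n ℤ.- + 3) 9 * Cat (frac (+ n) 3 - frac (+ 1) 1) ≡ frac (+ f) n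
term₃ p f f-no f-yes = term-by-divisibility (3 ℕ.+ p) 9 n 3 1 f z<s z<s z<s f-no λ 3∣n →
    let x , e = quotient-of 3 p (divides 2 refl) 3∣n in
    1 ℕ.+ x , trans (cong (6 ℕ.+_) e) (lem x) , trans (numerator₃ p x e) (cong (ℕ._* (9 ℕ.* (2 ℕ.+ x))) (sym (f-yes x e)))
  where
  n = 6 ℕ.+ p
  lem : ∀ x → 6 ℕ.+ 3 ℕ.* x ≡ ((1 ℕ.+ x) ℕ.+ 1) ℕ.* 3
  lem = solve-∀

term₆ : ∀ p f → (¬ 6 ∣ 6 ℕ.+ p → f ≡ 0) →
  (∀ x → p ≡ 6 ℕ.* x → f ≡ num (1 ℕ.+ x) x x ℕ.+ num (1 ℕ.+ x) x x) → let n = 6 ℕ.+ p in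
  frac (+ 1) 3 * Cat (frac (+ n) 6 - frac (+ 1) 1) ≡ frac (+ f) n
term₆ p f f-no f-yes = term-by-divisibility 1 3 n 6 1 f z<s z<s z<s f-no λ 6∣n →
    let x , e = quotient-of 6 p (divides 1 refl) 6∣n in
    x , trans (cong (6 ℕ.+_) e) (lem x) , trans (numerator₆ p x e) (cong (ℕ._* (3 ℕ.* (1 ℕ.+ x))) (sym (f-yes x e)))
  where
  n = 6 ℕ.+ p
  lem : ∀ x → 6 ℕ.+ 6 ℕ.* x ≡ (x ℕ.+ 1) ℕ.* 6
  lem = solve-∀

frac-sum : ∀ c n a b d e {q₁ q₂ q₃ q₄} → 0 < n → c ℕ.* n ≡ a ℕ.+ b ℕ.+ d ℕ.+ e →
  q₁ ≡ frac (+ a) n → q₂ ≡ frac (+ b) n → q₃ ≡ frac (+ d) n → q₄ ≡ frac (+ e) n → frac (+ c) 1 ≡ q₁ + q₂ + q₃ + q₄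
frac-sum c n a b d e 0<n sums refl refl refl refl = begin
  frac (+ c) 1 ≡⟨ frac-≡ c 1 (a ℕ.+ b ℕ.+ d ℕ.+ e) n z<s 0<n (trans sums (sym (*-identityʳ _))) ⟩
  frac (+ (a ℕ.+ b ℕ.+ d ℕ.+ e)) n ≡⟨ frac-+ (a ℕ.+ b ℕ.+ d) e n 0<n ⟨
  frac (+ (a ℕ.+ b ℕ.+ d)) n + frac (+ e) n ≡⟨ cong (λ q → q + frac (+ e) n) (frac-+ (a ℕ.+ b) d n 0<n) ⟨
  frac (+ (a ℕ.+ b)) n + frac (+ d) n + frac (+ e) n ≡⟨ cong (λ q → q + frac (+ d) n + frac (+ e) n) (frac-+ a b n 0<n) ⟨
  frac (+ a) n + frac (+ b) n + frac (+ d) n + frac (+ e) n ∎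

OrbitFormula : (n : ℕ) → .{{_ : NonZero n}} → Set
OrbitFormula n =
    ∃[ c ] (NumOrbits n (n ∸ 6) c
    × frac (+ c) 1 ≡
    frac ((+ n ℤ.- + 3) ℤ.* (+ n ℤ.- + 4) ℤ.* (+ n ℤ.- + 4) ℤ.* (+ n ℤ.- + 5)) (24 ℕ.* n ℕ.* (2 ℕ.* n ∸ 5))
    * Cat (frac (+ n ℤ.- + 2) 1)
    + frac ((+ n ℤ.- + 4) ℤ.* (+ n ℤ.- + 4)) (4 ℕ.* n) * Cat (frac (+ n) 2 - frac (+ 2) 1)
    + frac (+ n ℤ.- + 3) 9 * Cat (frac (+ n) 3 - frac (+ 1) 1)
    + frac (+ 1) 3 * Cat (frac (+ n) 6 - frac (+ 1) 1))

orbit-formula : ∀ p {m} → Enum (Cyc (6 ℕ.+ p) p) m →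
  (5 ℕ.+ p) ℕ.* m ≡ multichoose (5 ℕ.+ p) p ℕ.* slack-weight (3 ℕ.+ p) p → OrbitFormula (6 ℕ.+ p)
orbit-formula p {m} cycs m-eq = length V.orbits , V.numOrbits ,
    frac-sum (length V.orbits) (6 ℕ.+ p) m (V.fixedʲ 3) (V.fixedʲ 2 ℕ.+ V.fixedʲ 4) (V.fixedʲ 1 ℕ.+ V.fixedʲ 5) z<s
      (trans V.sums (cong (λ f → f ℕ.+ V.fixedʲ 3 ℕ.+ (V.fixedʲ 2 ℕ.+ V.fixedʲ 4) ℕ.+ (V.fixedʲ 1 ℕ.+ V.fixedʲ 5)) V.value₀))
      (term₁ p m m-eq)
      (term₂ p (V.fixedʲ 3) V.none₃ V.value₃)
      (term₃ p (V.fixedʲ 2 ℕ.+ V.fixedʲ 4) V.none₂₄ V.value₂₄)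
      (term₆ p (V.fixedʲ 1 ℕ.+ V.fixedʲ 5) V.none₁₅ V.value₁₅)
  where module V = Values p cycs

theorem4 : (n : ℕ) .{{_ : NonZero n}} → 6 ≤ n →
    ∃[ c ] (NumOrbits n (n ∸ 6) c
    × frac (+ c) 1 ≡
    frac ((+ n ℤ.- + 3) ℤ.* (+ n ℤ.- + 4) ℤ.* (+ n ℤ.- + 4) ℤ.* (+ n ℤ.- + 5)) (24 ℕ.* n ℕ.* (2 ℕ.* n ∸ 5))
    * Cat (frac (+ n ℤ.- + 2) 1)
    + frac ((+ n ℤ.- + 4) ℤ.* (+ n ℤ.- + 4)) (4 ℕ.* n) * Cat (frac (+ n) 2 - frac (+ 2) 1)
    + frac (+ n ℤ.- + 3) 9 * Cat (frac (+ n) 3 - frac (+ 1) 1)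
    + frac (+ 1) 3 * Cat (frac (+ n) 6 - frac (+ 1) 1))
theorem4 n 6≤n = go (m≤n⇒∃ 6≤n)
  where
  go : ∃[ p ] 6 ℕ.+ p ≡ n → OrbitFormula n
  -- `Linear` and `RootedCount` at T treat the polygon with 3 + T vertices, whence T = 3 + p.
  go (p , refl) = orbit-formula p (Linear.cycEnum (3 ℕ.+ p) p) (RootedCount.rooted-total (3 ℕ.+ p) p)
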